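{- For every graph $H$ there is a polynomial $p$ such that for every positive integer $s$, every graph $G$ that does not contain $K_{s,s}$ as a (not necessarily induced) subgraph and does not contain an induced subgraph isomorphic to a subdivision of $H$ has average degree at most $p(s)$.
   Context: A subdivision of a graph $H$ is any graph obtained from $H$ by replacing edges by (possibly) longer paths (with new internal vertices). All graphs are finite and simple. -}

module Defs where

open import Data.Nat using (ℕ; zero; suc; _+_; _*_; _≤_; _<_)
open import Data.Nat.Properties using (_<?_)
open import Data.Fin using (Fin; toℕ)
open import Data.Bool using (Bool; true; false; T; _∧_; if_then_else_)
open import Data.List using (List; []; _∷_; map)
open import Data.Nat.ListAction using (sum)
open import Data.Fin.Base using ()
open import Data.List using (allFin)
open import Data.Product using (Σ; _×_; _,_)
open import Data.Sum using (_⊎_; inj₁; inj₂)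
open import Relation.Nullary.Decidable using (⌊_⌋)
open import Relation.Binary.PropositionalEquality using (_≡_)
open import Function.Definitions using (Injective)

record Graph : Set where
  field
    n     : ℕ
    adj   : Fin n → Fin n → Bool
    sym   : ∀ u v → adj u v ≡ adj v u
    irrefl : ∀ v → adj v v ≡ false
open Graph public

deg : (G : Graph) → Fin (n G) → ℕ
deg G v = sum (map (λ u → if adj G v u then 1 else 0) (allFin (n G)))

degSum : Graph → ℕ
degSum G = sum (map (deg G) (allFin (n G)))

-- "G has average degree at most d":  degSum G / |V(G)| ≤ d, cleared of the
-- denominator (vacuous for the empty graph).
AvgDegAtMost : Graph → ℕ → Set
AvgDegAtMost G d = degSum G ≤ d * n G

Poly : Set
Poly = List ℕ

eval : Poly → ℕ → ℕ
eval []       x = 0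
eval (c ∷ cs) x = c + x * eval cs x

ContainsKss : ℕ → Graph → Set
ContainsKss s G =
  Σ (Fin s ⊎ Fin s → Fin (n G)) λ φ →
    Injective _≡_ _≡_ φ × (∀ i j → adj G (φ (inj₁ i)) (φ (inj₂ j)) ≡ true)

-- Subdivisions of a graph H.
-- An edge of H is represented by the ordered pair (i , j) with i < j.
-- A subdivision is determined by a length function ℓ : each edge {i,j}
-- (i < j) is replaced by the path  i - (e,0) - (e,1) - ... - (e,ℓ-1) - j
-- with ℓ i j new internal vertices.

FwdEdge : (H : Graph) → Fin (n H) → Fin (n H) → Bool
FwdEdge H i j = adj H i j ∧ ⌊ toℕ i <? toℕ j ⌋

Lengths : Graph → Set
Lengths H = Fin (n H) → Fin (n H) → ℕ

lenU : (H : Graph) → Lengths H → Fin (n H) → Fin (n H) → ℕ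
lenU H ℓ i j = if ⌊ toℕ i <? toℕ j ⌋ then ℓ i j else ℓ j i

SubV : (H : Graph) → Lengths H → Set
SubV H ℓ = Fin (n H) ⊎
  (Σ (Fin (n H)) λ i → Σ (Fin (n H)) λ j → T (FwdEdge H i j) × Fin (ℓ i j))

SubAdj : (H : Graph) (ℓ : Lengths H) → SubV H ℓ → SubV H ℓ → Set
SubAdj H ℓ (inj₁ u) (inj₁ v) = T (adj H u v) × lenU H ℓ u v ≡ 0
SubAdj H ℓ (inj₁ v) (inj₂ (i , j , _ , k)) =
  (v ≡ i × toℕ k ≡ 0) ⊎ (v ≡ j × suc (toℕ k) ≡ ℓ i j)
SubAdj H ℓ (inj₂ (i , j , _ , k)) (inj₁ v) =
  (v ≡ i × toℕ k ≡ 0) ⊎ (v ≡ j × suc (toℕ k) ≡ ℓ i j)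
SubAdj H ℓ (inj₂ (i , j , _ , k)) (inj₂ (i' , j' , _ , k')) =
  i ≡ i' × j ≡ j' × (suc (toℕ k) ≡ toℕ k' ⊎ suc (toℕ k') ≡ toℕ k)

ContainsInducedSubdivision : Graph → Graph → Set
ContainsInducedSubdivision H G =
  Σ (Lengths H) λ ℓ → Σ (SubV H ℓ → Fin (n G)) λ φ →
    Injective _≡_ _≡_ φ ×
    (∀ u v → (SubAdj H ℓ u v → adj G (φ u) (φ v) ≡ true)
           × (adj G (φ u) (φ v) ≡ true → SubAdj H ℓ u v))

{-# OPTIONS --safe #-}
module Submission where

-- It suffices to find an induced 1-subdivision of a graph F of large constant average degree: by Mader's theorem F
-- contains a subdivision of H, and the incidences along it form an induced subdivision of H in G.
--
-- If two sets X, Y of size polynomial in s have density at least 1 / q, then already the complete graph on |H| vertices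
-- can be taken as F.  Indeed, in a graph without K_{s,s} all but s vertices a miss a 1 / (2 s) fraction of a given set,
-- so branch vertices can be picked one by one from X, keeping the set of common private neighbours of any two large.
--
-- Otherwise G is locally sparse.  Let d be its degeneracy, orient every edge so that each vertex has at most d left
-- neighbours, and take a subgraph of minimum degree d.  Most of its vertices have degree at most 8 d; prune the bipartite
-- graph between all vertices and these to sides L and R of minimum degree of order d.  Sample A from L with rate c / d and
-- B from R with rate C / d, where c and C c² are small but C c is large.  Then the b in B with exactly two
-- neighbours in A, both without left neighbours in A, and without conflicting left neighbours in B, number more than any
-- given multiple of |A|, and they are the subdivision vertices of F.

open import Defs renaming (n to order; sym to adj-sym; irrefl to adj-irrefl)
open import Data.Nat using (ℕ; zero; suc; _+_; _*_; _∸_; _^_; _≤_; _<_; z≤n; s≤s; _≤ᵇ_; _≤?_; >-nonZero; _/_; _%_)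
open import Data.Nat.Properties hiding (_≟_)
open import Data.Nat.Tactic.RingSolver using (solve-∀)
open import Data.Fin using (Fin; zero; suc; combine; remQuot; toℕ)
open import Data.Fin.Properties using (_≟_; remQuot-combine; toℕ<n; toℕ-injective)
open import Data.Bool using (Bool; true; false; not; _∧_; _∨_; T; if_then_else_)
open import Data.Bool.Properties using (T-≡; T-irrelevant)
open import Data.Product using (Σ; ∃; _×_; _,_; proj₁; proj₂)
open import Data.Sum using (_⊎_; inj₁; inj₂)
open import Data.Empty using (⊥-elim)
open import Relation.Nullary using (¬_; Dec; yes; no)
open import Relation.Nullary.Decidable using (⌊_⌋; isYes≗does; dec-true; dec-false; toWitness; T?)
open import Relation.Binary.PropositionalEquality using (_≡_; _≢_; refl; sym; trans; cong; cong₂; subst; subst₂; module ≡-Reasoning)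
open import Function using (_∘_; id; case_of_)
open import Function.Bundles using (Equivalence)
open import Function.Definitions using (Injective)
open import Algebra.Properties.Semiring.Sum +-*-semiring using (sum; ∑-comm; sum-cong-≗; *-distribˡ-sum; *-distribʳ-sum) renaming (∑-distrib-+ to sum-+)
open import Algebra.Properties.CommutativeSemigroup *-commutativeSemigroup using () renaming (x∙yz≈y∙xz to *-swap)
open import Data.Vec using (Vec; []; _∷_; lookup; replicate; tabulate; _[_]≔_)
open import Data.Vec.Properties using (lookup∘tabulate; lookup∘update′)
open import Data.List using (List; []; _∷_; map; allFin; filter; cartesianProduct)
open import Data.Nat.DivMod using (m≡m%n+[m/n]*n; m%n<n; m/n*n≤m; /-monoˡ-≤; m*n/n≡m)
open import Data.List.Membership.Propositional using (_∈_)
open import Data.List.Relation.Unary.Any using (here; there)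
import Data.Nat.ListAction as ListAction
open import Data.List.Properties using (map-tabulate)
import Data.List as List
open import Data.List.Relation.Unary.All using (All; []; _∷_)
open import Data.List.Membership.Propositional.Properties using (∈-filter⁺; ∈-filter⁻; ∈-cartesianProduct⁺; ∈-allFin)

-- The dense-pair alternative enters the random step in one way only: fewer than `m₀ s` vertices see
-- a `1 / (8 q)` fraction of a given set of at least `m₀ s` vertices. Degrees are bounded by a
-- multiple of d on the side R alone, so conflicts are counted from R or along the orientation. The
-- rates are `1 / (J′ t)` for A and `1 / t` for B, with `t` about `d / (4 J)`; so C is of order `J`
-- and c of order `J / J′`. For `x = suc j` the choices `J = x ^ 4` and `J′ = x ^ 7` make c of order
-- `1 / x ^ 3`, C c² of order `1 / x ^ 2` and C c of order `x`. Here c governs further neighbours of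
-- b in A and left neighbours of its two ends, C c² governs left neighbours of b in B that have two
-- neighbours in A, and C c the number of surviving b per vertex of A. The other conflicts concern a
-- `1 / q` fraction of a set of order d and only need `q` large against C. All these constants
-- depend on H alone, so the sizes derived from them are polynomial in s. Expectations are sums of
-- natural numbers with fixed weights, without any division.

-- Deduces a linear inequality from a sum A ≤ B of hypotheses; e is the slack.
linear : ∀ {A B x y} e → A ≤ B → x + B + e ≡ y + A → x ≤ y
linear {A} {B} {x} {y} e A≤B eq = +-cancelʳ-≤ B x y (begin
  x + B     ≤⟨ m≤m+n (x + B) e ⟩
  x + B + e ≡⟨ eq ⟩
  y + A     ≤⟨ +-monoʳ-≤ y A≤B ⟩
  y + B     ∎)
  where open ≤-Reasoning

-- Booleans, indicators and cardinalities of finite subsets.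

≡true⊎≡false : ∀ b → (b ≡ true) ⊎ (b ≡ false)
≡true⊎≡false true  = inj₁ refl
≡true⊎≡false false = inj₂ refl

true≢false : ∀ {b} {A : Set} → b ≡ true → b ≡ false → A
true≢false refl ()

∧-intro : ∀ {a b} → a ≡ true → b ≡ true → a ∧ b ≡ true
∧-intro refl refl = refl

∧-elimˡ : ∀ {a b} → a ∧ b ≡ true → a ≡ true
∧-elimˡ {true} _ = refl

∧-elimʳ : ∀ {a b} → a ∧ b ≡ true → b ≡ true
∧-elimʳ {true} p = p

∨-introˡ : ∀ {a b} → a ≡ true → a ∨ b ≡ true
∨-introˡ refl = refl

∨-introʳ : ∀ {a b} → b ≡ true → a ∨ b ≡ true
∨-introʳ {true}  _ = refl
∨-introʳ {false} p = p

∨-elim : ∀ {a b} → a ∨ b ≡ true → (a ≡ true) ⊎ (b ≡ true)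
∨-elim {true}  _ = inj₁ refl
∨-elim {false} p = inj₂ p

not-intro : ∀ {a} → a ≡ false → not a ≡ true
not-intro refl = refl

not-elim : ∀ {a} → not a ≡ true → a ≡ false
not-elim {false} _ = refl

≢true⇒≡false : ∀ {b} → ¬ (b ≡ true) → b ≡ false
≢true⇒≡false {true}  f = ⊥-elim (f refl)
≢true⇒≡false {false} _ = refl

≤ᵇ-intro : ∀ {a b} → a ≤ b → (a ≤ᵇ b) ≡ true
≤ᵇ-intro p = Equivalence.to T-≡ (≤⇒≤ᵇ p)

≤ᵇ-elim : ∀ {a b} → (a ≤ᵇ b) ≡ true → a ≤ b
≤ᵇ-elim {a} {b} p = ≤ᵇ⇒≤ a b (Equivalence.from T-≡ p)

≤ᵇ-false : ∀ {a b} → (a ≤ᵇ b) ≡ false → b < a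
≤ᵇ-false p = ≰⇒> (λ a≤b → true≢false (≤ᵇ-intro a≤b) p)

≤ᵇ-elim-not : ∀ {a b} → not (a ≤ᵇ b) ≡ true → b < a
≤ᵇ-elim-not p = ≤ᵇ-false (not-elim p)

≱1⇒≡0 : ∀ {m} → ¬ (1 ≤ m) → m ≡ 0
≱1⇒≡0 p = n≤0⇒n≡0 (≤-pred (≰⇒> p))

infix 4 _==_
_==_ : ∀ {n} → Fin n → Fin n → Bool
i == j = ⌊ i ≟ j ⌋

==-refl : ∀ {n} (i : Fin n) → (i == i) ≡ true
==-refl i = trans (isYes≗does (i ≟ i)) (dec-true (i ≟ i) refl)

==⇒≡ : ∀ {n} {i j : Fin n} → (i == j) ≡ true → i ≡ j
==⇒≡ {i = i} {j} p with i ≟ j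
... | yes e = e

≢⇒== : ∀ {n} {i j : Fin n} → i ≢ j → (i == j) ≡ false
≢⇒== {i = i} {j} ne = trans (isYes≗does (i ≟ j)) (dec-false (i ≟ j) ne)

==-not⇒≢ : ∀ {n} {i j : Fin n} → not (i == j) ≡ true → i ≢ j
==-not⇒≢ {i = i} p refl = true≢false (==-refl i) (not-elim p)

infix 4 _⊆_
_⊆_ : ∀ {n} → (Fin n → Bool) → (Fin n → Bool) → Set
P ⊆ Q = ∀ i → P i ≡ true → Q i ≡ true

⟦_⟧ : Bool → ℕ
⟦ true  ⟧ = 1
⟦ false ⟧ = 0

⟦⟧-true : ∀ {b} → b ≡ true → ⟦ b ⟧ ≡ 1
⟦⟧-true refl = refl

⟦⟧-elim : ∀ {b} → 1 ≤ ⟦ b ⟧ → b ≡ true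
⟦⟧-elim {true} _ = refl

⟦⟧≤1 : ∀ b → ⟦ b ⟧ ≤ 1
⟦⟧≤1 true  = ≤-refl
⟦⟧≤1 false = z≤n

⟦∧⟧ : ∀ a b → ⟦ a ∧ b ⟧ ≡ ⟦ a ⟧ * ⟦ b ⟧
⟦∧⟧ true  b = sym (+-identityʳ ⟦ b ⟧)
⟦∧⟧ false b = refl

⟦∨⟧ : ∀ a b → ⟦ a ∨ b ⟧ ≤ ⟦ a ⟧ + ⟦ b ⟧
⟦∨⟧ true  b = m≤m+n 1 ⟦ b ⟧
⟦∨⟧ false b = ≤-refl

⟦⟧-mono : ∀ {a b} → (a ≡ true → b ≡ true) → ⟦ a ⟧ ≤ ⟦ b ⟧
⟦⟧-mono {true}  f rewrite f refl = ≤-refl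
⟦⟧-mono {false} f = z≤n

⟦⟧*-mono : ∀ b {x y} → (b ≡ true → x ≤ y) → ⟦ b ⟧ * x ≤ ⟦ b ⟧ * y
⟦⟧*-mono true  f = *-monoʳ-≤ 1 (f refl)
⟦⟧*-mono false f = z≤n

⟦⟧*≤ : ∀ b x → ⟦ b ⟧ * x ≤ x
⟦⟧*≤ true  x = ≤-reflexive (*-identityˡ x)
⟦⟧*≤ false x = z≤n

sum-mono : ∀ {n} {f g : Fin n → ℕ} → (∀ i → f i ≤ g i) → sum f ≤ sum g
sum-mono {zero}  p = z≤n
sum-mono {suc n} p = +-mono-≤ (p zero) (sum-mono (p ∘ suc))

sum-const : ∀ n c → sum {n} (λ _ → c) ≡ n * c
sum-const zero    c = refl
sum-const (suc n) c = cong (c +_) (sum-const n c)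

term≤sum : ∀ {n} (f : Fin n → ℕ) i → f i ≤ sum f
term≤sum f zero    = m≤m+n _ _
term≤sum f (suc i) = ≤-trans (term≤sum (f ∘ suc) i) (m≤n+m _ _)

sum-<⇒∃ : ∀ {n} {f g : Fin n → ℕ} → sum f < sum g → ∃ λ i → f i < g i
sum-<⇒∃ {suc n} {f} {g} p with suc (f zero) ≤? g zero
... | yes q = zero , q
... | no ¬q with sum-<⇒∃ (+-cancelˡ-< (g zero) _ _ (≤-<-trans (+-monoˡ-≤ (sum (f ∘ suc)) (≤-pred (≰⇒> ¬q))) p))
... | i , r = suc i , r

sum-*ˡ : ∀ {n} c (f : Fin n → ℕ) → sum (λ i → c * f i) ≡ c * sum f
sum-*ˡ c f = sym (*-distribˡ-sum c f)

sum-*ʳ : ∀ {n} c (f : Fin n → ℕ) → sum (λ i → f i * c) ≡ sum f * c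
sum-*ʳ c f = sym (*-distribʳ-sum c f)

# : ∀ {n} → (Fin n → Bool) → ℕ
# P = sum (λ i → ⟦ P i ⟧)

#-mono : ∀ {n} {P Q : Fin n → Bool} → P ⊆ Q → # P ≤ # Q
#-mono f = sum-mono (λ i → ⟦⟧-mono (f i))

#-cover : ∀ {n} {P Q R : Fin n → Bool} → (∀ i → P i ≡ true → (Q i ≡ true) ⊎ (R i ≡ true)) → # P ≤ # Q + # R
#-cover {P = P} {Q} {R} f = ≤-trans
  (sum-mono (λ i → ≤-trans (⟦⟧-mono {P i} {Q i ∨ R i} (λ p → case f i p of λ { (inj₁ q) → ∨-introˡ q ; (inj₂ r) → ∨-introʳ {Q i} r }))
                          (⟦∨⟧ (Q i) (R i))))
  (≤-reflexive (sum-+ (λ i → ⟦ Q i ⟧) (λ i → ⟦ R i ⟧)))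

#-split : ∀ {n} (P Q : Fin n → Bool) → # P ≡ # (λ i → P i ∧ Q i) + # (λ i → P i ∧ not (Q i))
#-split P Q = trans (sum-cong-≗ (λ i → cases (P i) (Q i))) (sum-+ (λ i → ⟦ P i ∧ Q i ⟧) (λ i → ⟦ P i ∧ not (Q i) ⟧))
  where
  cases : ∀ a b → ⟦ a ⟧ ≡ ⟦ a ∧ b ⟧ + ⟦ a ∧ not b ⟧
  cases true  true  = refl
  cases true  false = refl
  cases false _     = refl

#-∃ : ∀ {n} {P : Fin n → Bool} → 1 ≤ # P → ∃ λ i → P i ≡ true
#-∃ {n} {P} p with sum-<⇒∃ {n} {λ _ → 0} {λ i → ⟦ P i ⟧} (≤-trans (s≤s (≤-reflexive (trans (sum-const n 0) (*-zeroʳ n)))) p)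
... | i , q = i , ⟦⟧-elim q

∃-# : ∀ {n} {P : Fin n → Bool} i → P i ≡ true → 1 ≤ # P
∃-# {P = P} i p = ≤-trans (≤-reflexive (sym (⟦⟧-true p))) (term≤sum (λ i → ⟦ P i ⟧) i)

#≤n : ∀ {n} (P : Fin n → Bool) → # P ≤ n
#≤n {n} P = ≤-trans (sum-mono (λ i → ⟦⟧≤1 (P i))) (≤-reflexive (trans (sum-const n 1) (*-identityʳ n)))

#-all : ∀ n → # {n} (λ _ → true) ≡ n
#-all n = trans (sum-const n 1) (*-identityʳ n)

infixl 6 _─_
_─_ : ∀ {n} → (Fin n → Bool) → Fin n → Fin n → Bool
(P ─ v) i = P i ∧ not (v == i)

─-⊆ : ∀ {n} {P : Fin n → Bool} {v i} → (P ─ v) i ≡ true → P i ≡ true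
─-⊆ = ∧-elimˡ

─-≢ : ∀ {n} {P : Fin n → Bool} {v i} → (P ─ v) i ≡ true → v ≢ i
─-≢ {P = P} {v} {i} p = ==-not⇒≢ (∧-elimʳ {P i} p)

─-intro : ∀ {n} {P : Fin n → Bool} {v i} → P i ≡ true → v ≢ i → (P ─ v) i ≡ true
─-intro p ne = ∧-intro p (not-intro (≢⇒== ne))

#-single : ∀ {n} (v : Fin n) → # (v ==_) ≡ 1
#-single {suc n} zero = cong suc (trans (sum-const n 0) (*-zeroʳ n))
#-single {suc n} (suc v) = trans (sum-cong-≗ lemma) (#-single v)
  where
  lemma : ∀ i → ⟦ suc v == suc i ⟧ ≡ ⟦ v == i ⟧
  lemma i with v ≟ i
  ... | yes _ = refl
  ... | no  _ = refl

sum-single : ∀ {n} (v : Fin n) (f : Fin n → ℕ) → sum (λ i → ⟦ v == i ⟧ * f i) ≡ f v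
sum-single v f = trans (sum-cong-≗ lemma) (trans (sum-*ʳ (f v) (λ i → ⟦ v == i ⟧)) (trans (cong (_* f v) (#-single v)) (+-identityʳ (f v))))
  where
  lemma : ∀ i → ⟦ v == i ⟧ * f i ≡ ⟦ v == i ⟧ * f v
  lemma i with v ≟ i
  ... | yes refl = refl
  ... | no  _ = refl

#-─ : ∀ {n} (P : Fin n → Bool) v → P v ≡ true → # P ≡ suc (# (P ─ v))
#-─ P v pv = trans (#-split P (v ==_)) (cong (_+ # (P ─ v)) (trans (sum-cong-≗ lemma) (#-single v)))
  where
  lemma : ∀ i → ⟦ P i ∧ (v == i) ⟧ ≡ ⟦ v == i ⟧
  lemma i with v ≟ i
  ... | yes refl rewrite pv = refl
  ... | no  _ with P i
  ...   | true = refl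
  ...   | false = refl

#-unique : ∀ {n} (P : Fin n → Bool) → (∀ i j → P i ≡ true → P j ≡ true → i ≡ j) → # P ≤ 1
#-unique P uniq with 2 ≤? # P
... | no ¬p = ≤-pred (≰⇒> ¬p)
... | yes p with #-∃ {P = P} (≤-trans (s≤s z≤n) p)
... | v , pv with #-∃ {P = P ─ v} (≤-pred (≤-trans p (≤-reflexive (#-─ P v pv))))
... | w , pw = ⊥-elim (─-≢ {P = P} pw (uniq v w pv (─-⊆ {P = P} pw)))

subset-of-size : ∀ {n} r (P : Fin n → Bool) → r ≤ # P →
  Σ (Fin n → Bool) λ Q → Q ⊆ P × # Q ≡ r
subset-of-size {n} zero P _ = (λ _ → false) , (λ _ ()) , trans (sum-const n 0) (*-zeroʳ n)
subset-of-size {n} (suc r) P r<P with #-∃ {P = P} (≤-trans (s≤s z≤n) r<P)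
... | v , pv with subset-of-size r (P ─ v) (≤-pred (≤-trans r<P (≤-reflexive (#-─ P v pv))))
... | Q , Q⊆ , eq = Q′ , Q′⊆ , trans (#-─ Q′ v (∨-introʳ {Q v} (==-refl v))) (cong suc (trans (sum-cong-≗ (λ i → cong ⟦_⟧ (same i))) eq))
  where
  Q′ : Fin n → Bool
  Q′ i = Q i ∨ (v == i)
  Q′⊆ : ∀ i → Q′ i ≡ true → P i ≡ true
  Q′⊆ i q with ∨-elim {Q i} q
  ... | inj₁ q′ = ─-⊆ {P = P} (Q⊆ i q′)
  ... | inj₂ e = subst (λ i → P i ≡ true) (==⇒≡ e) pv
  same : ∀ i → (Q′ ─ v) i ≡ Q i
  same i with ≡true⊎≡false (Q i)
  ... | inj₁ q = trans (─-intro {P = Q′} (∨-introˡ q) (─-≢ {P = P} (Q⊆ i q))) (sym q)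
  ... | inj₂ q with v ≟ i
  ...   | yes _ rewrite q = refl
  ...   | no _  rewrite q = refl

choose-distinct : ∀ {n} h (P : Fin n → Bool) → h ≤ # P →
  Σ (Fin h → Fin n) λ f → Injective _≡_ _≡_ f × (∀ i → P (f i) ≡ true)
choose-distinct zero P _ = (λ ()) , (λ { {()} }) , λ ()
choose-distinct {n} (suc h) P h<P with #-∃ {P = P} (≤-trans (s≤s z≤n) h<P)
... | v , pv with choose-distinct h (P ─ v) (≤-pred (≤-trans h<P (≤-reflexive (#-─ P v pv))))
... | f , inj , inP = f′ , inj′ , inP′
  where
  f′ : Fin (suc h) → Fin n
  f′ zero = v
  f′ (suc i) = f i
  inj′ : Injective _≡_ _≡_ f′
  inj′ {zero} {zero} _ = refl
  inj′ {zero} {suc j} e = ⊥-elim (─-≢ {P = P} (inP j) e)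
  inj′ {suc i} {zero} e = ⊥-elim (─-≢ {P = P} (inP i) (sym e))
  inj′ {suc i} {suc j} e = cong suc (inj e)
  inP′ : ∀ i → P (f′ i) ≡ true
  inP′ zero = pv
  inP′ (suc i) = ─-⊆ {P = P} (inP i)

some : ∀ {n} → (Fin n → Bool) → Bool
some P = 1 ≤ᵇ # P

some-intro : ∀ {n} {P : Fin n → Bool} i → P i ≡ true → some P ≡ true
some-intro {P = P} i p = ≤ᵇ-intro (∃-# {P = P} i p)

some-elim : ∀ {n} {P : Fin n → Bool} → some P ≡ true → ∃ λ i → P i ≡ true
some-elim {P = P} p = #-∃ {P = P} (≤ᵇ-elim p)

sum-⟦⟧*≤ : ∀ {n} (P : Fin n → Bool) (f : Fin n → ℕ) c → (∀ i → P i ≡ true → f i ≤ c) → sum (λ i → ⟦ P i ⟧ * f i) ≤ # P * c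
sum-⟦⟧*≤ P f c p = ≤-trans (sum-mono (λ i → ⟦⟧*-mono (P i) (p i))) (≤-reflexive (sum-*ʳ c (λ i → ⟦ P i ⟧)))

sum-⟦⟧*≥ : ∀ {n} (P : Fin n → Bool) (f : Fin n → ℕ) c → (∀ i → P i ≡ true → c ≤ f i) → # P * c ≤ sum (λ i → ⟦ P i ⟧ * f i)
sum-⟦⟧*≥ P f c p = ≤-trans (≤-reflexive (sym (sum-*ʳ c (λ i → ⟦ P i ⟧)))) (sum-mono (λ i → ⟦⟧*-mono (P i) (p i)))

-- Weighted sums over Boolean vectors.

-- 𝔼 k f sums f over all α : Vec Bool n, an entry false having weight k and an entry true weight 1:
-- up to the factor (1 + k) ^ n this is the expectation of f when every entry is true with probability 1 / (1 + k).
𝔼 : ℕ → ∀ {n} → (Vec Bool n → ℕ) → ℕ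
𝔼 k {zero}  f = f []
𝔼 k {suc n} f = 𝔼 k (λ α → f (true ∷ α)) + k * 𝔼 k (λ α → f (false ∷ α))

𝔼-mono : ∀ k {n} {f g : Vec Bool n → ℕ} → (∀ α → f α ≤ g α) → 𝔼 k f ≤ 𝔼 k g
𝔼-mono k {zero}  p = p []
𝔼-mono k {suc n} p = +-mono-≤ (𝔼-mono k (λ α → p (true ∷ α))) (*-monoʳ-≤ k (𝔼-mono k (λ α → p (false ∷ α))))

𝔼-cong : ∀ k {n} {f g : Vec Bool n → ℕ} → (∀ α → f α ≡ g α) → 𝔼 k f ≡ 𝔼 k g
𝔼-cong k {zero}  p = p []
𝔼-cong k {suc n} p = cong₂ _+_ (𝔼-cong k (λ α → p (true ∷ α))) (cong (k *_) (𝔼-cong k (λ α → p (false ∷ α))))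

𝔼-const : ∀ k n c → 𝔼 k {n} (λ _ → c) ≡ suc k ^ n * c
𝔼-const k zero    c = sym (+-identityʳ c)
𝔼-const k (suc n) c rewrite 𝔼-const k n c = ring-identity k (suc k ^ n) c
  where
  ring-identity : ∀ k a c → a * c + k * (a * c) ≡ (suc k * a) * c
  ring-identity = solve-∀

𝔼-+ : ∀ k {n} (f g : Vec Bool n → ℕ) → 𝔼 k (λ α → f α + g α) ≡ 𝔼 k f + 𝔼 k g
𝔼-+ k {zero}  f g = refl
𝔼-+ k {suc n} f g rewrite 𝔼-+ k (λ α → f (true ∷ α)) (λ α → g (true ∷ α)) | 𝔼-+ k (λ α → f (false ∷ α)) (λ α → g (false ∷ α)) = ring-identity k (𝔼 k (λ α → f (true ∷ α))) (𝔼 k (λ α → g (true ∷ α))) (𝔼 k (λ α → f (false ∷ α))) (𝔼 k (λ α → g (false ∷ α)))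
  where
  ring-identity : ∀ k a b c d → (a + b) + k * (c + d) ≡ (a + k * c) + (b + k * d)
  ring-identity = solve-∀

𝔼-* : ∀ k {n} c (f : Vec Bool n → ℕ) → 𝔼 k (λ α → c * f α) ≡ c * 𝔼 k f
𝔼-* k {zero}  c f = refl
𝔼-* k {suc n} c f rewrite 𝔼-* k c (λ α → f (true ∷ α)) | 𝔼-* k c (λ α → f (false ∷ α)) = ring-identity k c (𝔼 k (λ α → f (true ∷ α))) (𝔼 k (λ α → f (false ∷ α)))
  where
  ring-identity : ∀ k c a b → c * a + k * (c * b) ≡ c * (a + k * b)
  ring-identity = solve-∀

𝔼-sum : ∀ k {n m} (f : Fin m → Vec Bool n → ℕ) → 𝔼 k (λ α → sum (λ i → f i α)) ≡ sum (λ i → 𝔼 k (f i))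
𝔼-sum k {n} {zero}  f = trans (𝔼-const k n 0) (*-zeroʳ (suc k ^ n))
𝔼-sum k {n} {suc m} f = trans (𝔼-+ k (f zero) (λ α → sum (λ i → f (suc i) α))) (cong (𝔼 k (f zero) +_) (𝔼-sum k (λ i → f (suc i))))

-- The first moment method: both sides carry the same normalising factor, which can therefore stay
-- implicit.
𝔼-< : ∀ k {n} {f g : Vec Bool n → ℕ} → 𝔼 k f < 𝔼 k g → ∃ λ α → f α < g α
𝔼-< k {zero}  p = [] , p
𝔼-< k {suc n} {f} {g} p with suc (𝔼 k (λ α → f (true ∷ α))) ≤? 𝔼 k (λ α → g (true ∷ α))
... | yes q = let α , r = 𝔼-< k q in true ∷ α , r
... | no ¬q with suc (𝔼 k (λ α → f (false ∷ α))) ≤? 𝔼 k (λ α → g (false ∷ α))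
...   | yes q = let α , r = 𝔼-< k q in false ∷ α , r
...   | no ¬r = ⊥-elim (<⇒≱ p (+-mono-≤ (≤-pred (≰⇒> ¬q)) (*-monoʳ-≤ k (≤-pred (≰⇒> ¬r)))))

-- For `k = 1` all weights are 1 and `𝔼` is a plain sum; in this form it sums over adjacency
-- patterns.
term≤𝔼 : ∀ {n} (f : Vec Bool n → ℕ) α → f α ≤ 𝔼 1 f
term≤𝔼 f []          = ≤-refl
term≤𝔼 f (true ∷ α)  = ≤-trans (term≤𝔼 (λ β → f (true ∷ β)) α) (m≤m+n _ _)
term≤𝔼 f (false ∷ α) = ≤-trans (term≤𝔼 (λ β → f (false ∷ β)) α) (≤-trans (m≤m+n _ 0) (m≤n+m _ (𝔼 1 (λ β → f (true ∷ β)))))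

-- Induced incidence structures.

-- An induced copy in G of the 1-subdivision of the graph F on the vertex set V (given inside Fin N).
record InducedIncidence (G : Graph) {N : ℕ} (F : Fin N → Fin N → Bool) (V : Fin N → Bool) : Set where
  field
    ι         : Fin N → Fin (order G)
    mid       : Fin N → Fin N → Fin (order G)
    ι-inj     : ∀ {u v} → V u ≡ true → V v ≡ true → ι u ≡ ι v → u ≡ v
    ι-indep   : ∀ {u v} → V u ≡ true → V v ≡ true → adj G (ι u) (ι v) ≡ false
    mid-adjˡ  : ∀ {u v} → F u v ≡ true → adj G (ι u) (mid u v) ≡ true
    mid-adjʳ  : ∀ {u v} → F u v ≡ true → adj G (ι v) (mid u v) ≡ true
    mid-only  : ∀ {u v x} → F u v ≡ true → V x ≡ true → adj G (ι x) (mid u v) ≡ true → (x ≡ u) ⊎ (x ≡ v)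
    mid-indep : ∀ {u v u′ v′} → F u v ≡ true → F u′ v′ ≡ true → adj G (mid u v) (mid u′ v′) ≡ false

2ab≤a²+b² : ∀ a b → 2 * (a * b) ≤ a * a + b * b
2ab≤a²+b² zero b = z≤n
2ab≤a²+b² (suc a) zero rewrite *-zeroʳ a = z≤n
2ab≤a²+b² (suc a) (suc b) = linear 0 (2ab≤a²+b² a b) (identity a b)
  where
  identity : ∀ a b → 2 * (suc a * suc b) + (a * a + b * b) + 0 ≡ suc a * suc a + suc b * suc b + 2 * (a * b)
  identity = solve-∀

-- Extending a set of branch vertices in a graph without K_{s,s}.

module Neighbourhoods (G : Graph) where

  V : Set
  V = Fin (order G)

  inter diff : (V → Bool) → V → V → Bool
  inter P a y = P y ∧ adj G a y
  diff  P a y = P y ∧ not (adj G a y)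

  biclique : ∀ s (X Y : V → Bool) → s ≤ # X → s ≤ # Y →
    (∀ x y → X x ≡ true → Y y ≡ true → adj G x y ≡ true) → ContainsKss s G
  biclique s X Y s≤X s≤Y complete with choose-distinct s X s≤X | choose-distinct s Y s≤Y
  ... | f , f-inj , f∈ | g , g-inj , g∈ = φ , φ-inj , λ i j → complete (f i) (g j) (f∈ i) (g∈ j)
    where
    φ : Fin s ⊎ Fin s → V
    φ (inj₁ i) = f i
    φ (inj₂ j) = g j
    disjoint : ∀ i j → f i ≢ g j
    disjoint i j e = true≢false (complete (f i) (g j) (f∈ i) (g∈ j)) (trans (cong (adj G (f i)) (sym e)) (adj-irrefl G (f i)))
    φ-inj : Injective _≡_ _≡_ φ
    φ-inj {inj₁ i} {inj₁ j} e = cong inj₁ (f-inj e)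
    φ-inj {inj₁ i} {inj₂ j} e = ⊥-elim (disjoint i j e)
    φ-inj {inj₂ i} {inj₁ j} e = ⊥-elim (disjoint j i (sym e))
    φ-inj {inj₂ i} {inj₂ j} e = cong inj₂ (g-inj e)

  inter≤ : ∀ P a → # (inter P a) ≤ # P
  inter≤ P a = #-mono {P = inter P a} {P} (λ i → ∧-elimˡ)

  diff≤ : ∀ P a → # (diff P a) ≤ # P
  diff≤ P a = #-mono {P = diff P a} {P} (λ i → ∧-elimˡ)

-- The inverse density after one extension. Two candidates of density `1 / q` share about a `1 / q²`
-- fraction on average, and restricting to nonadjacent pairs costs the factor of order `s`; the
-- constant 32 is fixed by `lower`.
next : ℕ → ℕ → ℕ
next s q = 32 * s * (q * q)

module KssFree (G : Graph) (s : ℕ) (1≤s : 1 ≤ s) (noKss : ¬ ContainsKss s G) where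
  open Neighbourhoods G

  covers : (V → Bool) → V → Bool
  covers P a = suc (2 * s * # (diff P a)) ≤ᵇ # P

  covers-false : ∀ P a → covers P a ≡ false → # P ≤ 2 * s * # (diff P a)
  covers-false P a e = ≤-pred (≤ᵇ-false e)

  -- The sets missed by `s` covering vertices together make up at most half of `P`, so at least `s`
  -- common neighbours would remain.
  few-covers : ∀ P → 2 * s ≤ # P → # (covers P) < s
  few-covers P 2s≤P with suc (# (covers P)) ≤? s
  ... | yes p = p
  ... | no ¬p with subset-of-size s (covers P) (≤-pred (≰⇒> ¬p))
  ... | X , X⊆ , #X = ⊥-elim (noKss (biclique s X Common (≤-reflexive (sym #X)) s≤Common complete))
    where
    missed : V → V → Bool
    missed y a = X a ∧ not (adj G a y)
    Common : V → Bool
    Common y = P y ∧ not (some (missed y))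
    complete : ∀ x y → X x ≡ true → Common y ≡ true → adj G x y ≡ true
    complete x y Xx Cy with ≡true⊎≡false (adj G x y)
    ... | inj₁ e = e
    ... | inj₂ e = true≢false (some-intro {P = missed y} x (∧-intro Xx (not-intro e))) (not-elim (∧-elimʳ {P y} Cy))
    pointwise : ∀ y → ⟦ P y ⟧ ≤ ⟦ Common y ⟧ + sum (λ a → ⟦ X a ⟧ * ⟦ diff P a y ⟧)
    pointwise y with P y
    ... | false = z≤n
    ... | true with ≡true⊎≡false (some (missed y))
    ...   | inj₂ e rewrite e = s≤s z≤n
    ...   | inj₁ e with some-elim {P = missed y} e
    ...     | a , m = ≤-trans (≤-reflexive (sym (cong₂ _*_ (⟦⟧-true {X a} (∧-elimˡ m)) (⟦⟧-true (∧-elimʳ {X a} m)))))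
                      (≤-trans (term≤sum (λ a → ⟦ X a ⟧ * ⟦ not (adj G a y) ⟧) a) (m≤n+m _ ⟦ not (some (missed y)) ⟧))
    union : # P ≤ # Common + sum (λ a → ⟦ X a ⟧ * # (diff P a))
    union = begin
      # P ≤⟨ sum-mono pointwise ⟩
      sum (λ y → ⟦ Common y ⟧ + sum (λ a → ⟦ X a ⟧ * ⟦ diff P a y ⟧)) ≡⟨ sum-+ (λ y → ⟦ Common y ⟧) _ ⟩
      # Common + sum (λ y → sum (λ a → ⟦ X a ⟧ * ⟦ diff P a y ⟧)) ≡⟨ cong (# Common +_) (∑-comm (λ y a → ⟦ X a ⟧ * ⟦ diff P a y ⟧)) ⟩
      # Common + sum (λ a → sum (λ y → ⟦ X a ⟧ * ⟦ diff P a y ⟧)) ≡⟨ cong (# Common +_) (sum-cong-≗ (λ a → sum-*ˡ ⟦ X a ⟧ (λ y → ⟦ diff P a y ⟧))) ⟩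
      # Common + sum (λ a → ⟦ X a ⟧ * # (diff P a)) ∎
      where open ≤-Reasoning
    losses : sum (λ a → ⟦ X a ⟧ * # (diff P a)) * (2 * s) ≤ s * # P
    losses = begin
      sum (λ a → ⟦ X a ⟧ * # (diff P a)) * (2 * s) ≡⟨ sum-*ʳ (2 * s) (λ a → ⟦ X a ⟧ * # (diff P a)) ⟨
      sum (λ a → ⟦ X a ⟧ * # (diff P a) * (2 * s)) ≡⟨ sum-cong-≗ (λ a → trans (*-assoc ⟦ X a ⟧ _ _) (cong (⟦ X a ⟧ *_) (*-comm _ (2 * s)))) ⟩
      sum (λ a → ⟦ X a ⟧ * (2 * s * # (diff P a))) ≤⟨ sum-⟦⟧*≤ X _ (# P) (λ a Xa → <⇒≤ (≤ᵇ-elim (X⊆ a Xa))) ⟩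
      # X * # P ≡⟨ cong (_* # P) #X ⟩
      s * # P ∎
      where open ≤-Reasoning
    half : s * # P ≤ s * (2 * # Common)
    half = linear 0 (+-mono-≤ (*-monoʳ-≤ (2 * s) union) losses)
             (identity s (# P) (# Common) (sum (λ a → ⟦ X a ⟧ * # (diff P a))))
      where
      identity : ∀ s p c l → s * p + (2 * s * (c + l) + s * p) + 0 ≡ s * (2 * c) + (2 * s * p + l * (2 * s))
      identity = solve-∀
    s≤Common : s ≤ # Common
    s≤Common = *-cancelˡ-≤ 2 (≤-trans 2s≤P (*-cancelˡ-≤ s ⦃ >-nonZero 1≤s ⦄ half))

  typ : ∀ {i} → (V → Bool) → Vec V i → Vec Bool i → V → Bool
  typ Y []       []      y = Y y
  typ Y (a ∷ as) (b ∷ π) y = typ Y as π y ∧ (if b then adj G a y else not (adj G a y))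

  typ-lookup : ∀ {i} Y (as : Vec V i) π {y} → typ Y as π y ≡ true → ∀ k → adj G (lookup as k) y ≡ lookup π k
  typ-lookup Y (a ∷ as) (true ∷ π)  {y} e zero    = ∧-elimʳ {typ Y as π y} e
  typ-lookup Y (a ∷ as) (false ∷ π) {y} e zero    = not-elim (∧-elimʳ {typ Y as π y} e)
  typ-lookup Y (a ∷ as) (b ∷ π)     {y} e (suc k) = typ-lookup Y as π (∧-elimˡ e) k

  weight : ∀ {i} → Vec Bool i → ℕ
  weight π = # (lookup π)

  weight-0 : ∀ {i} (π : Vec Bool i) → weight π ≤ 0 → π ≡ replicate i false
  weight-0 []          _ = refl
  weight-0 (false ∷ π) p = cong (false ∷_) (weight-0 π p)

  weight-zeros : ∀ i → weight (replicate i false) ≡ 0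
  weight-zeros zero    = refl
  weight-zeros (suc i) = weight-zeros i

  -- C is the set of candidates for extending as; the sets typ Y as π with π of weight 2 will contain the subdivision vertices.
  record State {i} (Y : V → Bool) (as : Vec V i) (C : V → Bool) (q m : ℕ) : Set where
    field
      indep  : ∀ k l → adj G (lookup as k) (lookup as l) ≡ false
      apart  : ∀ k c → C c ≡ true → adj G (lookup as k) c ≡ false
      large  : ∀ π → weight π ≤ 2 → m ≤ # (typ Y as π)
      dense  : ∀ π → weight π ≤ 1 → ∀ c → C c ≡ true → # (typ Y as π) ≤ q * # (inter (typ Y as π) c)

  -- Moving a vertex `a` from `C` to `as` splits every type in two, and the parts of weight at most
  -- 2 must stay large. A type of weight at most 1 can still be cut down to the neighbours of a
  -- later branch vertex, so it must also stay dense towards all candidates; a type of weight 2 is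
  -- only cut down to nonneighbours.
  module Step {i} {Y : V → Bool} {as : Vec V i} {C : V → Bool} {q m : ℕ} (st : State Y as C q m)
              (1≤q : 1 ≤ q) (2sq≤m : 2 * s * q ≤ m) (4sq≤C : 4 * s * q ≤ # C)
              (2q′≤C : 2 * next s q * (2 ^ i * s) ≤ # C) (1≤C : 1 ≤ # C) where
    open State st

    q′ : ℕ
    q′ = next s q

    zeros : Vec Bool i
    zeros = replicate i false

    T₀ : V → Bool
    T₀ = typ Y as zeros

    c t₀ : ℕ
    c = # C
    t₀ = # T₀

    2s≤m : 2 * s ≤ m
    2s≤m = ≤-trans (≤-trans (≤-reflexive (sym (*-identityʳ (2 * s)))) (*-monoʳ-≤ (2 * s) 1≤q)) 2sq≤m

    1≤t₀ : 1 ≤ t₀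
    1≤t₀ = ≤-trans (≤-trans (≤-trans 1≤s (m≤m+n s _)) 2s≤m) (large zeros (≤-trans (≤-reflexive (weight-zeros i)) z≤n))

    -- The number of types of which too little would remain outside the neighbourhood of `a`.
    loss : V → ℕ
    loss a = 𝔼 1 (λ π → ⟦ weight π ≤ᵇ 2 ⟧ * ⟦ covers (typ Y as π) a ⟧)

    -- The corresponding obstruction to density: removing the neighbours of `a` must not destroy the
    -- neighbours of `x` inside a type.
    pairLoss : V → V → ℕ
    pairLoss a x = 𝔼 1 (λ π → ⟦ weight π ≤ᵇ 1 ⟧ * ⟦ covers (inter (typ Y as π) x) a ⟧)

    sum-𝔼≤ : (f : Vec Bool i → Bool) (P : Vec Bool i → V → Bool) → (∀ π → f π ≡ true → # (P π) ≤ s) →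
      sum (λ a → 𝔼 1 (λ π → ⟦ f π ⟧ * ⟦ P π a ⟧)) ≤ 2 ^ i * s
    sum-𝔼≤ f P bound = begin
      sum (λ a → 𝔼 1 (λ π → ⟦ f π ⟧ * ⟦ P π a ⟧)) ≡⟨ 𝔼-sum 1 (λ a π → ⟦ f π ⟧ * ⟦ P π a ⟧) ⟨
      𝔼 1 (λ π → sum (λ a → ⟦ f π ⟧ * ⟦ P π a ⟧)) ≡⟨ 𝔼-cong 1 (λ π → sum-*ˡ ⟦ f π ⟧ (λ a → ⟦ P π a ⟧)) ⟩
      𝔼 1 (λ π → ⟦ f π ⟧ * # (P π)) ≤⟨ 𝔼-mono 1 (λ π → ≤-trans (⟦⟧*-mono (f π) (bound π)) (⟦⟧*≤ (f π) s)) ⟩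
      𝔼 1 {i} (λ _ → s) ≡⟨ 𝔼-const 1 i s ⟩
      2 ^ i * s ∎
      where open ≤-Reasoning

    Σloss : sum loss ≤ 2 ^ i * s
    Σloss = sum-𝔼≤ (λ π → weight π ≤ᵇ 2) (λ π → covers (typ Y as π))
      (λ π w → <⇒≤ (few-covers (typ Y as π) (≤-trans 2s≤m (large π (≤ᵇ-elim w)))))

    inter-large : ∀ π → weight π ≤ 1 → ∀ x → C x ≡ true → 2 * s ≤ # (inter (typ Y as π) x)
    inter-large π w x Cx = *-cancelˡ-≤ q ⦃ >-nonZero 1≤q ⦄
      (≤-trans (≤-reflexive (*-comm q (2 * s))) (≤-trans 2sq≤m (≤-trans (large π (≤-trans w (s≤s z≤n))) (dense π w x Cx))))

    ΣpairLoss : ∀ x → C x ≡ true → sum (λ a → pairLoss a x) ≤ 2 ^ i * s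
    ΣpairLoss x Cx = sum-𝔼≤ (λ π → weight π ≤ᵇ 1) (λ π → covers (inter (typ Y as π) x))
      (λ π w → <⇒≤ (few-covers (inter (typ Y as π) x) (inter-large π (≤ᵇ-elim w) x Cx)))

    codeg : V → V → ℕ
    codeg a x = # (inter (inter T₀ a) x)

    -- The condition under which `x` remains a candidate after `a`. Codegrees are tested in the zero
    -- type only, because a type of weight at most 1 that uses `a` is zero on the earlier vertices.
    -- For `a` in `C` the case `x = a` is excluded implicitly: `a` covers its own neighbourhood, so
    -- `pairLoss a a` is positive.
    good : V → V → Bool
    good a x = C a ∧ (C x ∧ not (adj G a x)) ∧ (t₀ ≤ᵇ q′ * codeg a x) ∧ (loss a + pairLoss a x ≤ᵇ 0)

    -- A pair has small codegree, or suffers a loss, or is good; in the last two cases the trivial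
    -- bound `t₀` on the codegree is used.
    codeg-bound : ∀ a x → C a ≡ true → C x ∧ not (adj G a x) ≡ true →
      q′ * codeg a x ≤ q′ * t₀ * (loss a + pairLoss a x + ⟦ good a x ⟧) + t₀
    codeg-bound a x Ca Cx rewrite Ca | Cx with ≡true⊎≡false (t₀ ≤ᵇ q′ * codeg a x)
    ... | inj₂ e = ≤-trans (<⇒≤ (≤ᵇ-false e)) (m≤n+m t₀ _)
    ... | inj₁ e rewrite e = ≤-trans (*-monoʳ-≤ q′ (≤-trans (inter≤ (inter T₀ a) x) (inter≤ T₀ a)))
                        (≤-trans (≤-trans (≤-reflexive (sym (*-identityʳ (q′ * t₀)))) (*-monoʳ-≤ (q′ * t₀) (one (loss a + pairLoss a x)))) (m≤m+n _ t₀))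
      where
      one : ∀ l → 1 ≤ l + ⟦ l ≤ᵇ 0 ⟧
      one zero = ≤-refl
      one (suc l) = s≤s z≤n

    nonadjacent : V → ℕ
    nonadjacent y = sum (λ a → ⟦ inter C y a ⟧ * # (diff (inter C y) a))

    -- If the neighbourhood has at least `2 s` vertices, all but `s` of them miss a `1 / (2 s)`
    -- fraction of it, so at least a `1 / (4 s)` fraction of its ordered pairs is nonadjacent. The
    -- last summand covers small neighbourhoods.
    square-bound : ∀ y → # (inter C y) * # (inter C y) ≤ 4 * s * nonadjacent y + 4 * (s * s)
    square-bound y with 2 * s ≤? # (inter C y)
    ... | no small = ≤-trans (*-mono-≤ D≤2s D≤2s) (≤-trans (≤-reflexive (identity s)) (m≤n+m _ (4 * s * nonadjacent y)))
      where
      D≤2s : # (inter C y) ≤ 2 * s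
      D≤2s = <⇒≤ (≰⇒> small)
      identity : ∀ s → 2 * s * (2 * s) ≡ 4 * (s * s)
      identity = solve-∀
    ... | yes 2s≤D = more step
      where
      D k l : ℕ
      D = # (inter C y)
      k = # (λ a → inter C y a ∧ not (covers (inter C y) a))
      l = # (covers (inter C y))
      split : D ≤ l + k
      split = #-cover {P = inter C y} {covers (inter C y)} {λ a → inter C y a ∧ not (covers (inter C y) a)}
        (λ a p → case ≡true⊎≡false (covers (inter C y) a) of λ { (inj₁ e) → inj₁ e ; (inj₂ e) → inj₂ (∧-intro p (not-intro e)) })
      uncovered : k * D ≤ 2 * s * nonadjacent y
      uncovered = begin
        k * D ≤⟨ sum-⟦⟧*≥ (λ a → inter C y a ∧ not (covers (inter C y) a)) _ D
                   (λ a p → covers-false (inter C y) a (not-elim (∧-elimʳ {inter C y a} p))) ⟩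
        sum (λ a → ⟦ inter C y a ∧ not (covers (inter C y) a) ⟧ * (2 * s * # (diff (inter C y) a)))
          ≤⟨ sum-mono (λ a → *-monoˡ-≤ (2 * s * # (diff (inter C y) a)) (⟦⟧-mono {inter C y a ∧ not (covers (inter C y) a)} {inter C y a} ∧-elimˡ)) ⟩
        sum (λ a → ⟦ inter C y a ⟧ * (2 * s * # (diff (inter C y) a)))
          ≡⟨ sum-cong-≗ (λ a → *-swap ⟦ inter C y a ⟧ (2 * s) (# (diff (inter C y) a))) ⟩
        sum (λ a → 2 * s * (⟦ inter C y a ⟧ * # (diff (inter C y) a)))
          ≡⟨ sum-*ˡ (2 * s) (λ a → ⟦ inter C y a ⟧ * # (diff (inter C y) a)) ⟩
        2 * s * nonadjacent y ∎
        where
        open ≤-Reasoning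
      identity : ∀ D k l s N → 2 * (D * D) + (2 * (D * (l + k)) + (2 * (2 * s * N) + D * (2 * s))) + 0
        ≡ 4 * s * N + D * (2 * s) + (2 * (D * D) + (2 * (k * D) + D * (2 * l)))
      identity = solve-∀
      step : 2 * (D * D) ≤ 4 * s * nonadjacent y + D * (2 * s)
      step = linear 0 (+-mono-≤ (*-monoʳ-≤ 2 (*-monoʳ-≤ D split)) (+-mono-≤ (*-monoʳ-≤ 2 uncovered)
        (*-monoʳ-≤ D (*-monoʳ-≤ 2 (<⇒≤ (few-covers (inter C y) 2s≤D)))))) (identity D k l s (nonadjacent y))
      more : 2 * (D * D) ≤ 4 * s * nonadjacent y + D * (2 * s) → D * D ≤ 4 * s * nonadjacent y + 4 * (s * s)
      more h = linear (4 * (s * s)) (+-mono-≤ h (*-monoʳ-≤ D 2s≤D)) (identity′ (D * D) (D * (2 * s)) (4 * s * nonadjacent y) (4 * (s * s)))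
        where
        identity′ : ∀ x y n e → x + ((n + y) + x) + e ≡ (n + e) + (2 * x + y)
        identity′ = solve-∀

    ΣN : ℕ
    ΣN = sum (λ y → ⟦ T₀ y ⟧ * nonadjacent y)

    degree-swap : sum (λ y → ⟦ T₀ y ⟧ * # (inter C y)) ≡ sum (λ a → ⟦ C a ⟧ * # (inter T₀ a))
    degree-swap = trans (sum-cong-≗ (λ y → sym (sum-*ˡ ⟦ T₀ y ⟧ (λ a → ⟦ inter C y a ⟧))))
      (trans (∑-comm (λ y a → ⟦ T₀ y ⟧ * ⟦ inter C y a ⟧))
      (sum-cong-≗ (λ a → trans (sum-cong-≗ (λ y → pointwise (T₀ y) (C a) (adj-sym G y a))) (sum-*ˡ ⟦ C a ⟧ (λ y → ⟦ inter T₀ a y ⟧)))))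
      where
      pointwise : ∀ t b {e e′} → e ≡ e′ → ⟦ t ⟧ * ⟦ b ∧ e ⟧ ≡ ⟦ b ⟧ * ⟦ t ∧ e′ ⟧
      pointwise t b {e} refl rewrite ⟦∧⟧ b e | ⟦∧⟧ t e = identity ⟦ t ⟧ ⟦ b ⟧ ⟦ e ⟧
        where
        identity : ∀ t b e → t * (b * e) ≡ b * (t * e)
        identity = solve-∀

    -- Double counting of a vertex `y` of the zero type together with an ordered nonadjacent pair of
    -- its neighbours in `C`.
    pair-swap : ΣN ≡ sum (λ a → ⟦ C a ⟧ * sum (λ x → ⟦ C x ∧ not (adj G a x) ⟧ * codeg a x))
    pair-swap = trans (sum-cong-≗ expand) (trans (∑-comm (λ y a → sum (λ x → term y a x)))
      (sum-cong-≗ (λ a → trans (∑-comm (λ y x → term y a x)) (trans (sum-cong-≗ (collect a)) (sum-*ˡ ⟦ C a ⟧ (λ x → ⟦ C x ∧ not (adj G a x) ⟧ * codeg a x))))))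
      where
      term : V → V → V → ℕ
      term y a x = ⟦ T₀ y ⟧ * (⟦ inter C y a ⟧ * ⟦ diff (inter C y) a x ⟧)
      expand : ∀ y → ⟦ T₀ y ⟧ * nonadjacent y ≡ sum (λ a → sum (λ x → term y a x))
      expand y = trans (sym (sum-*ˡ ⟦ T₀ y ⟧ (λ a → ⟦ inter C y a ⟧ * # (diff (inter C y) a))))
        (sum-cong-≗ (λ a → trans (cong (⟦ T₀ y ⟧ *_) (sym (sum-*ˡ ⟦ inter C y a ⟧ (λ x → ⟦ diff (inter C y) a x ⟧))))
                                 (sym (sum-*ˡ ⟦ T₀ y ⟧ (λ x → ⟦ inter C y a ⟧ * ⟦ diff (inter C y) a x ⟧)))))
      pointwise : ∀ t ca cx n {ea ea′ ex ex′} → ea ≡ ea′ → ex ≡ ex′ →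
        ⟦ t ⟧ * (⟦ ca ∧ ea ⟧ * ⟦ (cx ∧ ex) ∧ n ⟧) ≡ (⟦ ca ⟧ * ⟦ cx ∧ n ⟧) * ⟦ (t ∧ ea′) ∧ ex′ ⟧
      pointwise t ca cx n {ea} {_} {ex} refl refl
        rewrite ⟦∧⟧ ca ea | ⟦∧⟧ (cx ∧ ex) n | ⟦∧⟧ cx ex | ⟦∧⟧ cx n | ⟦∧⟧ (t ∧ ea) ex | ⟦∧⟧ t ea
        = identity ⟦ t ⟧ ⟦ ca ⟧ ⟦ cx ⟧ ⟦ n ⟧ ⟦ ea ⟧ ⟦ ex ⟧
        where
        identity : ∀ t ca cx n ea ex → t * ((ca * ea) * ((cx * ex) * n)) ≡ (ca * (cx * n)) * ((t * ea) * ex)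
        identity = solve-∀
      collect : ∀ a x → sum (λ y → term y a x) ≡ ⟦ C a ⟧ * (⟦ C x ∧ not (adj G a x) ⟧ * codeg a x)
      collect a x = trans (sum-cong-≗ (λ y → pointwise (T₀ y) (C a) (C x) (not (adj G a x)) (adj-sym G y a) (adj-sym G y x)))
        (trans (sum-*ˡ (⟦ C a ⟧ * ⟦ C x ∧ not (adj G a x) ⟧) (λ y → ⟦ inter (inter T₀ a) x y ⟧)) (*-assoc ⟦ C a ⟧ _ _))

    Σgood : ℕ
    Σgood = sum (λ a → # (good a))

    -- Cauchy-Schwarz in its termwise form `2 q D c ≤ (q D)² + c²`, for the number `D` of neighbours
    -- of `y` in `C`. The density gives twice `c² t₀` on the left; the squares `c²` cost one of
    -- these, and the terms `4 s²` a quarter by `4 s q ≤ c`. The remaining three quarters are scaled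
    -- by 8.
    lower : 6 * (c * c * t₀) ≤ q′ * ΣN
    lower = linear 0 (+-mono-≤ (*-monoʳ-≤ 8 (+-mono-≤ amgm edges)) (*-monoʳ-≤ t₀ (*-monoʳ-≤ 2 (*-mono-≤ 4sq≤C 4sq≤C))))
        (identity s q c t₀ Σdeg ΣN)
      where
      Σdeg : ℕ
      Σdeg = sum (λ y → ⟦ T₀ y ⟧ * # (inter C y))
      edges : 2 * c * (c * t₀) ≤ 2 * c * (q * Σdeg)
      edges = *-monoʳ-≤ (2 * c) (begin
        c * t₀ ≤⟨ sum-⟦⟧*≥ C (λ a → q * # (inter T₀ a)) t₀ (dense zeros (≤-trans (≤-reflexive (weight-zeros i)) z≤n)) ⟩
        sum (λ a → ⟦ C a ⟧ * (q * # (inter T₀ a))) ≡⟨ sum-cong-≗ (λ a → *-swap ⟦ C a ⟧ q (# (inter T₀ a))) ⟩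
        sum (λ a → q * (⟦ C a ⟧ * # (inter T₀ a))) ≡⟨ sum-*ˡ q (λ a → ⟦ C a ⟧ * # (inter T₀ a)) ⟩
        q * sum (λ a → ⟦ C a ⟧ * # (inter T₀ a)) ≡⟨ cong (q *_) degree-swap ⟨
        q * Σdeg ∎)
        where
        open ≤-Reasoning
      amgm-at : ∀ y → # (inter C y) * (2 * q * c) ≤ nonadjacent y * (q * q * (4 * s)) + (q * q * (4 * (s * s)) + c * c)
      amgm-at y = linear 0 (+-mono-≤ (2ab≤a²+b² (q * # (inter C y)) c) (*-monoʳ-≤ (q * q) (square-bound y))) (identity′ (# (inter C y)) (nonadjacent y) s q c)
        where
        identity′ : ∀ D N s q c → D * (2 * q * c) + ((q * D * (q * D) + c * c) + q * q * (4 * s * N + 4 * (s * s))) + 0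
          ≡ (N * (q * q * (4 * s)) + (q * q * (4 * (s * s)) + c * c)) + (2 * (q * D * c) + q * q * (D * D))
        identity′ = solve-∀
      amgm : Σdeg * (2 * q * c) ≤ ΣN * (q * q * (4 * s)) + t₀ * (q * q * (4 * (s * s)) + c * c)
      amgm = begin
        Σdeg * (2 * q * c) ≡⟨ sum-*ʳ (2 * q * c) (λ y → ⟦ T₀ y ⟧ * # (inter C y)) ⟨
        sum (λ y → ⟦ T₀ y ⟧ * # (inter C y) * (2 * q * c)) ≤⟨ sum-mono (λ y → ≤-trans (≤-reflexive (*-assoc ⟦ T₀ y ⟧ _ _)) (≤-trans (*-monoʳ-≤ ⟦ T₀ y ⟧ (amgm-at y)) (≤-reflexive (distrib ⟦ T₀ y ⟧ (nonadjacent y) _ _)))) ⟩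
        sum (λ y → ⟦ T₀ y ⟧ * nonadjacent y * (q * q * (4 * s)) + ⟦ T₀ y ⟧ * (q * q * (4 * (s * s)) + c * c))
          ≡⟨ sum-+ (λ y → ⟦ T₀ y ⟧ * nonadjacent y * (q * q * (4 * s))) _ ⟩
        sum (λ y → ⟦ T₀ y ⟧ * nonadjacent y * (q * q * (4 * s))) + sum (λ y → ⟦ T₀ y ⟧ * (q * q * (4 * (s * s)) + c * c))
          ≡⟨ cong₂ _+_ (sum-*ʳ (q * q * (4 * s)) (λ y → ⟦ T₀ y ⟧ * nonadjacent y)) (sum-*ʳ (q * q * (4 * (s * s)) + c * c) (λ y → ⟦ T₀ y ⟧)) ⟩
        ΣN * (q * q * (4 * s)) + t₀ * (q * q * (4 * (s * s)) + c * c) ∎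
        where
        open ≤-Reasoning
        distrib : ∀ t n a b → t * (n * a + b) ≡ t * n * a + t * b
        distrib = solve-∀
      identity : ∀ s q c t d N →
        6 * (c * c * t) + (8 * ((N * (q * q * (4 * s)) + t * (q * q * (4 * (s * s)) + c * c)) + 2 * c * (q * d)) + t * (2 * (c * c))) + 0
        ≡ 32 * s * (q * q) * N + (8 * (d * (2 * q * c) + 2 * c * (c * t)) + t * (2 * (4 * s * q * (4 * s * q))))
      identity = solve-∀

    cellBound : V → V → ℕ
    cellBound a x = ⟦ C x ⟧ * loss a + ⟦ C x ⟧ * pairLoss a x + ⟦ good a x ⟧

    rowBound nonadjCodeg : V → ℕ
    rowBound a = c * loss a + sum (λ x → ⟦ C x ⟧ * pairLoss a x) + # (good a)
    nonadjCodeg a = sum (λ x → ⟦ C x ∧ not (adj G a x) ⟧ * codeg a x)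

    -- `codeg-bound` summed over all pairs. `loss a` is independent of `x`, and `pairLoss` is summed
    -- over `a` for fixed `x`, so that each of the two costs at most `c` times the number of
    -- covering vertices.
    upper : q′ * ΣN ≤ q′ * t₀ * (2 * (c * (2 ^ i * s)) + Σgood) + c * c * t₀
    upper = begin
      q′ * ΣN ≡⟨ cong (q′ *_) pair-swap ⟩
      q′ * sum (λ a → ⟦ C a ⟧ * nonadjCodeg a) ≡⟨ sum-*ˡ {order G} q′ _ ⟨
      sum (λ a → q′ * (⟦ C a ⟧ * nonadjCodeg a)) ≤⟨ sum-mono row ⟩
      sum (λ a → q′ * t₀ * rowBound a + ⟦ C a ⟧ * (c * t₀))
        ≡⟨ sum-+ (λ a → q′ * t₀ * rowBound a) (λ a → ⟦ C a ⟧ * (c * t₀)) ⟩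
      sum (λ a → q′ * t₀ * rowBound a) + sum (λ a → ⟦ C a ⟧ * (c * t₀))
        ≡⟨ cong₂ _+_ (sum-*ˡ (q′ * t₀) rowBound) (trans (sum-*ʳ (c * t₀) (λ a → ⟦ C a ⟧)) (sym (*-assoc c c t₀))) ⟩
      q′ * t₀ * sum rowBound + c * c * t₀
        ≤⟨ +-monoˡ-≤ (c * c * t₀) (*-monoʳ-≤ (q′ * t₀) total) ⟩
      q′ * t₀ * (2 * (c * (2 ^ i * s)) + Σgood) + c * c * t₀ ∎
      where
      open ≤-Reasoning
      entry : ∀ a → C a ≡ true → ∀ x → q′ * (⟦ C x ∧ not (adj G a x) ⟧ * codeg a x) ≤
        q′ * t₀ * cellBound a x + ⟦ C x ⟧ * t₀
      entry a Ca x with ≡true⊎≡false (C x ∧ not (adj G a x))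
      ... | inj₂ e rewrite e | *-zeroʳ q′ = z≤n
      ... | inj₁ e = begin
        q′ * (⟦ C x ∧ not (adj G a x) ⟧ * codeg a x) ≤⟨ *-monoʳ-≤ q′ (⟦⟧*≤ (C x ∧ not (adj G a x)) _) ⟩
        q′ * codeg a x ≤⟨ codeg-bound a x Ca e ⟩
        q′ * t₀ * (loss a + pairLoss a x + ⟦ good a x ⟧) + t₀ ≡⟨ subst (λ z → q′ * t₀ * (loss a + pairLoss a x + ⟦ good a x ⟧) + t₀ ≡ q′ * t₀ * (z * loss a + z * pairLoss a x + ⟦ good a x ⟧) + z * t₀) (sym (⟦⟧-true {C x} (∧-elimˡ e))) (ones (q′ * t₀) (loss a) (pairLoss a x) ⟦ good a x ⟧ t₀) ⟩
        q′ * t₀ * cellBound a x + ⟦ C x ⟧ * t₀ ∎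
        where
        ones : ∀ k l p g t → k * (l + p + g) + t ≡ k * (1 * l + 1 * p + g) + 1 * t
        ones = solve-∀
      row : ∀ a → q′ * (⟦ C a ⟧ * nonadjCodeg a) ≤
        q′ * t₀ * rowBound a + ⟦ C a ⟧ * (c * t₀)
      row a with ≡true⊎≡false (C a)
      ... | inj₂ e rewrite cong ⟦_⟧ e | *-zeroʳ q′ = z≤n
      ... | inj₁ e = begin
        q′ * (⟦ C a ⟧ * nonadjCodeg a) ≤⟨ *-monoʳ-≤ q′ (⟦⟧*≤ (C a) _) ⟩
        q′ * nonadjCodeg a ≡⟨ sum-*ˡ {order G} q′ _ ⟨
        sum (λ x → q′ * (⟦ C x ∧ not (adj G a x) ⟧ * codeg a x)) ≤⟨ sum-mono (entry a e) ⟩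
        sum (λ x → q′ * t₀ * cellBound a x + ⟦ C x ⟧ * t₀)
          ≡⟨ sum-+ (λ x → q′ * t₀ * cellBound a x) (λ x → ⟦ C x ⟧ * t₀) ⟩
        sum (λ x → q′ * t₀ * cellBound a x) + sum (λ x → ⟦ C x ⟧ * t₀)
          ≡⟨ cong₂ _+_ (trans (sum-*ˡ {order G} (q′ * t₀) _) (cong (q′ * t₀ *_) (trans (sum-+ (λ x → ⟦ C x ⟧ * loss a + ⟦ C x ⟧ * pairLoss a x) (λ x → ⟦ good a x ⟧))
               (cong (_+ # (good a)) (trans (sum-+ (λ x → ⟦ C x ⟧ * loss a) (λ x → ⟦ C x ⟧ * pairLoss a x)) (cong (_+ sum (λ x → ⟦ C x ⟧ * pairLoss a x)) (sum-*ʳ (loss a) (λ x → ⟦ C x ⟧))))))))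
               (sum-*ʳ t₀ (λ x → ⟦ C x ⟧)) ⟩
        q′ * t₀ * rowBound a + c * t₀
          ≡⟨ cong (q′ * t₀ * rowBound a +_) (trans (sym (*-identityˡ (c * t₀))) (cong (_* (c * t₀)) (sym (⟦⟧-true e)))) ⟩
        q′ * t₀ * rowBound a + ⟦ C a ⟧ * (c * t₀) ∎
      total : sum rowBound ≤ 2 * (c * (2 ^ i * s)) + Σgood
      total = begin
        sum rowBound ≡⟨ sum-+ (λ a → c * loss a + sum (λ x → ⟦ C x ⟧ * pairLoss a x)) (λ a → # (good a)) ⟩
        sum (λ a → c * loss a + sum (λ x → ⟦ C x ⟧ * pairLoss a x)) + Σgood ≡⟨ cong (_+ Σgood) (sum-+ (λ a → c * loss a) _) ⟩
        sum (λ a → c * loss a) + sum (λ a → sum (λ x → ⟦ C x ⟧ * pairLoss a x)) + Σgood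
          ≡⟨ cong (_+ Σgood) (cong₂ _+_ (sum-*ˡ c loss) (trans (∑-comm (λ a x → ⟦ C x ⟧ * pairLoss a x)) (sum-cong-≗ (λ x → sum-*ˡ ⟦ C x ⟧ (λ a → pairLoss a x))))) ⟩
        c * sum loss + sum (λ x → ⟦ C x ⟧ * sum (λ a → pairLoss a x)) + Σgood
          ≤⟨ +-monoˡ-≤ Σgood (+-mono-≤ (*-monoʳ-≤ c Σloss) (sum-⟦⟧*≤ C _ (2 ^ i * s) ΣpairLoss)) ⟩
        c * (2 ^ i * s) + c * (2 ^ i * s) + Σgood ≡⟨ cong (_+ Σgood) (cong (c * (2 ^ i * s) +_) (sym (+-identityʳ _))) ⟩
        2 * (c * (2 ^ i * s)) + Σgood ∎

    many-good : 4 * (c * c) ≤ q′ * Σgood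
    many-good = linear 0 (+-mono-≤ (*-cancelʳ-≤ _ _ t₀ ⦃ >-nonZero 1≤t₀ ⦄
        (≤-trans (≤-reflexive (identity₁ c t₀)) (≤-trans lower (≤-trans upper (≤-reflexive (identity₂ q′ t₀ c (2 ^ i * s) Σgood))))))
        (*-monoʳ-≤ c 2q′≤C)) (identity₃ q′ c (2 ^ i * s) Σgood)
      where
      identity₁ : ∀ c t → 6 * (c * c) * t ≡ 6 * (c * c * t)
      identity₁ = solve-∀
      identity₂ : ∀ q t c w g → q * t * (2 * (c * w) + g) + c * c * t ≡ (q * (2 * (c * w) + g) + c * c) * t
      identity₂ = solve-∀
      identity₃ : ∀ q c w g → 4 * (c * c) + ((q * (2 * (c * w) + g) + c * c) + c * c) + 0 ≡ q * g + (6 * (c * c) + c * (2 * q * w))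
      identity₃ = solve-∀

    -- The average is taken over all vertices of G. That the pivot lies in `C` follows afterwards
    -- from any element of `good a`.
    pivot : ∃ λ a → ⟦ C a ⟧ * c < q′ * # (good a)
    pivot = sum-<⇒∃ (begin-strict
      sum (λ a → ⟦ C a ⟧ * c) ≡⟨ sum-*ʳ c (λ a → ⟦ C a ⟧) ⟩
      c * c <⟨ more (*-mono-≤ 1≤C 1≤C) ⟩
      4 * (c * c) ≤⟨ many-good ⟩
      q′ * Σgood ≡⟨ sum-*ˡ q′ (λ a → # (good a)) ⟨
      sum (λ a → q′ * # (good a)) ∎)
      where
      open ≤-Reasoning
      more : ∀ {x} → 1 ≤ x → x < 4 * x
      more {x} 1≤x = linear (2 * x) 1≤x (identity x)
        where
        identity : ∀ x → suc x + x + 2 * x ≡ 4 * x + 1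
        identity = solve-∀

-- Branch vertices and independent subdivision vertices from a dense pair.

-- The sizes that k further steps of KssFree.Step require of the sets typ Y as π and of the candidate set C.
typeSize : ℕ → ℕ → ℕ → ℕ → ℕ
typeSize s base zero    q = base
typeSize s base (suc k) q = 2 * s * q * typeSize s base k (next s q)

candidateSize : ℕ → ℕ → ℕ → ℕ → ℕ
candidateSize s h zero    q = 0
candidateSize s h (suc k) q = next s q * candidateSize s h k (next s q) + (4 * s * q + 2 * next s q * (2 ^ h * s) + 1)

-- The first summand pays for deleting the neighbours of a chosen vertex, the second for avoiding
-- vertices that cover one of the remaining sets.
threshold : ℕ → ℕ → ℕ
threshold s zero    = 1
threshold s (suc m) = 2 * s * threshold s m + suc m * s

module DensePair (G : Graph) (s : ℕ) (1≤s : 1 ≤ s) (noKss : ¬ ContainsKss s G) where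
  open Neighbourhoods G
  open KssFree G s 1≤s noKss

  1≤next : ∀ {q} → 1 ≤ q → 1 ≤ next s q
  1≤next 1≤q = *-mono-≤ (*-mono-≤ {1} {32} (s≤s z≤n) 1≤s) (*-mono-≤ 1≤q 1≤q)

  2sq≤next : ∀ {q} → 1 ≤ q → q * (2 * s) ≤ next s q
  2sq≤next {q} 1≤q = linear (30 * s * (q * q)) (*-monoʳ-≤ (2 * s) (*-monoʳ-≤ q 1≤q)) (identity s q)
    where
    identity : ∀ s q → q * (2 * s) + 2 * s * (q * q) + 30 * s * (q * q) ≡ 32 * s * (q * q) + 2 * s * (q * 1)
    identity = solve-∀

  advance : ∀ {i Y C q m} {as : Vec V i} → State Y as C q m → 1 ≤ q → 2 * s * q ≤ m → 4 * s * q ≤ # C →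
    2 * next s q * (2 ^ i * s) ≤ # C → 1 ≤ # C → ∀ m′ → 2 * s * q * m′ ≤ m →
    ∃ λ a → ∃ λ C′ → # C ≤ next s q * # C′ × State Y (a ∷ as) C′ (next s q) m′
  advance {i} {Y} {C} {q} {m} {as} st 1≤q 2sq≤m 4sq≤C 2q′≤C 1≤C m′ m′-small =
    a , good a , #C≤ , record { indep = indep′ ; apart = apart′ ; large = large′ ; dense = dense′ }
    where
    open Step st 1≤q 2sq≤m 4sq≤C 2q′≤C 1≤C
    open State st
    a : V
    a = proj₁ pivot
    nonempty : ∃ λ x → good a x ≡ true
    nonempty = #-∃ {P = good a} (positive (proj₂ pivot))
      where
      positive : ∀ {x y} → x < q′ * y → 1 ≤ y
      positive {x} {zero}  p = ⊥-elim (<⇒≱ p (≤-trans (≤-reflexive (*-zeroʳ q′)) z≤n))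
      positive {x} {suc y} p = s≤s z≤n
    Ca : C a ≡ true
    Ca = ∧-elimˡ {C a} (proj₂ nonempty)
    #C≤ : # C ≤ q′ * # (good a)
    #C≤ = ≤-trans (≤-reflexive (sym (*-identityˡ c))) (<⇒≤ (subst (λ z → z * c < q′ * # (good a)) (⟦⟧-true Ca) (proj₂ pivot)))
    goodC : ∀ {x} → good a x ≡ true → (C x ∧ not (adj G a x)) ≡ true
    goodC {x} g = ∧-elimˡ {C x ∧ not (adj G a x)} (∧-elimʳ {C a} g)
    goodTail : ∀ {x} → good a x ≡ true → ((t₀ ≤ᵇ q′ * codeg a x) ∧ (loss a + pairLoss a x ≤ᵇ 0)) ≡ true
    goodTail {x} g = ∧-elimʳ {C x ∧ not (adj G a x)} (∧-elimʳ {C a} g)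
    no-losses : ∀ {x} → good a x ≡ true → loss a + pairLoss a x ≤ 0
    no-losses {x} g = ≤ᵇ-elim {loss a + pairLoss a x} {0} (∧-elimʳ {t₀ ≤ᵇ q′ * codeg a x} (goodTail {x} g))
    uncovered : ∀ (f P : Vec Bool i → Bool) → 𝔼 1 (λ π → ⟦ f π ⟧ * ⟦ P π ⟧) ≤ 0 → ∀ π → f π ≡ true → P π ≡ false
    uncovered f P e π fπ with P π in eq
    ... | false = refl
    ... | true = ⊥-elim (<⇒≱ (≤-reflexive (sym (cong₂ _*_ (⟦⟧-true fπ) (⟦⟧-true eq)))) (≤-trans (term≤𝔼 (λ π → ⟦ f π ⟧ * ⟦ P π ⟧) π) e))
    indep′ : ∀ k l → adj G (lookup (a ∷ as) k) (lookup (a ∷ as) l) ≡ false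
    indep′ zero zero = adj-irrefl G a
    indep′ zero (suc l) = trans (adj-sym G a (lookup as l)) (apart l a Ca)
    indep′ (suc k) zero = apart k a Ca
    indep′ (suc k) (suc l) = indep k l
    apart′ : ∀ k x → good a x ≡ true → adj G (lookup (a ∷ as) k) x ≡ false
    apart′ zero x g = not-elim (∧-elimʳ {C x} (goodC {x} g))
    apart′ (suc k) x g = apart k x (∧-elimˡ {C x} (goodC {x} g))
    1≤2s : 1 ≤ 2 * s
    1≤2s = *-mono-≤ {1} {2} (s≤s z≤n) 1≤s
    shrink : ∀ u v {x} → 1 ≤ u → 1 ≤ v → u * (v * m′) ≤ u * x → m′ ≤ x
    shrink u v 1≤u 1≤v p = ≤-trans (m≤n*m m′ v ⦃ >-nonZero 1≤v ⦄) (*-cancelˡ-≤ u ⦃ >-nonZero 1≤u ⦄ p)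
    large′ : ∀ π → weight π ≤ 2 → m′ ≤ # (typ Y (a ∷ as) π)
    -- Inside the neighbourhood of `a` the earlier pattern has weight at most 1 and density applies.
    -- Outside it, the size is kept because `a` does not cover the type.
    large′ (true ∷ π) w = shrink q (2 * s) 1≤q 1≤2s (≤-trans (≤-reflexive (identity q s m′)) (≤-trans m′-small
        (≤-trans (large π (≤-trans (≤-pred w) (s≤s z≤n))) (dense π (≤-pred w) a Ca))))
      where
      identity : ∀ q s m → q * (2 * s * m) ≡ 2 * s * q * m
      identity = solve-∀
    large′ (false ∷ π) w = shrink (2 * s) q 1≤2s 1≤q (≤-trans (≤-reflexive (sym (*-assoc (2 * s) q m′))) (≤-trans m′-small (≤-trans (large π w) (covers-false (typ Y as π) a
        (uncovered (λ π → weight π ≤ᵇ 2) (λ π → covers (typ Y as π) a) (≤-trans (m≤m+n (loss a) (pairLoss a (proj₁ nonempty))) (no-losses {proj₁ nonempty} (proj₂ nonempty))) π (≤ᵇ-intro w))))))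
    dense′ : ∀ π → weight π ≤ 1 → ∀ x → good a x ≡ true → # (typ Y (a ∷ as) π) ≤ q′ * # (inter (typ Y (a ∷ as) π) x)
    dense′ (true ∷ π) w x g = subst (λ π → # (inter (typ Y as π) a) ≤ q′ * # (inter (inter (typ Y as π) a) x)) (sym (weight-0 π (≤-pred w)))
      (≤-trans (inter≤ T₀ a) (≤ᵇ-elim {t₀} {q′ * codeg a x} (∧-elimˡ {t₀ ≤ᵇ q′ * codeg a x} (goodTail {x} g))))
    -- The neighbours of `x` in the type are not covered by `a`, so enough of them lie outside the
    -- neighbourhood of `a`.
    dense′ (false ∷ π) w x g = begin
      # (diff P a) ≤⟨ diff≤ P a ⟩
      # P ≤⟨ dense π w x (∧-elimˡ {C x} (goodC {x} g)) ⟩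
      q * # (inter P x) ≤⟨ *-monoʳ-≤ q (covers-false (inter P x) a
        (uncovered (λ π → weight π ≤ᵇ 1) (λ π → covers (inter (typ Y as π) x) a) (≤-trans (m≤n+m (pairLoss a x) (loss a)) (no-losses {x} g)) π (≤ᵇ-intro w))) ⟩
      q * (2 * s * # (diff (inter P x) a)) ≡⟨ *-assoc q (2 * s) (# (diff (inter P x) a)) ⟨
      q * (2 * s) * # (diff (inter P x) a) ≤⟨ *-mono-≤ (2sq≤next 1≤q) (#-mono {P = diff (inter P x) a} {inter (diff P a) x} swap) ⟩
      q′ * # (inter (diff P a) x) ∎
      where
      open ≤-Reasoning
      P : V → Bool
      P = typ Y as π
      swap : ∀ y → diff (inter P x) a y ≡ true → inter (diff P a) x y ≡ true
      swap y p = ∧-intro (∧-intro (∧-elimˡ (∧-elimˡ p)) (∧-elimʳ {P y ∧ adj G x y} p)) (∧-elimʳ {P y} (∧-elimˡ p))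

  1≤typeSize : ∀ {base} k {q} → 1 ≤ base → 1 ≤ q → 1 ≤ typeSize s base k q
  1≤typeSize zero 1≤b 1≤q = 1≤b
  1≤typeSize (suc k) 1≤b 1≤q = *-mono-≤ (*-mono-≤ (*-mono-≤ {1} {2} (s≤s z≤n) 1≤s) 1≤q) (1≤typeSize k 1≤b (1≤next 1≤q))

  Branching : ℕ → (V → Bool) → ℕ → Set
  Branching h Y base = ∃ λ (bs : Vec V h) → (∀ k l → adj G (lookup bs k) (lookup bs l) ≡ false) × (∀ π → weight π ≤ 2 → base ≤ # (typ Y bs π))

  iterate : ∀ {h base} → 1 ≤ base → ∀ k {i Y C q} {as : Vec V i} → k + i ≡ h → 1 ≤ q → State Y as C q (typeSize s base k q) →
    candidateSize s h k q ≤ # C → Branching h Y base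
  iterate _ zero {as = as} refl _ st _ = as , State.indep st , State.large st
  iterate {h} {base} 1≤b (suc k) {i} {Y} {C} {q} {as} k+i≡h 1≤q st bound = continue (advance st 1≤q
      (≤-trans (≤-reflexive (sym (*-identityʳ (2 * s * q)))) (*-monoʳ-≤ (2 * s * q) (1≤typeSize k 1≤b (1≤next 1≤q))))
      (≤-trans (m≤m+n (4 * s * q) _) (≤-trans (m≤m+n (4 * s * q + 2 * next s q * (2 ^ h * s)) 1) extra))
      (≤-trans (*-monoʳ-≤ (2 * next s q) (*-monoˡ-≤ s (^-monoʳ-≤ 2 (≤-trans (m≤n+m i (suc k)) (≤-reflexive k+i≡h)))))
        (≤-trans (m≤n+m (2 * next s q * (2 ^ h * s)) (4 * s * q)) (≤-trans (m≤m+n (4 * s * q + 2 * next s q * (2 ^ h * s)) 1) extra)))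
      (≤-trans (m≤n+m 1 (4 * s * q + 2 * next s q * (2 ^ h * s))) extra)
      (typeSize s base k (next s q)) ≤-refl)
    where
    extra : 4 * s * q + 2 * next s q * (2 ^ h * s) + 1 ≤ # C
    extra = ≤-trans (m≤n+m _ (next s q * candidateSize s h k (next s q))) bound
    continue : (∃ λ a → ∃ λ C′ → # C ≤ next s q * # C′ × State Y (a ∷ as) C′ (next s q) (typeSize s base k (next s q))) → Branching h Y base
    continue (a , C′ , #C≤ , st′) = iterate 1≤b k (trans (+-suc k i) k+i≡h) (1≤next 1≤q) st′
      (*-cancelˡ-≤ (next s q) ⦃ >-nonZero (1≤next 1≤q) ⦄ (≤-trans (≤-trans (m≤m+n (next s q * candidateSize s h k (next s q)) _) bound) #C≤))

  1≤threshold : ∀ m → 1 ≤ threshold s m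
  1≤threshold zero    = ≤-refl
  1≤threshold (suc m) = ≤-trans (≤-trans 1≤s (m≤m+n s _)) (m≤n+m _ (2 * s * threshold s m))

  -- Greedy choice: fewer than `s` vertices cover any one of the later sets, so some vertex of the
  -- first set covers none of them, and deleting its neighbours leaves at least a `1 / (2 s)`
  -- fraction of each.
  independent-transversal : ∀ m (Ts : Fin m → V → Bool) → (∀ i → threshold s m ≤ # (Ts i)) →
    Σ (Fin m → V) λ y → (∀ i → Ts i (y i) ≡ true) × (∀ i j → adj G (y i) (y j) ≡ false)
  independent-transversal zero Ts _ = (λ ()) , (λ ()) , λ ()
  independent-transversal (suc m) Ts big = ys , ys∈ , ys-indep
    where
    bad : V → ℕ
    bad y = sum (λ i → ⟦ covers (Ts (suc i)) y ⟧)
    2s≤ : ∀ i → 2 * s ≤ # (Ts i)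
    2s≤ i = ≤-trans (≤-trans (≤-reflexive (sym (*-identityʳ _))) (*-monoʳ-≤ (2 * s) (1≤threshold m))) (≤-trans (m≤m+n _ (suc m * s)) (big i))
    Σbad : sum bad ≤ m * s
    Σbad = ≤-trans (≤-reflexive (∑-comm (λ y i → ⟦ covers (Ts (suc i)) y ⟧))) (≤-trans (sum-mono (λ i → <⇒≤ (few-covers (Ts (suc i)) (2s≤ (suc i))))) (≤-reflexive (sum-const m s)))
    first : ∃ λ y → bad y < ⟦ Ts zero y ⟧
    first = sum-<⇒∃ (≤-<-trans Σbad (≤-trans (+-monoˡ-≤ (m * s) 1≤s) (≤-trans (m≤n+m _ (2 * s * threshold s m)) (big zero))))
    y₀ : V
    y₀ = proj₁ first
    Ts′ : Fin m → V → Bool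
    Ts′ i = diff (Ts (suc i)) y₀
    big′ : ∀ i → threshold s m ≤ # (Ts′ i)
    big′ i = *-cancelˡ-≤ (2 * s) ⦃ >-nonZero (*-mono-≤ {1} {2} (s≤s z≤n) 1≤s) ⦄ (≤-trans (≤-trans (m≤m+n _ (suc m * s)) (big (suc i)))
      (covers-false (Ts (suc i)) y₀ (≢true⇒≡false (λ e → <⇒≱ (≤-<-trans (≤-trans (≤-reflexive (sym (⟦⟧-true e))) (term≤sum (λ i → ⟦ covers (Ts (suc i)) y₀ ⟧) i)) (proj₂ first)) (⟦⟧≤1 (Ts zero y₀))))))
    rest = independent-transversal m Ts′ big′
    ys : Fin (suc m) → V
    ys zero = y₀
    ys (suc i) = proj₁ rest i
    ys∈ : ∀ i → Ts i (ys i) ≡ true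
    ys∈ zero = ⟦⟧-elim (≤-trans (s≤s z≤n) (proj₂ first))
    ys∈ (suc i) = ∧-elimˡ (proj₁ (proj₂ rest) i)
    off : ∀ i → adj G y₀ (proj₁ rest i) ≡ false
    off i = not-elim (∧-elimʳ {Ts (suc i) (proj₁ rest i)} (proj₁ (proj₂ rest) i))
    ys-indep : ∀ i j → adj G (ys i) (ys j) ≡ false
    ys-indep zero zero = adj-irrefl G y₀
    ys-indep zero (suc j) = off j
    ys-indep (suc i) zero = trans (adj-sym G _ _) (off i)
    ys-indep (suc i) (suc j) = proj₂ (proj₂ rest) i j

  complete : ∀ {h} → Fin h → Fin h → Bool
  complete i j = not (i == j)

  -- One subdivision vertex is chosen for every ordered pair, the diagonal included. The vertex for
  -- `u , u` sees the branch vertex `u` and no other index, which is what shows the branch vertices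
  -- to be distinct.
  incidence : ∀ {h Y} → Branching h Y (threshold s (h * h)) → InducedIncidence G (complete {h}) (λ _ → true)
  incidence {h} {Y} (as , indep , large) = record
    { ι = lookup as
    ; mid = mid
    ; ι-inj = λ {u} {v} _ _ e → same u v e
    ; ι-indep = λ {u} {v} _ _ → indep u v
    ; mid-adjˡ = λ {u} {v} _ → trans (mid-adj u v u) (∨-introˡ (==-refl u))
    ; mid-adjʳ = λ {u} {v} _ → trans (mid-adj u v v) (∨-introʳ {u == v} (==-refl v))
    ; mid-only = λ {u} {v} {x} _ _ e → case ∨-elim {u == x} (trans (sym (mid-adj u v x)) e) of
        λ { (inj₁ p) → inj₁ (sym (==⇒≡ p)) ; (inj₂ p) → inj₂ (sym (==⇒≡ p)) }
    ; mid-indep = λ {u} {v} {u′} {v′} _ _ → proj₂ (proj₂ chosen) (combine u v) (combine u′ v′)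
    }
    where
    pair : Fin h → Fin h → Fin h → Bool
    pair u v k = (u == k) ∨ (v == k)
    pattern-of : Fin h × Fin h → Vec Bool h
    pattern-of (u , v) = tabulate (pair u v)
    weight≤2 : ∀ p → weight (pattern-of p) ≤ 2
    weight≤2 (u , v) = ≤-trans (#-cover {P = lookup (pattern-of (u , v))} {u ==_} {v ==_} (λ k e → ∨-elim (trans (sym (lookup∘tabulate (pair u v) k)) e)))
      (≤-reflexive (cong₂ _+_ (#-single u) (#-single v)))
    sets : Fin (h * h) → V → Bool
    sets e = typ Y as (pattern-of (remQuot h e))
    chosen = independent-transversal (h * h) sets (λ e → large (pattern-of (remQuot h e)) (weight≤2 (remQuot h e)))
    mid : Fin h → Fin h → V
    mid u v = proj₁ chosen (combine u v)
    mid-adj : ∀ u v k → adj G (lookup as k) (mid u v) ≡ (u == k) ∨ (v == k)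
    mid-adj u v k = trans (typ-lookup Y as (pattern-of (u , v)) (subst (λ p → typ Y as (pattern-of p) (mid u v) ≡ true) (remQuot-combine u v) (proj₁ (proj₂ chosen) (combine u v))) k)
      (lookup∘tabulate (pair u v) k)
    same : ∀ u v → lookup as u ≡ lookup as v → u ≡ v
    same u v e = case ∨-elim {u == v} (trans (sym (mid-adj u u v)) (trans (cong (λ a → adj G a (mid u u)) (sym e)) (trans (mid-adj u u u) (∨-introˡ (==-refl u))))) of
      λ { (inj₁ p) → ==⇒≡ p ; (inj₂ p) → ==⇒≡ p }

  dense-pair : ∀ h q (X Y : V → Bool) → 1 ≤ q → candidateSize s h h q ≤ # X → typeSize s (threshold s (h * h)) h q ≤ # Y →
    (∀ x → X x ≡ true → # Y ≤ q * # (inter Y x)) → InducedIncidence G (complete {h}) (λ _ → true)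
  dense-pair h q X Y 1≤q bigX bigY dense₀ = incidence (iterate {h} (1≤threshold (h * h)) h {0} {Y} {X} {q} {[]} (+-identityʳ h) 1≤q
    (record { indep = λ () ; apart = λ () ; large = λ { [] _ → bigY } ; dense = λ { [] _ → dense₀ } }) bigX)

-- Paths and topological minors.

record Path {N : ℕ} (F : Fin N → Fin N → Bool) (Q : Fin N → Bool) (x y : Fin N) : Set where
  field
    len    : ℕ
    at     : ℕ → Fin N
    start  : at 0 ≡ x
    end    : at len ≡ y
    step   : ∀ t → t < len → F (at t) (at (suc t)) ≡ true
    within : ∀ t → t ≤ len → Q (at t) ≡ true
    inj    : ∀ t u → t ≤ len → u ≤ len → at t ≡ at u → t ≡ u

module _ {N : ℕ} {F : Fin N → Fin N → Bool} where

  path-refl : ∀ {Q x} → Q x ≡ true → Path F Q x x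
  path-refl {x = x} Qx = record { len = 0 ; at = λ _ → x ; start = refl ; end = refl ; step = λ _ () ; within = λ _ _ → Qx
    ; inj = λ { t u z≤n z≤n _ → refl } }

  path-weaken : ∀ {Q R x y} → Q ⊆ R → Path F Q x y → Path F R x y
  path-weaken Q⊆R p = record { len = len ; at = at ; start = start ; end = end ; step = step ; within = λ t le → Q⊆R _ (within t le) ; inj = inj }
    where open Path p

  path-cons : ∀ {Q v x y} → Q v ≡ false → F v x ≡ true → Path F Q x y → Path F (λ z → Q z ∨ (v == z)) v y
  path-cons {Q} {v} {x} ¬Qv Fvx p = record { len = suc len ; at = at′ ; start = refl ; end = end ; step = step′ ; within = within′ ; inj = inj′ }
    where
    open Path p
    at′ : ℕ → Fin N
    at′ zero    = v
    at′ (suc t) = at t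
    step′ : ∀ t → t < suc len → F (at′ t) (at′ (suc t)) ≡ true
    step′ zero    _ = trans (cong (F v) start) Fvx
    step′ (suc t) (s≤s le) = step t le
    within′ : ∀ t → t ≤ suc len → Q (at′ t) ∨ (v == at′ t) ≡ true
    within′ zero    _ = ∨-introʳ {Q v} (==-refl v)
    within′ (suc t) (s≤s le) = ∨-introˡ (within t le)
    fresh : ∀ t → t ≤ len → v ≢ at t
    fresh t le e = true≢false (within t le) (trans (cong Q (sym e)) ¬Qv)
    inj′ : ∀ t u → t ≤ suc len → u ≤ suc len → at′ t ≡ at′ u → t ≡ u
    inj′ zero    zero    _ _ _ = refl
    inj′ zero    (suc u) _ (s≤s le) e = ⊥-elim (fresh u le e)
    inj′ (suc t) zero    (s≤s le) _ e = ⊥-elim (fresh t le (sym e))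
    inj′ (suc t) (suc u) (s≤s l₁) (s≤s l₂) e = cong suc (inj t u l₁ l₂ e)

  path-reverse : (∀ {u v} → F u v ≡ true → F v u ≡ true) → ∀ {Q x y} → Path F Q x y → Path F Q y x
  path-reverse F-sym p = record { len = len ; at = λ t → at (len ∸ t) ; start = end ; end = trans (cong at (n∸n≡0 len)) start
    ; step = λ t le → F-sym (subst (λ z → F (at (len ∸ suc t)) (at z) ≡ true) (sym (+-∸-assoc 1 le)) (step (len ∸ suc t) (≤-trans (≤-reflexive (sym (+-∸-assoc 1 le))) (m∸n≤m len t))))
    ; within = λ t _ → within (len ∸ t) (m∸n≤m len t)
    ; inj = λ t u l₁ l₂ e → trans (sym (m∸[m∸n]≡n l₁)) (trans (cong (len ∸_) (inj (len ∸ t) (len ∸ u) (m∸n≤m len t) (m∸n≤m len u) e)) (m∸[m∸n]≡n l₂)) }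
    where open Path p

-- The route has suc len edges, not len.
record Route {N h : ℕ} (F : Fin N → Fin N → Bool) (S : Fin N → Bool) (φ : Fin h → Fin N) (i j : Fin h) (len : ℕ) (at : ℕ → Fin N) : Set where
  field
    start  : at 0 ≡ φ i
    end    : at (suc len) ≡ φ j
    step   : ∀ t → t ≤ len → F (at t) (at (suc t)) ≡ true
    within : ∀ t → t ≤ suc len → S (at t) ≡ true
    inj    : ∀ t u → t ≤ suc len → u ≤ suc len → at t ≡ at u → t ≡ u
    avoid  : ∀ t → suc t ≤ len → ∀ b → at (suc t) ≢ φ b

-- `es` lists the edges routed so far, so that routes can be added one by one; `len` and `at` are
-- total and arbitrary off `es`.
record TopMinor {N h : ℕ} (F : Fin N → Fin N → Bool) (S : Fin N → Bool) (es : List (Fin h × Fin h)) : Set where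
  field
    φ        : Fin h → Fin N
    φ-inj    : ∀ {i j} → φ i ≡ φ j → i ≡ j
    φ-within : ∀ i → S (φ i) ≡ true
    len      : Fin h → Fin h → ℕ
    at       : Fin h → Fin h → ℕ → Fin N
    route    : ∀ {i j} → (i , j) ∈ es → Route F S φ i j (len i j) (at i j)
    disjoint : ∀ {i j i′ j′} → (i , j) ∈ es → (i′ , j′) ∈ es → ¬ (i ≡ i′ × j ≡ j′) →
               ∀ t t′ → suc t ≤ len i j → suc t′ ≤ len i′ j′ → at i j (suc t) ≢ at i′ j′ (suc t′)

topMinor-weaken : ∀ {N h} {F : Fin N → Fin N → Bool} {S S′} {es : List (Fin h × Fin h)} → S ⊆ S′ →
  TopMinor F S es → TopMinor F S′ es
topMinor-weaken S⊆S′ M = record { φ = φ ; φ-inj = φ-inj ; φ-within = λ i → S⊆S′ _ (φ-within i) ; len = len ; at = at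
  ; route = λ m → let open Route (route m) in record { start = start ; end = end ; step = step ; within = λ t le → S⊆S′ _ (within t le) ; inj = inj ; avoid = avoid }
  ; disjoint = disjoint }
  where open TopMinor M

through : ∀ {N} → Fin N → (ℕ → Fin N) → ℕ → Fin N → ℕ → Fin N
through x w l y zero    = x
through x w l y (suc t) = if t ≤ᵇ l then w t else y

through-inner : ∀ {N} (x : Fin N) w {l} y {t} → t ≤ l → through x w l y (suc t) ≡ w t
through-inner x w {l} y {t} le = cong (λ b → if b then w t else y) (≤ᵇ-intro le)

through-end : ∀ {N} (x : Fin N) w l y → through x w l y (suc (suc l)) ≡ y
through-end x w l y = cong (λ b → if b then w (suc l) else y) (≢true⇒≡false (λ e → <⇒≱ (n<1+n l) (≤ᵇ-elim {suc l} {l} e)))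

-- The old minor stays in `S` and the interior of the new route in the connected set `U`, so their
-- disjointness is automatic. The two ends enter `U` because every vertex of `S` has a neighbour
-- there.
addRoute : ∀ {N h} {F : Fin N → Fin N → Bool} {S S′ U : Fin N → Bool} {es : List (Fin h × Fin h)} {i j} →
  (∀ {u v} → F u v ≡ true → F v u ≡ true) →
  S ⊆ S′ → (∀ x → U x ≡ true → S x ≡ false) → U ⊆ S′ →
  (∀ x → S x ≡ true → ∃ λ u → U u ≡ true × F u x ≡ true) → (∀ u v → U u ≡ true → U v ≡ true → Path F U u v) →
  i ≢ j → TopMinor F S es → TopMinor F S′ ((i , j) ∷ es)
addRoute {N} {h} {F} {S} {S′} {U} {es} {i} {j} F-sym S⊆S′ U∩S U⊆S′ attach conn i≢j M = record
  { φ = φ ; φ-inj = φ-inj ; φ-within = λ i → S⊆S′ _ (φ-within i) ; len = len′ ; at = at′ ; route = route′ ; disjoint = disjoint′ }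
  where
  open TopMinor M
  x y u v : Fin N
  x = φ i
  y = φ j
  u = proj₁ (attach x (φ-within i))
  v = proj₁ (attach y (φ-within j))
  p : Path F U u v
  p = conn u v (proj₁ (proj₂ (attach x (φ-within i)))) (proj₁ (proj₂ (attach y (φ-within j))))
  module P = Path p
  new : ℕ → Fin N
  new = through x P.at P.len y
  is-new : Fin h → Fin h → Bool
  is-new k l = (i == k) ∧ (j == l)
  len′ : Fin h → Fin h → ℕ
  -- A path with `P.len` edges has `P.len + 1` vertices, and all of them are interior to the new
  -- route.
  len′ k l = if is-new k l then suc P.len else len k l
  at′ : Fin h → Fin h → ℕ → Fin N
  at′ k l = if is-new k l then new else at k l
  inner : ∀ t → t ≤ P.len → U (new (suc t)) ≡ true
  inner t le = trans (cong U (through-inner x P.at y le)) (P.within t le)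
  S≢U : ∀ {a b} → S a ≡ true → U b ≡ true → b ≢ a
  S≢U Sa Ub refl = true≢false Sa (U∩S _ Ub)
  end′ : new (suc (suc P.len)) ≡ y
  end′ = through-end x P.at P.len y
  data Position (t : ℕ) : Set where
    first : t ≡ 0 → Position t
    inside : ∀ s → s ≤ P.len → t ≡ suc s → Position t
    last : t ≡ suc (suc P.len) → Position t
  position : ∀ t → t ≤ suc (suc P.len) → Position t
  position zero _ = first refl
  position (suc t) (s≤s le) with t ≤? P.len
  ... | yes q = inside t q refl
  ... | no ¬q = last (cong suc (≤-antisym le (≰⇒> ¬q)))
  new-inj : ∀ {s t} → Position s → Position t → new s ≡ new t → s ≡ t
  new-inj (first refl) (first refl) e = refl
  new-inj (first refl) (inside s le refl) e = ⊥-elim (S≢U (φ-within i) (inner s le) (sym e))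
  new-inj (first refl) (last refl) e = ⊥-elim (i≢j (φ-inj (trans e end′)))
  new-inj (inside s le refl) (first refl) e = ⊥-elim (S≢U (φ-within i) (inner s le) e)
  new-inj (inside s le refl) (inside t le′ refl) e = cong suc (P.inj s t le le′ (trans (sym (through-inner x P.at y le)) (trans e (through-inner x P.at y le′))))
  new-inj (inside s le refl) (last refl) e = ⊥-elim (S≢U (φ-within j) (inner s le) (trans e end′))
  new-inj (last refl) (first refl) e = ⊥-elim (i≢j (φ-inj (sym (trans (sym end′) e))))
  new-inj (last refl) (inside s le refl) e = ⊥-elim (S≢U (φ-within j) (inner s le) (trans (sym e) end′))
  new-inj (last refl) (last refl) e = refl
  new-step : ∀ {t} → t ≤ suc P.len → Position t → F (new t) (new (suc t)) ≡ true
  new-step _ (first refl) = F-sym (trans (cong (λ z → F z x) (trans (through-inner x P.at {P.len} y {0} z≤n) P.start)) (proj₂ (proj₂ (attach x (φ-within i)))))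
  new-step _ (inside s le refl) with suc s ≤? P.len
  ... | yes q = trans (cong₂ F (through-inner x P.at y le) (through-inner x P.at y q)) (P.step s q)
  ... | no ¬q with ≤-antisym le (≤-pred (≰⇒> ¬q))
  ...   | refl = trans (cong₂ F (trans (through-inner x P.at y le) P.end) end′) (proj₂ (proj₂ (attach y (φ-within j))))
  new-step le (last refl) = ⊥-elim (<⇒≱ ≤-refl le)
  new-within : ∀ {t} → Position t → S′ (new t) ≡ true
  new-within (first refl) = S⊆S′ _ (φ-within i)
  new-within (inside s le refl) = U⊆S′ _ (inner s le)
  new-within (last refl) = trans (cong S′ end′) (S⊆S′ _ (φ-within j))
  new-route : Route F S′ φ i j (suc P.len) new
  new-route = record { start = refl ; end = end′
    ; step = λ t le → new-step le (position t (m≤n⇒m≤1+n le)) ; within = λ t le → new-within (position t le)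
    ; inj = λ s t l₁ l₂ → new-inj (position s l₁) (position t l₂)
    ; avoid = λ { t (s≤s le) b → S≢U (φ-within b) (inner t le) } }
  old : ∀ {k l} → is-new k l ≡ false → (k , l) ∈ ((i , j) ∷ es) → (k , l) ∈ es
  old ¬new (here refl) = true≢false {is-new i j} (∧-intro (==-refl i) (==-refl j)) ¬new
  old ¬new (there m) = m
  route′ : ∀ {k l} → (k , l) ∈ ((i , j) ∷ es) → Route F S′ φ k l (len′ k l) (at′ k l)
  route′ {k} {l} m with is-new k l in eq
  ... | true with ==⇒≡ (∧-elimˡ {i == k} eq) | ==⇒≡ (∧-elimʳ {i == k} eq)
  ...   | refl | refl = new-route
  route′ {k} {l} m | false = TopMinor.route (topMinor-weaken S⊆S′ M) (old eq m)
  disjoint′ : ∀ {k l k′ l′} → (k , l) ∈ ((i , j) ∷ es) → (k′ , l′) ∈ ((i , j) ∷ es) → ¬ (k ≡ k′ × l ≡ l′) →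
    ∀ t t′ → suc t ≤ len′ k l → suc t′ ≤ len′ k′ l′ → at′ k l (suc t) ≢ at′ k′ l′ (suc t′)
  disjoint′ {k} {l} {k′} {l′} m m′ ne t t′ le le′ with is-new k l in eq | is-new k′ l′ in eq′
  ... | true | true = ⊥-elim (ne (trans (sym (==⇒≡ (∧-elimˡ {i == k} eq))) (==⇒≡ (∧-elimˡ {i == k′} eq′)) , trans (sym (==⇒≡ (∧-elimʳ {i == k} eq))) (==⇒≡ (∧-elimʳ {i == k′} eq′))))
  ... | true | false = S≢U (Route.within (route (old eq′ m′)) (suc t′) (m≤n⇒m≤1+n le′)) (inner t (≤-pred le))
  ... | false | true = λ e → S≢U (Route.within (route (old eq m)) (suc t) (m≤n⇒m≤1+n le)) (inner t′ (≤-pred le′)) (sym e)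
  ... | false | false = disjoint (old eq m) (old eq′ m′) ne t t′ le le′

-- Mader's theorem: topological minors from large average degree.

degIn : ∀ {N} → (Fin N → Fin N → Bool) → (Fin N → Bool) → Fin N → ℕ
degIn F S u = # (λ v → S v ∧ F u v)

-- Ordered pairs are counted, so this is twice the number of edges when `F` is symmetric and
-- irreflexive.
edges₂ : ∀ {N} → (Fin N → Fin N → Bool) → (Fin N → Bool) → ℕ
edges₂ F S = sum (λ u → ⟦ S u ⟧ * degIn F S u)

⟦⟧-─ : ∀ {N} (S : Fin N → Bool) v → S v ≡ true → ∀ u → ⟦ S u ⟧ ≡ ⟦ (S ─ v) u ⟧ + ⟦ v == u ⟧
⟦⟧-─ S v Sv u with v ≟ u
... | yes refl rewrite Sv = refl
... | no _ with S u
...   | true  = refl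
...   | false = refl

edges₂-─ : ∀ {N} (F : Fin N → Fin N → Bool) (S : Fin N → Bool) v → (∀ {u v} → F u v ≡ true → F v u ≡ true) → S v ≡ true →
  edges₂ F S ≤ edges₂ F (S ─ v) + 2 * degIn F S v
edges₂-─ {N} F S v F-sym Sv = begin
  edges₂ F S ≤⟨ sum-mono pointwise ⟩
  sum (λ u → ⟦ (S ─ v) u ⟧ * degIn F (S ─ v) u + (⟦ S u ∧ F v u ⟧ + ⟦ v == u ⟧ * degIn F S u))
    ≡⟨ trans (sum-+ (λ u → ⟦ (S ─ v) u ⟧ * degIn F (S ─ v) u) (λ u → ⟦ S u ∧ F v u ⟧ + ⟦ v == u ⟧ * degIn F S u))
         (cong (edges₂ F (S ─ v) +_) (trans (sum-+ (λ u → ⟦ S u ∧ F v u ⟧) (λ u → ⟦ v == u ⟧ * degIn F S u)) (cong (degIn F S v +_) (trans (sum-single v (degIn F S)) (sym (+-identityʳ _)))))) ⟩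
  edges₂ F (S ─ v) + 2 * degIn F S v ∎
  where
  open ≤-Reasoning
  degree : ∀ u → degIn F S u ≤ degIn F (S ─ v) u + ⟦ F v u ⟧
  degree u = begin
    degIn F S u ≤⟨ sum-mono (λ w → cases w) ⟩
    sum (λ w → ⟦ (S ─ v) w ∧ F u w ⟧ + ⟦ v == w ⟧ * ⟦ F u w ⟧) ≡⟨ sum-+ (λ w → ⟦ (S ─ v) w ∧ F u w ⟧) (λ w → ⟦ v == w ⟧ * ⟦ F u w ⟧) ⟩
    degIn F (S ─ v) u + sum (λ w → ⟦ v == w ⟧ * ⟦ F u w ⟧) ≡⟨ cong (degIn F (S ─ v) u +_) (sum-single v (λ w → ⟦ F u w ⟧)) ⟩
    degIn F (S ─ v) u + ⟦ F u v ⟧ ≤⟨ +-monoʳ-≤ (degIn F (S ─ v) u) (⟦⟧-mono {F u v} {F v u} F-sym) ⟩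
    degIn F (S ─ v) u + ⟦ F v u ⟧ ∎
    where
    cases : ∀ w → ⟦ S w ∧ F u w ⟧ ≤ ⟦ (S ─ v) w ∧ F u w ⟧ + ⟦ v == w ⟧ * ⟦ F u w ⟧
    cases w = ≤-reflexive (trans (⟦∧⟧ (S w) (F u w)) (trans (cong (_* ⟦ F u w ⟧) (⟦⟧-─ S v Sv w))
      (trans (*-distribʳ-+ ⟦ F u w ⟧ ⟦ (S ─ v) w ⟧ ⟦ v == w ⟧) (cong (_+ ⟦ v == w ⟧ * ⟦ F u w ⟧) (sym (⟦∧⟧ ((S ─ v) w) (F u w)))))))
  pointwise : ∀ u → ⟦ S u ⟧ * degIn F S u ≤ ⟦ (S ─ v) u ⟧ * degIn F (S ─ v) u + (⟦ S u ∧ F v u ⟧ + ⟦ v == u ⟧ * degIn F S u)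
  pointwise u = begin
    ⟦ S u ⟧ * degIn F S u ≡⟨ cong (_* degIn F S u) (⟦⟧-─ S v Sv u) ⟩
    (⟦ (S ─ v) u ⟧ + ⟦ v == u ⟧) * degIn F S u ≡⟨ *-distribʳ-+ (degIn F S u) ⟦ (S ─ v) u ⟧ ⟦ v == u ⟧ ⟩
    ⟦ (S ─ v) u ⟧ * degIn F S u + ⟦ v == u ⟧ * degIn F S u ≤⟨ +-monoˡ-≤ _ (*-monoʳ-≤ ⟦ (S ─ v) u ⟧ (degree u)) ⟩
    ⟦ (S ─ v) u ⟧ * (degIn F (S ─ v) u + ⟦ F v u ⟧) + ⟦ v == u ⟧ * degIn F S u ≤⟨ +-monoˡ-≤ _ (≤-trans (≤-reflexive (*-distribˡ-+ ⟦ (S ─ v) u ⟧ _ _))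
      (+-monoʳ-≤ (⟦ (S ─ v) u ⟧ * degIn F (S ─ v) u) (≤-trans (*-monoˡ-≤ ⟦ F v u ⟧ (⟦⟧-mono {(S ─ v) u} {S u} ∧-elimˡ)) (≤-reflexive (sym (⟦∧⟧ (S u) (F v u))))))) ⟩
    ⟦ (S ─ v) u ⟧ * degIn F (S ─ v) u + ⟦ S u ∧ F v u ⟧ + ⟦ v == u ⟧ * degIn F S u ≡⟨ +-assoc (⟦ (S ─ v) u ⟧ * degIn F (S ─ v) u) _ _ ⟩
    ⟦ (S ─ v) u ⟧ * degIn F (S ─ v) u + (⟦ S u ∧ F v u ⟧ + ⟦ v == u ⟧ * degIn F S u) ∎

-- The number of edges per vertex from which `es` can be routed. It doubles with each edge: in the
-- neighbourhood of a contracted set this number survives as minimum degree, which is only half as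
-- many edges per vertex.
maderBound : ∀ {A : Set} → ℕ → List A → ℕ
maderBound h []       = suc h
maderBound h (e ∷ es) = 2 * maderBound h es

1≤maderBound : ∀ {A : Set} h (es : List A) → 1 ≤ maderBound h es
1≤maderBound h []       = s≤s z≤n
1≤maderBound h (e ∷ es) = *-mono-≤ {1} {2} (s≤s z≤n) (1≤maderBound h es)

module Mader {N : ℕ} (F : Fin N → Fin N → Bool) (F-sym : ∀ {u v} → F u v ≡ true → F v u ≡ true) (F-irrefl : ∀ {u v} → F u v ≡ true → u ≢ v) where

  Γ : (Fin N → Bool) → (Fin N → Bool) → Fin N → Bool
  Γ U W x = W x ∧ some (λ u → U u ∧ F u x)

  -- U is a connected set about to be contracted: the last field counts the edges of the graph obtained from U ∪ W by contracting U.
  record Contraction (c : ℕ) (U W : Fin N → Bool) : Set where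
    field
      connected : ∀ u v → U u ≡ true → U v ≡ true → Path F U u v
      disjoint  : ∀ x → U x ≡ true → W x ≡ false
      many      : 2 * c * suc (# W) ≤ edges₂ F W + 2 * # (Γ U W)

  seed : ∀ {c W} w → W w ≡ true → 2 * c * # W ≤ edges₂ F W → Contraction c (w ==_) (W ─ w)
  seed {c} {W} w Ww h = record
    { connected = λ u v p q → subst₂ (Path F (w ==_)) (==⇒≡ p) (==⇒≡ q) (path-refl (==-refl w))
    ; disjoint = λ x p → subst (λ z → (W ─ w) z ≡ false) (==⇒≡ p) (trans (cong (λ b → W w ∧ not b) (==-refl w)) (cong (_∧ false) Ww))
    ; many = ≤-trans (≤-reflexive (cong (2 * c *_) (sym (#-─ W w Ww)))) (≤-trans h (≤-trans (edges₂-─ F W w F-sym Ww) (+-monoʳ-≤ (edges₂ F (W ─ w)) (*-monoʳ-≤ 2 (#-mono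
        {P = λ x → W x ∧ F w x} {Γ (w ==_) (W ─ w)} λ x p → ∧-intro (─-intro {P = W} (∧-elimˡ p) (F-irrefl (∧-elimʳ {W x} p))) (some-intro {P = λ u → (w == u) ∧ F u x} w (∧-intro (==-refl w) (∧-elimʳ {W x} p)))))))) }

  -- Contracting `v` into `U` removes one vertex, the edge from `v` to `U`, and one of two parallel
  -- edges for each neighbour of `v` in `Γ U W`. These are at most `c` edges, so the ratio of edges
  -- to vertices does not drop below `c`.
  absorb : ∀ {c U W} v → Γ U W v ≡ true → suc (degIn F (Γ U W) v) ≤ c → Contraction c U W → Contraction c (λ z → U z ∨ (v == z)) (W ─ v)
  absorb {c} {U} {W} v Γv small C = record { connected = connected′ ; disjoint = disjoint′ ; many = many′ }
    where
    open Contraction C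
    Wv : W v ≡ true
    Wv = ∧-elimˡ Γv
    attach : ∃ λ u → (U u ∧ F u v) ≡ true
    attach = some-elim {P = λ u → U u ∧ F u v} (∧-elimʳ {W v} Γv)
    U′ W′ : Fin N → Bool
    U′ z = U z ∨ (v == z)
    W′ = W ─ v
    ¬Uv : U v ≡ false
    ¬Uv = ≢true⇒≡false (λ e → true≢false Wv (disjoint v e))
    from-v : ∀ u → U u ≡ true → Path F U′ v u
    from-v u Uu = path-cons ¬Uv (F-sym (∧-elimʳ {U (proj₁ attach)} (proj₂ attach))) (connected (proj₁ attach) u (∧-elimˡ (proj₂ attach)) Uu)
    connected′ : ∀ x y → U′ x ≡ true → U′ y ≡ true → Path F U′ x y
    connected′ x y p q with ∨-elim {U x} p | ∨-elim {U y} q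
    ... | inj₁ Ux | inj₁ Uy = path-weaken (λ z → ∨-introˡ) (connected x y Ux Uy)
    ... | inj₁ Ux | inj₂ e = path-reverse F-sym (subst (λ z → Path F U′ z x) (==⇒≡ e) (from-v x Ux))
    ... | inj₂ e | inj₁ Uy = subst (λ z → Path F U′ z y) (==⇒≡ e) (from-v y Uy)
    ... | inj₂ e | inj₂ e′ = subst₂ (Path F U′) (==⇒≡ e) (==⇒≡ e′) (path-refl (∨-introʳ {U v} (==-refl v)))
    disjoint′ : ∀ x → U′ x ≡ true → W′ x ≡ false
    disjoint′ x p = ≢true⇒≡false λ Wx → case ∨-elim {U x} p of
      λ { (inj₁ Ux) → true≢false (∧-elimˡ Wx) (disjoint x Ux) ; (inj₂ e) → ─-≢ {P = W} Wx (==⇒≡ e) }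
    Γ′ : Fin N → Bool
    Γ′ = Γ U′ W′
    -- The old neighbourhood without `v` and the neighbours of `v` in `W` both lie in `Γ′`, apart
    -- from indices counted by neither, and their overlap lies among the neighbours of `v` in
    -- `Γ U W`.
    exchange : # (Γ U W ─ v) + degIn F W v ≤ # Γ′ + degIn F (Γ U W) v
    exchange = ≤-trans (≤-reflexive (sym (sum-+ (λ x → ⟦ (Γ U W ─ v) x ⟧) (λ x → ⟦ W x ∧ F v x ⟧)))) (≤-trans (sum-mono pointwise) (≤-reflexive (sum-+ (λ x → ⟦ Γ′ x ⟧) (λ x → ⟦ Γ U W x ∧ F v x ⟧))))
      where
      in-Γ′ : ∀ x → W x ≡ true → v ≢ x → (Γ U W x ≡ true) ⊎ (F v x ≡ true) → Γ′ x ≡ true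
      in-Γ′ x Wx v≢x (inj₂ f) = ∧-intro (─-intro {P = W} Wx v≢x) (some-intro {P = λ u → U′ u ∧ F u x} v (∧-intro (∨-introʳ {U v} (==-refl v)) f))
      in-Γ′ x Wx v≢x (inj₁ g) with some-elim {P = λ u → U u ∧ F u x} (∧-elimʳ {W x} g)
      ... | u , p = ∧-intro (─-intro {P = W} Wx v≢x) (some-intro {P = λ u → U′ u ∧ F u x} u (∧-intro (∨-introˡ {U u} (∧-elimˡ p)) (∧-elimʳ {U u} p)))
      pointwise : ∀ x → ⟦ (Γ U W ─ v) x ⟧ + ⟦ W x ∧ F v x ⟧ ≤ ⟦ Γ′ x ⟧ + ⟦ Γ U W x ∧ F v x ⟧
      pointwise x with ≡true⊎≡false (W x)
      ... | inj₂ ¬Wx rewrite ¬Wx = z≤n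
      ... | inj₁ Wx with ≡true⊎≡false (F v x)
      ...   | inj₂ ¬f rewrite ¬f | Wx | +-identityʳ ⟦ (some (λ u → U u ∧ F u x)) ∧ not (v == x) ⟧ = ≤-trans (⟦⟧-mono {some (λ u → U u ∧ F u x) ∧ not (v == x)} {some (λ u → U′ u ∧ F u x) ∧ not (v == x)}
              λ p → ∧-intro (∧-elimʳ {W′ x} (in-Γ′ x Wx (==-not⇒≢ (∧-elimʳ {some (λ u → U u ∧ F u x)} p)) (inj₁ (∧-intro Wx (∧-elimˡ p))))) (∧-elimʳ {some (λ u → U u ∧ F u x)} p)) (≤-trans (≤-reflexive (cong ⟦_⟧ (flip (some (λ u → U′ u ∧ F u x)) (not (v == x))))) (m≤m+n _ _))
              where
              flip : ∀ a b → a ∧ b ≡ b ∧ a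
              flip true true = refl
              flip true false = refl
              flip false true = refl
              flip false false = refl
      ...   | inj₁ f = ≤-trans (+-mono-≤ (⟦⟧-mono {(Γ U W ─ v) x} {Γ U W x ∧ F v x} (λ p → ∧-intro (─-⊆ {P = Γ U W} p) f)) (≤-trans (⟦⟧≤1 _) (≤-reflexive (sym (⟦⟧-true (in-Γ′ x Wx (F-irrefl f) (inj₂ f))))))) (≤-reflexive (+-comm _ ⟦ Γ′ x ⟧))
    many′ : 2 * c * suc (# W′) ≤ edges₂ F W′ + 2 * # Γ′
    many′ = linear 0 (+-mono-≤ many (+-mono-≤ (edges₂-─ F W v F-sym Wv) (+-mono-≤ (*-monoʳ-≤ 2 exchange) (*-monoʳ-≤ 2 small))))
      (trans (cong (λ g → 2 * c * suc (# W′) + ((edges₂ F W + 2 * g) + ((edges₂ F W′ + 2 * degIn F W v) + (2 * (# Γ′ + degIn F (Γ U W) v) + 2 * c))) + 0) (#-─ (Γ U W) v Γv))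
      (trans (identity c (# W′) (edges₂ F W) (# (Γ U W ─ v)) (edges₂ F W′) (degIn F W v) (# Γ′) (degIn F (Γ U W) v))
      (cong (λ w → (edges₂ F W′ + 2 * # Γ′) + (2 * c * suc w + (edges₂ F W + (2 * (# (Γ U W ─ v) + degIn F W v) + 2 * suc (degIn F (Γ U W) v))))) (sym (#-─ W v Wv)))))
      where
      identity : ∀ c w e g e′ d g′ d′ → 2 * c * suc w + ((e + 2 * suc g) + ((e′ + 2 * d) + (2 * (g′ + d′) + 2 * c))) + 0
        ≡ (e′ + 2 * g′) + (2 * c * suc (suc w) + (e + (2 * (g + d) + 2 * suc d′)))
      identity = solve-∀

  module Grow {h} {e : Fin h × Fin h} {es : List (Fin h × Fin h)} (i≢j : proj₁ e ≢ proj₂ e)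
    (IH : ∀ S → 1 ≤ # S → 2 * maderBound h es * # S ≤ edges₂ F S → TopMinor F S es) where

    lowDegree : (Fin N → Bool) → (Fin N → Bool) → Fin N → Bool
    lowDegree U W v = Γ U W v ∧ (suc (degIn F (Γ U W) v) ≤ᵇ maderBound h (e ∷ es))

    -- `k` bounds the size of `W`, which shrinks in every call. If `U` has no neighbours in `W`,
    -- then `W` alone carries the density and a single vertex of it starts afresh. If every
    -- neighbour has large degree among the neighbours, the induction hypothesis applies to `Γ U W`
    -- and the new edge is routed through `U`. Otherwise a neighbour of low degree is absorbed.
    grow : ∀ k U W S → # W ≤ k → U ⊆ S → W ⊆ S →
      1 ≤ maderBound h es → Contraction (maderBound h (e ∷ es)) U W → TopMinor F S (e ∷ es)
    grow k U W S W≤k U⊆S W⊆S 1≤b C with 1 ≤? # (Γ U W)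
    ... | no empty = restart k W≤k (#-∃ {P = W} positive)
      where
      open Contraction C
      b : ℕ
      b = maderBound h (e ∷ es)
      Γ≡0 : # (Γ U W) ≡ 0
      Γ≡0 = n≤0⇒n≡0 (≤-pred (≰⇒> empty))
      many′ : 2 * b * suc (# W) ≤ edges₂ F W
      many′ = ≤-trans many (≤-reflexive (trans (cong (λ z → edges₂ F W + 2 * z) Γ≡0) (+-identityʳ _)))
      positive : 1 ≤ # W
      positive with 1 ≤? # W
      ... | yes p = p
      ... | no ¬p = ⊥-elim (<⇒≱ (≤-trans (*-mono-≤ (*-mono-≤ {1} {2} (s≤s z≤n) (*-mono-≤ {1} {2} (s≤s z≤n) 1≤b)) (s≤s {n = # W} z≤n)) many′)
              (≤-trans (sum-⟦⟧*≤ W (degIn F W) N (λ i _ → #≤n _)) (≤-reflexive (cong (_* N) (≱1⇒≡0 ¬p)))))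
      restart : ∀ k → # W ≤ k → (∃ λ w → W w ≡ true) → TopMinor F S (e ∷ es)
      restart zero le (w , Ww) = ⊥-elim (<⇒≱ (∃-# {P = W} w Ww) le)
      restart (suc k) le (w , Ww) = grow k (w ==_) (W ─ w) S (≤-pred (≤-trans (≤-reflexive (sym (#-─ W w Ww))) le))
        (λ x p → subst (λ z → S z ≡ true) (==⇒≡ p) (W⊆S w Ww)) (λ x p → W⊆S x (∧-elimˡ p)) 1≤b
        (seed w Ww (≤-trans (*-monoʳ-≤ (2 * b) (n≤1+n (# W))) many′))
    ... | yes nonempty with 1 ≤? # (lowDegree U W)
    ...   | no none = addRoute F-sym (λ x p → W⊆S x (∧-elimˡ p)) (λ x Ux → ≢true⇒≡false (λ p → true≢false (∧-elimˡ p) (disjoint x Ux))) U⊆S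
              (λ x p → let u , q = some-elim {P = λ u → U u ∧ F u x} (∧-elimʳ {W x} p) in u , ∧-elimˡ q , ∧-elimʳ {U u} q) connected i≢j
              (IH (Γ U W) nonempty (≤-trans (≤-reflexive (*-comm (2 * maderBound h es) (# (Γ U W)))) (sum-⟦⟧*≥ (Γ U W) (degIn F (Γ U W)) (2 * maderBound h es)
                λ v p → ≤-pred (≰⇒> (λ le → none (∃-# {P = lowDegree U W} v (∧-intro p (≤ᵇ-intro le))))))))
      where open Contraction C
    ...   | yes some-small with #-∃ {P = lowDegree U W} some-small
    ...     | v , p = continue k W≤k
      where
      Wv : W v ≡ true
      Wv = ∧-elimˡ (∧-elimˡ p)
      continue : ∀ k → # W ≤ k → TopMinor F S (e ∷ es)
      continue zero le = ⊥-elim (<⇒≱ (∃-# {P = W} v Wv) le)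
      continue (suc k) le = grow k _ (W ─ v) S (≤-pred (≤-trans (≤-reflexive (sym (#-─ W v Wv))) le))
        (λ x q → case ∨-elim {U x} q of λ { (inj₁ Ux) → U⊆S x Ux ; (inj₂ e) → subst (λ z → S z ≡ true) (==⇒≡ e) (W⊆S v Wv) }) (λ x q → W⊆S x (∧-elimˡ q)) 1≤b
        (absorb v (∧-elimˡ p) (≤ᵇ-elim (∧-elimʳ {Γ U W v} p)) C)

  mader : ∀ {h} (es : List (Fin h × Fin h)) → (∀ {i j} → (i , j) ∈ es → i ≢ j) → ∀ S → 1 ≤ # S → 2 * maderBound h es * # S ≤ edges₂ F S → TopMinor F S es
  mader {h} [] _ S 1≤S many with choose-distinct h S h≤S
    where
    h≤S : h ≤ # S
    h≤S = ≤-trans (≤-trans (n≤1+n h) (m≤n*m (suc h) 2)) (*-cancelʳ-≤ _ _ (# S) ⦃ >-nonZero 1≤S ⦄ (≤-trans many (sum-⟦⟧*≤ S (degIn F S) (# S) (λ u _ → #-mono {P = λ v → S v ∧ F u v} {S} (λ v → ∧-elimˡ)))))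
  ... | φ , φ-inj , φ∈ = record { φ = φ ; φ-inj = φ-inj ; φ-within = φ∈ ; len = λ _ _ → 0 ; at = λ i _ _ → φ i ; route = λ () ; disjoint = λ () }
  mader {h} (e ∷ es) distinct S 1≤S many with #-∃ {P = S} 1≤S
  ... | w , Sw = Grow.grow (distinct (here refl)) (mader es (λ m → distinct (there m))) (# (S ─ w)) (w ==_) (S ─ w) S ≤-refl
        (λ x p → subst (λ z → S z ≡ true) (==⇒≡ p) Sw) (λ x p → ∧-elimˡ p) (1≤maderBound h es) (seed w Sw many)

-- From a topological minor to an induced subdivision.

double : ℕ → ℕ
double zero    = zero
double (suc t) = suc (suc (double t))

double-inj : ∀ {s t} → double s ≡ double t → s ≡ t
double-inj {zero}  {zero}  _ = refl
double-inj {suc s} {suc t} e = cong suc (double-inj (suc-injective (suc-injective e)))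

odd≢even : ∀ s t → suc (double s) ≢ double t
odd≢even (suc s) (suc t) e = odd≢even s t (suc-injective (suc-injective e))

data Parity : ℕ → Set where
  even : ∀ t → Parity (double t)
  odd  : ∀ t → Parity (suc (double t))

parity : ∀ p → Parity p
parity zero = even 0
parity (suc zero) = odd 0
parity (suc (suc p)) with parity p
... | even t = even (suc t)
... | odd t  = odd (suc t)

double-≤ : ∀ {s t} → double s ≤ suc (double t) → s ≤ t
double-≤ {zero}          _ = z≤n
double-≤ {suc s} {suc t} (s≤s (s≤s p)) = s≤s (double-≤ p)
double-≤ {suc s} {zero}  (s≤s ())

forward-ordered : ∀ H {i j} → T (FwdEdge H i j) → toℕ i < toℕ j
forward-ordered H {i} {j} p with adj H i j
... | true = toWitness {a? = toℕ i <? toℕ j} p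

module Assemble (H G : Graph) {N : ℕ} {F : Fin N → Fin N → Bool} {V : Fin N → Bool} {es : List (Fin (order H) × Fin (order H))}
  (I : InducedIncidence G F V) (M : TopMinor F V es) (edges : ∀ i j → T (FwdEdge H i j) → (i , j) ∈ es) where
  open InducedIncidence I
  open TopMinor M

  -- A route with `len` interior vertices has `len + 1` edges, and each of them contributes a middle
  -- vertex. The length is never 0, in agreement with the independence of the branch vertices.
  ℓ : Lengths H
  ℓ i j = suc (double (len i j))

  interleave : (ℕ → Fin N) → ℕ → Fin (order G)
  interleave w zero          = ι (w 0)
  interleave w (suc zero)    = mid (w 0) (w 1)
  interleave w (suc (suc p)) = interleave (λ t → w (suc t)) p

  interleave-even : ∀ w t → interleave w (double t) ≡ ι (w t)
  interleave-even w zero    = refl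
  interleave-even w (suc t) = interleave-even (λ t → w (suc t)) t

  interleave-odd : ∀ w t → interleave w (suc (double t)) ≡ mid (w t) (w (suc t))
  interleave-odd w zero    = refl
  interleave-odd w (suc t) = interleave-odd (λ t → w (suc t)) t

  ψ : SubV H ℓ → Fin (order G)
  ψ (inj₁ i)               = ι (φ i)
  ψ (inj₂ (i , j , _ , k)) = interleave (at i j) (suc (toℕ k))

  -- The internal vertex with index `k` is at position `k + 1` of the interleaved route, so middle
  -- vertices have even indices and route vertices odd ones.
  data Point : SubV H ℓ → Set where
    branch   : ∀ b → Point (inj₁ b)
    interior : ∀ {i j} p k t → toℕ k ≡ suc (double t) → suc t ≤ len i j → Point (inj₂ (i , j , p , k))
    middle   : ∀ {i j} p k t → toℕ k ≡ double t → t ≤ len i j → Point (inj₂ (i , j , p , k))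

  point : ∀ x → Point x
  point (inj₁ b) = branch b
  point (inj₂ (i , j , p , k)) with toℕ k in eq | toℕ<n k | parity (toℕ k)
  ... | _ | s≤s le | even t = middle p k t eq (double-≤ (m≤n⇒m≤1+n le))
  ... | _ | s≤s le | odd t  = interior p k t eq (double-≤ (s≤s le))

  ψ-interior : ∀ {i j} p (k : Fin (ℓ i j)) t → toℕ k ≡ suc (double t) → ψ (inj₂ (i , j , p , k)) ≡ ι (at i j (suc t))
  ψ-interior {i} {j} p k t e = trans (cong (λ z → interleave (at i j) (suc z)) e) (interleave-even (at i j) (suc t))

  ψ-middle : ∀ {i j} p (k : Fin (ℓ i j)) t → toℕ k ≡ double t → ψ (inj₂ (i , j , p , k)) ≡ mid (at i j t) (at i j (suc t))
  ψ-middle {i} {j} p k t e = trans (cong (λ z → interleave (at i j) (suc z)) e) (interleave-odd (at i j) t)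

  module R {i j} (p : T (FwdEdge H i j)) = Route (route (edges i j p))

  same-pair? : ∀ (i j i′ j′ : Fin (order H)) → Dec (i ≡ i′ × j ≡ j′)
  same-pair? i j i′ j′ with i ≟ i′ | j ≟ j′
  ... | yes e | yes e′ = yes (e , e′)
  ... | no ne | _      = no (λ q → ne (proj₁ q))
  ... | _     | no ne  = no (λ q → ne (proj₂ q))

  at-branch : ∀ {i j} (p : T (FwdEdge H i j)) t → t ≤ suc (len i j) → ∀ b → at i j t ≡ φ b → (t ≡ 0 × b ≡ i) ⊎ (t ≡ suc (len i j) × b ≡ j)
  at-branch p zero _ b e = inj₁ (refl , sym (φ-inj (trans (sym (R.start p)) e)))
  at-branch {i} {j} p (suc t) (s≤s le) b e with suc t ≤? len i j
  ... | yes q = ⊥-elim (R.avoid p t q b e)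
  ... | no ¬q with ≤-antisym le (≤-pred (≰⇒> ¬q))
  ...   | refl = inj₂ (refl , sym (φ-inj (trans (sym (R.end p)) e)))

  interior-apart : ∀ {i j i′ j′} (p : T (FwdEdge H i j)) (p′ : T (FwdEdge H i′ j′)) → ¬ (i ≡ i′ × j ≡ j′) →
    ∀ t t′ → suc t ≤ len i j → t′ ≤ suc (len i′ j′) → at i j (suc t) ≢ at i′ j′ t′
  interior-apart p p′ ne t zero q _ e = R.avoid p t q _ (trans e (R.start p′))
  interior-apart {i} {j} {i′} {j′} p p′ ne t (suc t′) q (s≤s le) e with suc t′ ≤? len i′ j′
  ... | yes q′ = disjoint (edges i j p) (edges i′ j′ p′) ne t t′ q q′ e
  ... | no ¬q′ with ≤-antisym le (≤-pred (≰⇒> ¬q′))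
  ...   | refl = R.avoid p t q _ (trans e (R.end p′))

  meet-branch : ∀ {i j i′ j′} (p : T (FwdEdge H i j)) (p′ : T (FwdEdge H i′ j′)) → ¬ (i ≡ i′ × j ≡ j′) →
    ∀ t t′ → t ≤ suc (len i j) → t′ ≤ suc (len i′ j′) → at i j t ≡ at i′ j′ t′ → ∃ λ b → at i j t ≡ φ b
  meet-branch p p′ ne zero t′ _ _ e = _ , R.start p
  meet-branch {i} {j} p p′ ne (suc t) t′ (s≤s le) le′ e with suc t ≤? len i j
  ... | yes q = ⊥-elim (interior-apart p p′ ne t t′ q le′ e)
  ... | no ¬q with ≤-antisym le (≤-pred (≰⇒> ¬q))
  ...   | refl = _ , R.end p

  step-at : ∀ {i j} (p : T (FwdEdge H i j)) t → t ≤ len i j → F (at i j t) (at i j (suc t)) ≡ true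
  step-at p = R.step p

  at∈V : ∀ {i j} (p : T (FwdEdge H i j)) t → t ≤ suc (len i j) → V (at i j t) ≡ true
  at∈V p = R.within p

  interior∈V : ∀ {i j} (p : T (FwdEdge H i j)) t → suc t ≤ len i j → V (at i j (suc t)) ≡ true
  interior∈V p t le = at∈V p (suc t) (m≤n⇒m≤1+n le)

  Correct : SubV H ℓ → SubV H ℓ → Set
  Correct x y = (SubAdj H ℓ x y → adj G (ψ x) (ψ y) ≡ true) × (adj G (ψ x) (ψ y) ≡ true → SubAdj H ℓ x y)

  neither : ∀ x y → ¬ SubAdj H ℓ x y → adj G (ψ x) (ψ y) ≡ false → Correct x y
  neither x y ¬S ¬a = (λ S → ⊥-elim (¬S S)) , λ a → true≢false a ¬a

  SubAdj-sym : ∀ b x → SubAdj H ℓ (inj₂ b) x → SubAdj H ℓ x (inj₂ b)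
  SubAdj-sym b (inj₁ v) S = S
  SubAdj-sym b (inj₂ b′) (refl , refl , inj₁ e) = refl , refl , inj₂ e
  SubAdj-sym b (inj₂ b′) (refl , refl , inj₂ e) = refl , refl , inj₁ e

  SubAdj-sym′ : ∀ b x → SubAdj H ℓ x (inj₂ b) → SubAdj H ℓ (inj₂ b) x
  SubAdj-sym′ b (inj₁ v) S = S
  SubAdj-sym′ b (inj₂ b′) (refl , refl , inj₁ e) = refl , refl , inj₂ e
  SubAdj-sym′ b (inj₂ b′) (refl , refl , inj₂ e) = refl , refl , inj₁ e

  correct-sym : ∀ b x → Correct x (inj₂ b) → Correct (inj₂ b) x
  correct-sym b x (f , g) = (λ S → trans (adj-sym G (ψ (inj₂ b)) (ψ x)) (f (SubAdj-sym b x S))) , λ a → SubAdj-sym′ b x (g (trans (adj-sym G (ψ x) (ψ (inj₂ b))) a))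

  ι-apart : ∀ {x y u v} → V u ≡ true → V v ≡ true → ψ x ≡ ι u → ψ y ≡ ι v → adj G (ψ x) (ψ y) ≡ false
  ι-apart Vu Vv e e′ = trans (cong₂ (adj G) e e′) (ι-indep Vu Vv)

  branch-interior : ∀ {i j} b t → ¬ ((b ≡ i × suc (double t) ≡ 0) ⊎ (b ≡ j × suc (suc (double t)) ≡ ℓ i j))
  branch-interior b t (inj₁ (_ , ()))
  branch-interior b t (inj₂ (_ , e)) = odd≢even t _ (suc-injective e)

  -- The only adjacencies of an incidence structure are those between an end and a middle vertex.
  -- This reduces them, for branch vertices and route vertices alike, to equalities of vertices of
  -- `F`.
  vertex-middle : ∀ {x i j} v p (k : Fin (ℓ i j)) t → V v ≡ true → ψ x ≡ ι v → (e : toℕ k ≡ double t) → t ≤ len i j →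
    (SubAdj H ℓ x (inj₂ (i , j , p , k)) → (v ≡ at i j t) ⊎ (v ≡ at i j (suc t))) →
    ((v ≡ at i j t) ⊎ (v ≡ at i j (suc t)) → SubAdj H ℓ x (inj₂ (i , j , p , k))) → Correct x (inj₂ (i , j , p , k))
  vertex-middle v p k t Vv ev e le f g =
    (λ S → trans (cong₂ (adj G) ev (ψ-middle p k t e)) (adjacent (f S))) ,
    λ a → g (mid-only (step-at p t le) Vv (trans (sym (cong₂ (adj G) ev (ψ-middle p k t e))) a))
    where
    adjacent : (v ≡ at _ _ t) ⊎ (v ≡ at _ _ (suc t)) → adj G (ι v) (mid (at _ _ t) (at _ _ (suc t))) ≡ true
    adjacent (inj₁ refl) = mid-adjˡ (step-at p t le)
    adjacent (inj₂ refl) = mid-adjʳ (step-at p t le)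

  branch-middle : ∀ {i j} b p (k : Fin (ℓ i j)) t → toℕ k ≡ double t → t ≤ len i j → Correct (inj₁ b) (inj₂ (i , j , p , k))
  branch-middle {i} {j} b p k t e le = vertex-middle {inj₁ b} (φ b) p k t (φ-within b) refl e le to from
    where
    to : SubAdj H ℓ (inj₁ b) (inj₂ (i , j , p , k)) → (φ b ≡ at i j t) ⊎ (φ b ≡ at i j (suc t))
    to (inj₁ (refl , k≡0)) with double-inj {t} {0} (trans (sym e) k≡0)
    ... | refl = inj₁ (sym (R.start p))
    to (inj₂ (refl , k≡ℓ)) with double-inj {t} {len i j} (trans (sym e) (suc-injective k≡ℓ))
    ... | refl = inj₂ (sym (R.end p))
    from : (φ b ≡ at i j t) ⊎ (φ b ≡ at i j (suc t)) → SubAdj H ℓ (inj₁ b) (inj₂ (i , j , p , k))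
    from (inj₁ q) with at-branch p t (m≤n⇒m≤1+n le) b (sym q)
    ... | inj₁ (refl , b≡i) = inj₁ (b≡i , e)
    ... | inj₂ (refl , _) = ⊥-elim (<⇒≱ ≤-refl le)
    from (inj₂ q) with at-branch p (suc t) (s≤s le) b (sym q)
    ... | inj₂ (e′ , b≡j) = inj₂ (b≡j , cong suc (trans e (cong double (suc-injective e′))))

  interior-middle : ∀ {i j i′ j′} p (k : Fin (ℓ i j)) t p′ (k′ : Fin (ℓ i′ j′)) t′ → toℕ k ≡ suc (double t) → suc t ≤ len i j →
    toℕ k′ ≡ double t′ → t′ ≤ len i′ j′ → Correct (inj₂ (i , j , p , k)) (inj₂ (i′ , j′ , p′ , k′))
  interior-middle {i} {j} {i′} {j′} p k t p′ k′ t′ e le e′ le′ =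
    vertex-middle {inj₂ (i , j , p , k)} (at i j (suc t)) p′ k′ t′ (interior∈V p t le) (ψ-interior p k t e) e′ le′ to from
    where
    to : SubAdj H ℓ (inj₂ (i , j , p , k)) (inj₂ (i′ , j′ , p′ , k′)) → (at i j (suc t) ≡ at i′ j′ t′) ⊎ (at i j (suc t) ≡ at i′ j′ (suc t′))
    to (refl , refl , inj₁ s) = inj₁ (cong (at i j) (double-inj {suc t} {t′} (trans (cong suc (sym e)) (trans s e′))))
    to (refl , refl , inj₂ s) = inj₂ (cong (λ z → at i j (suc z)) (sym (double-inj {t′} {t} (suc-injective (trans (cong suc (sym e′)) (trans s e))))))
    from : (at i j (suc t) ≡ at i′ j′ t′) ⊎ (at i j (suc t) ≡ at i′ j′ (suc t′)) → SubAdj H ℓ (inj₂ (i , j , p , k)) (inj₂ (i′ , j′ , p′ , k′))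
    from q with same-pair? i j i′ j′
    from (inj₁ q) | no ne = ⊥-elim (interior-apart p p′ ne t t′ le (m≤n⇒m≤1+n le′) q)
    from (inj₂ q) | no ne = ⊥-elim (interior-apart p p′ ne t (suc t′) le (s≤s le′) q)
    from (inj₁ q) | yes (refl , refl) = refl , refl , inj₁ (trans (cong suc e) (trans (cong double (R.inj p (suc t) t′ (m≤n⇒m≤1+n le) (m≤n⇒m≤1+n le′) q)) (sym e′)))
    from (inj₂ q) | yes (refl , refl) = refl , refl , inj₂ (trans (cong suc e′) (trans (cong (λ z → suc (double z)) (sym (suc-injective (R.inj p (suc t) (suc t′) (m≤n⇒m≤1+n le) (s≤s le′) q)))) (sym e)))

  same-parity : ∀ {i j i′ j′ p p′} {k : Fin (ℓ i j)} {k′ : Fin (ℓ i′ j′)} (f : ℕ → ℕ) → (∀ s t → suc (f s) ≢ f t) → ∀ t t′ → toℕ k ≡ f t → toℕ k′ ≡ f t′ →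
    ¬ SubAdj H ℓ (inj₂ (i , j , p , k)) (inj₂ (i′ , j′ , p′ , k′))
  same-parity f ne t t′ e e′ (_ , _ , inj₁ s) = ne t t′ (trans (cong suc (sym e)) (trans s e′))
  same-parity f ne t t′ e e′ (_ , _ , inj₂ s) = ne t′ t (trans (cong suc (sym e′)) (trans s e))

  correct : ∀ {x y} → Point x → Point y → Correct x y
  correct (branch b) (branch b′) = neither (inj₁ b) (inj₁ b′) (λ { (_ , e) → positive e }) (ι-indep (φ-within b) (φ-within b′))
    where
    positive : lenU H ℓ b b′ ≢ 0
    positive with ⌊ toℕ b <? toℕ b′ ⌋
    ... | true  = λ ()
    ... | false = λ ()
  correct (branch b) (interior {i} {j} p k t e le) = neither (inj₁ b) (inj₂ (i , j , p , k))
    (λ S → branch-interior {i} {j} b t (subst (λ z → (b ≡ i × z ≡ 0) ⊎ (b ≡ j × suc z ≡ ℓ i j)) e S))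
    (ι-apart {inj₁ b} {inj₂ (i , j , p , k)} (φ-within b) (interior∈V p t le) refl (ψ-interior p k t e))
  correct (branch b) (middle p k t e le) = branch-middle b p k t e le
  correct (interior p k t e le) (branch b) = correct-sym (_ , _ , p , k) (inj₁ b) (correct (branch b) (interior p k t e le))
  correct (interior {i} {j} p k t e le) (interior {i′} {j′} p′ k′ t′ e′ le′) = neither (inj₂ (i , j , p , k)) (inj₂ (i′ , j′ , p′ , k′))
    (same-parity {p = p} {p′} (λ z → suc (double z)) (λ s t q → odd≢even s t (suc-injective q)) t t′ e e′)
    (ι-apart {inj₂ (i , j , p , k)} {inj₂ (i′ , j′ , p′ , k′)} (interior∈V p t le) (interior∈V p′ t′ le′) (ψ-interior p k t e) (ψ-interior p′ k′ t′ e′))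
  correct (interior p k t e le) (middle p′ k′ t′ e′ le′) = interior-middle p k t p′ k′ t′ e le e′ le′
  correct (middle p k t e le) (branch b) = correct-sym (_ , _ , p , k) (inj₁ b) (branch-middle b p k t e le)
  correct (middle p k t e le) (interior p′ k′ t′ e′ le′) = correct-sym (_ , _ , p , k) (inj₂ (_ , _ , p′ , k′)) (interior-middle p′ k′ t′ p k t e′ le′ e le)
  correct (middle {i} {j} p k t e le) (middle {i′} {j′} p′ k′ t′ e′ le′) = neither (inj₂ (i , j , p , k)) (inj₂ (i′ , j′ , p′ , k′))
    (same-parity {p = p} {p′} double odd≢even t t′ e e′)
    (trans (cong₂ (adj G) (ψ-middle p k t e) (ψ-middle p′ k′ t′ e′)) (mid-indep (step-at p t le) (step-at p′ t′ le′)))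

  -- A middle vertex has a neighbour among the images of `V`, while these images are independent.
  ι≢mid : ∀ {i j v} (p : T (FwdEdge H i j)) t → t ≤ len i j → V v ≡ true → ι v ≢ mid (at i j t) (at i j (suc t))
  ι≢mid p t le Vv e = true≢false (mid-adjˡ (step-at p t le)) (trans (cong (adj G _) (sym e)) (ι-indep (at∈V p t (m≤n⇒m≤1+n le)) Vv))

  same-element : ∀ {i j} {p p′ : T (FwdEdge H i j)} {k k′ : Fin (ℓ i j)} → toℕ k ≡ toℕ k′ → _≡_ {A = SubV H ℓ} (inj₂ (i , j , p , k)) (inj₂ (i , j , p′ , k′))
  same-element {i} {j} {p} {p′} e = cong₂ (λ p k → inj₂ (i , j , p , k)) (T-irrelevant p p′) (toℕ-injective e)

  -- By `mid-only` a middle vertex determines the two ends of its edge. Along one route injectivity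
  -- decides. Two routes sharing both ends of an edge share two branch vertices, hence join the same
  -- pair up to order, and forward edges have only one order.
  middle-inj : ∀ {i j i′ j′} (p : T (FwdEdge H i j)) (p′ : T (FwdEdge H i′ j′)) t t′ → t ≤ len i j → t′ ≤ len i′ j′ →
    mid (at i j t) (at i j (suc t)) ≡ mid (at i′ j′ t′) (at i′ j′ (suc t′)) → (i ≡ i′ × j ≡ j′) × t ≡ t′
  middle-inj {i} {j} {i′} {j′} p p′ t t′ le le′ e = conclude (same-pair? i j i′ j′)
    where
    end₁ : (at i j t ≡ at i′ j′ t′) ⊎ (at i j t ≡ at i′ j′ (suc t′))
    end₁ = mid-only (step-at p′ t′ le′) (at∈V p t (m≤n⇒m≤1+n le)) (trans (cong (adj G _) (sym e)) (mid-adjˡ (step-at p t le)))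
    end₂ : (at i j (suc t) ≡ at i′ j′ t′) ⊎ (at i j (suc t) ≡ at i′ j′ (suc t′))
    end₂ = mid-only (step-at p′ t′ le′) (at∈V p (suc t) (s≤s le)) (trans (cong (adj G _) (sym e)) (mid-adjʳ (step-at p t le)))
    le₀ : t′ ≤ suc (len i′ j′)
    le₀ = ≤-trans le′ (n≤1+n _)
    pick : ∀ {x} → (x ≡ at i′ j′ t′) ⊎ (x ≡ at i′ j′ (suc t′)) → ∃ λ u → u ≤ suc (len i′ j′) × x ≡ at i′ j′ u
    pick (inj₁ q) = t′ , le₀ , q
    pick (inj₂ q) = suc t′ , s≤s le′ , q
    conclude : Dec (i ≡ i′ × j ≡ j′) → (i ≡ i′ × j ≡ j′) × t ≡ t′
    conclude (yes (refl , refl)) = (refl , refl) , index end₁ end₂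
      where
      index : (at i j t ≡ at i′ j′ t′) ⊎ (at i j t ≡ at i′ j′ (suc t′)) → (at i j (suc t) ≡ at i′ j′ t′) ⊎ (at i j (suc t) ≡ at i′ j′ (suc t′)) → t ≡ t′
      index (inj₁ q) _ = R.inj p t t′ (m≤n⇒m≤1+n le) le₀ q
      index (inj₂ q) (inj₂ r) = suc-injective (R.inj p (suc t) (suc t′) (s≤s le) (s≤s le′) r)
      index (inj₂ q) (inj₁ r) with R.inj p t (suc t′) (m≤n⇒m≤1+n le) (s≤s le′) q | R.inj p (suc t) t′ (s≤s le) le₀ r
      ... | refl | e = ⊥-elim (<⇒≢ (m≤n⇒m≤1+n (n<1+n _)) (sym e))
    conclude (no ne) with pick end₁ | pick end₂
    ... | u , u≤ , q | w , w≤ , r with meet-branch p p′ ne t u (m≤n⇒m≤1+n le) u≤ q | meet-branch p p′ ne (suc t) w (s≤s le) w≤ r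
    ...   | b , qb | b′ , rb with at-branch p t (m≤n⇒m≤1+n le) b qb | at-branch p (suc t) (s≤s le) b′ rb
    ...     | inj₂ (refl , _) | _ = ⊥-elim (<⇒≱ ≤-refl le)
    ...     | inj₁ _ | inj₁ (() , _)
    ...     | inj₁ (refl , refl) | inj₂ (_ , refl) with at-branch p′ u u≤ i (trans (sym q) qb) | at-branch p′ w w≤ j (trans (sym r) rb)
    ...       | inj₁ (_ , refl) | inj₂ (_ , refl) = ⊥-elim (ne (refl , refl))
    ...       | inj₁ (_ , refl) | inj₁ (_ , refl) = ⊥-elim (<-irrefl refl (forward-ordered H p))
    ...       | inj₂ (_ , refl) | inj₂ (_ , refl) = ⊥-elim (<-irrefl refl (forward-ordered H p))
    ...       | inj₂ (_ , refl) | inj₁ (_ , refl) = ⊥-elim (<-asym (forward-ordered H p) (forward-ordered H p′))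

  injective : ∀ {x y} → Point x → Point y → ψ x ≡ ψ y → x ≡ y
  injective (branch b) (branch b′) e = cong inj₁ (φ-inj (ι-inj (φ-within b) (φ-within b′) e))
  injective (branch b) (interior p k t q le) e =
    ⊥-elim (R.avoid p t le b (ι-inj (interior∈V p t le) (φ-within b) (trans (sym (ψ-interior p k t q)) (sym e))))
  injective (branch b) (middle p k t q le) e = ⊥-elim (ι≢mid p t le (φ-within b) (trans e (ψ-middle p k t q)))
  injective (interior p k t q le) (branch b) e = sym (injective (branch b) (interior p k t q le) (sym e))
  injective (interior {i} {j} p k t q le) (interior {i′} {j′} p′ k′ t′ q′ le′) e = compare (same-pair? i j i′ j′)
    where
    e′ : at i j (suc t) ≡ at i′ j′ (suc t′)
    e′ = ι-inj (interior∈V p t le) (interior∈V p′ t′ le′) (trans (sym (ψ-interior p k t q)) (trans e (ψ-interior p′ k′ t′ q′)))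
    compare : Dec (i ≡ i′ × j ≡ j′) → _
    compare (no ne) = ⊥-elim (interior-apart p p′ ne t (suc t′) le (m≤n⇒m≤1+n le′) e′)
    compare (yes (refl , refl)) = same-element (trans q (trans (cong double′ (R.inj p (suc t) (suc t′) (m≤n⇒m≤1+n le) (m≤n⇒m≤1+n le′) e′)) (sym q′)))
      where
      double′ : ℕ → ℕ
      double′ z = suc (double (z ∸ 1))
  injective (interior p k t q le) (middle p′ k′ t′ q′ le′) e =
    ⊥-elim (ι≢mid p′ t′ le′ (interior∈V p t le) (trans (sym (ψ-interior p k t q)) (trans e (ψ-middle p′ k′ t′ q′))))
  injective (middle p k t q le) (branch b) e = sym (injective (branch b) (middle p k t q le) (sym e))
  injective (middle p k t q le) (interior p′ k′ t′ q′ le′) e = sym (injective (interior p′ k′ t′ q′ le′) (middle p k t q le) (sym e))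
  injective (middle p k t q le) (middle p′ k′ t′ q′ le′) e
    with middle-inj p p′ t t′ le le′ (trans (sym (ψ-middle p k t q)) (trans e (ψ-middle p′ k′ t′ q′)))
  ... | (refl , refl) , refl = same-element (trans q (sym q′))

  subdivision : ContainsInducedSubdivision H G
  subdivision = ℓ , ψ , (λ {x} {y} → injective (point x) (point y)) , λ x y → correct (point x) (point y)

-- Degeneracy and dense subgraphs.

record Orientation (G : Graph) (S : Fin (order G) → Bool) (d : ℕ) : Set where
  field
    left     : Fin (order G) → Fin (order G) → Bool
    left-adj : ∀ {u v} → left u v ≡ true → adj G u v ≡ true
    left-in  : ∀ {u v} → left u v ≡ true → S v ≡ true
    total    : ∀ {u v} → S u ≡ true → S v ≡ true → adj G u v ≡ true → (left u v ≡ true) ⊎ (left v u ≡ true)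
    left-≤   : ∀ v → # (λ u → left u v) ≤ d

module Degeneracy (G : Graph) where

  V : Set
  V = Fin (order G)

  Dense : ℕ → (V → Bool) → Set
  Dense d S = 1 ≤ # S × (∀ v → S v ≡ true → d ≤ degIn (adj G) S v)

  lowDegree : ℕ → (V → Bool) → V → Bool
  lowDegree d S v = S v ∧ (degIn (adj G) S v ≤ᵇ d)

  -- A vertex of degree at most `d` is removed and put back at the right end, where its left
  -- neighbours are its neighbours in `S`; by `left-in` it had none before.
  peel : ∀ d k S → # S ≤ k → Orientation G S d ⊎ ∃ (Dense (suc d))
  peel d k S S≤k with 1 ≤? # S
  ... | no empty = inj₁ (record { left = λ _ _ → false ; left-adj = λ () ; left-in = λ () ; total = λ Su _ _ → ⊥-elim (empty (∃-# {P = S} _ Su))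
                                ; left-≤ = λ v → ≤-trans (≤-reflexive (trans (sum-const (order G) 0) (*-zeroʳ (order G)))) z≤n })
  ... | yes nonempty with 1 ≤? # (lowDegree d S)
  ...   | no none = inj₂ (S , nonempty , λ v Sv → ≰⇒> (λ le → none (∃-# {P = lowDegree d S} v (∧-intro Sv (≤ᵇ-intro le)))))
  ...   | yes some-low with #-∃ {P = lowDegree d S} some-low
  ...     | v , p = extend k S≤k
    where
    Sv : S v ≡ true
    Sv = ∧-elimˡ p
    extend : ∀ k → # S ≤ k → Orientation G S d ⊎ ∃ (Dense (suc d))
    extend zero le = ⊥-elim (<⇒≱ (∃-# {P = S} v Sv) le)
    extend (suc k) le with peel d k (S ─ v) (≤-pred (≤-trans (≤-reflexive (sym (#-─ S v Sv))) le))
    ... | inj₂ D = inj₂ D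
    ... | inj₁ O = inj₁ (record { left = left′ ; left-adj = left-adj′ ; left-in = left-in′ ; total = total′ ; left-≤ = left-≤′ })
      where
      open Orientation O
      left′ : V → V → Bool
      left′ u w = left u w ∨ ((v == w) ∧ (S u ∧ adj G v u))
      left-adj′ : ∀ {u w} → left′ u w ≡ true → adj G u w ≡ true
      left-adj′ {u} {w} q with ∨-elim {left u w} q
      ... | inj₁ l = left-adj l
      ... | inj₂ r with ==⇒≡ {i = v} (∧-elimˡ r)
      ...   | refl = trans (adj-sym G u v) (∧-elimʳ {S u} (∧-elimʳ {v == v} r))
      left-in′ : ∀ {u w} → left′ u w ≡ true → S w ≡ true
      left-in′ {u} {w} q with ∨-elim {left u w} q
      ... | inj₁ l = ─-⊆ {P = S} (left-in l)
      ... | inj₂ r with ==⇒≡ {i = v} (∧-elimˡ r)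
      ...   | refl = Sv
      total′ : ∀ {u w} → S u ≡ true → S w ≡ true → adj G u w ≡ true → (left′ u w ≡ true) ⊎ (left′ w u ≡ true)
      total′ {u} {w} Su Sw a with v ≟ w | v ≟ u
      ... | yes refl | _ = inj₁ (∨-introʳ {left u v} (∧-intro Su (trans (adj-sym G v u) a)))
      ... | no _ | yes refl = inj₂ (∨-introʳ {left w v} (∧-intro Sw a))
      ... | no ne | no ne′ with total {u} {w} (─-intro {P = S} Su ne′) (─-intro {P = S} Sw ne) a
      ...   | inj₁ l = inj₁ (∨-introˡ l)
      ...   | inj₂ l = inj₂ (∨-introˡ l)
      left-≤′ : ∀ w → # (λ u → left′ u w) ≤ d
      left-≤′ w with ≡true⊎≡false (v == w)
      ... | inj₂ e = ≤-trans (#-mono {P = λ u → left′ u w} {λ u → left u w} λ u q → case ∨-elim {left u w} q of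
              λ { (inj₁ l) → l ; (inj₂ r) → true≢false (∧-elimˡ r) e }) (left-≤ w)
      ... | inj₁ e with ==⇒≡ {i = v} e
      ...   | refl = ≤-trans (#-mono {P = λ u → left′ u v} {λ u → S u ∧ adj G v u} λ u q → case ∨-elim {left u v} q of
              λ { (inj₁ l) → ⊥-elim (─-≢ {P = S} (left-in l) refl) ; (inj₂ r) → ∧-elimʳ {v == v} r }) (≤ᵇ-elim (∧-elimʳ {S v} p))

  everything : V → Bool
  everything _ = true

  -- `d` is raised until peeling succeeds, which happens because a minimum degree is smaller than
  -- the order. At that moment a single number bounds the degrees of a subgraph from below and all
  -- left degrees from above.
  maximal-dense : ∀ k d S → order G ≤ d + k → Dense (suc d) S → ∃ λ d′ → d < d′ × ∃ (Dense d′) × Orientation G everything d′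
  maximal-dense k d S n≤ D with peel (suc d) (order G) everything (#≤n everything)
  ... | inj₁ O = suc d , ≤-refl , (S , D) , O
  ... | inj₂ (S′ , D′) = continue k n≤
    where
    continue : ∀ k → order G ≤ d + k → ∃ λ d′ → d < d′ × ∃ (Dense d′) × Orientation G everything d′
    continue zero n≤ with #-∃ {P = S′} (proj₁ D′)
    ... | v , S′v = ⊥-elim (<⇒≱ (≤-trans (n<1+n (suc d)) (proj₂ D′ v S′v)) (≤-trans (#≤n (λ u → S′ u ∧ adj G v u)) (≤-trans n≤ (≤-trans (≤-reflexive (+-identityʳ d)) (n≤1+n d)))))
    continue (suc k) n≤ with maximal-dense k (suc d) S′ (≤-trans n≤ (≤-reflexive (+-suc d k))) D′
    ... | d′ , lt , rest = d′ , <-trans (n<1+n d) lt , rest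

  -- Each edge is charged to its right end.
  edges₂-≤ : ∀ {d} → Orientation G everything d → ∀ S → edges₂ (adj G) S ≤ 2 * (# S * d)
  edges₂-≤ {d} O S = begin
    edges₂ (adj G) S ≡⟨ sum-cong-≗ (λ u → sym (sum-*ˡ ⟦ S u ⟧ (λ v → ⟦ S v ∧ adj G u v ⟧))) ⟩
    sum (λ u → sum (λ v → ⟦ S u ⟧ * ⟦ S v ∧ adj G u v ⟧)) ≤⟨ sum-mono (λ u → sum-mono (λ v → pointwise u v)) ⟩
    sum (λ u → sum (λ v → ⟦ S v ⟧ * ⟦ left u v ⟧ + ⟦ S u ⟧ * ⟦ left v u ⟧)) ≡⟨ sum-cong-≗ (λ u → sum-+ (λ v → ⟦ S v ⟧ * ⟦ left u v ⟧) (λ v → ⟦ S u ⟧ * ⟦ left v u ⟧)) ⟩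
    sum (λ u → sum (λ v → ⟦ S v ⟧ * ⟦ left u v ⟧) + sum (λ v → ⟦ S u ⟧ * ⟦ left v u ⟧)) ≡⟨ sum-+ (λ u → sum (λ v → ⟦ S v ⟧ * ⟦ left u v ⟧)) (λ u → sum (λ v → ⟦ S u ⟧ * ⟦ left v u ⟧)) ⟩
    sum (λ u → sum (λ v → ⟦ S v ⟧ * ⟦ left u v ⟧)) + X ≡⟨ cong (_+ X) (∑-comm (λ u v → ⟦ S v ⟧ * ⟦ left u v ⟧)) ⟩
    X + X ≤⟨ +-mono-≤ X≤ (≤-trans X≤ (≤-reflexive (sym (+-identityʳ _)))) ⟩
    2 * (# S * d) ∎
    where
    open ≤-Reasoning
    open Orientation O
    X : ℕ
    X = sum (λ v → sum (λ u → ⟦ S v ⟧ * ⟦ left u v ⟧))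
    X≤ : X ≤ # S * d
    X≤ = ≤-trans (≤-reflexive (sum-cong-≗ (λ v → sum-*ˡ ⟦ S v ⟧ (λ u → ⟦ left u v ⟧)))) (sum-⟦⟧*≤ S (λ v → # (λ u → left u v)) d (λ v _ → left-≤ v))
    pointwise : ∀ u v → ⟦ S u ⟧ * ⟦ S v ∧ adj G u v ⟧ ≤ ⟦ S v ⟧ * ⟦ left u v ⟧ + ⟦ S u ⟧ * ⟦ left v u ⟧
    pointwise u v with S u | S v | adj G u v in eq
    ... | false | _     | _     = z≤n
    ... | true  | false | _     = z≤n
    ... | true  | true  | false = z≤n
    ... | true  | true  | true with total {u} {v} refl refl eq
    ...   | inj₁ l rewrite l = s≤s z≤n
    ...   | inj₂ l rewrite l = m≤n+m 1 (⟦ left u v ⟧ + 0)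

  degSum-≡ : degSum G ≡ edges₂ (adj G) everything
  degSum-≡ = trans (list-sum (deg G)) (sum-cong-≗ (λ v → trans (list-sum (λ u → if adj G v u then 1 else 0)) (trans (sum-cong-≗ (λ u → indicator (adj G v u))) (sym (+-identityʳ _)))))
    where
    indicator : ∀ b → (if b then 1 else 0) ≡ ⟦ b ⟧
    indicator true  = refl
    indicator false = refl
    tabulate-sum : ∀ {n} (f : Fin n → ℕ) → ListAction.sum (List.tabulate f) ≡ sum f
    tabulate-sum {zero}  f = refl
    tabulate-sum {suc n} f = cong (f zero +_) (tabulate-sum (f ∘ suc))
    list-sum : ∀ {n} (f : Fin n → ℕ) → ListAction.sum (map f (allFin n)) ≡ sum f
    list-sum f = trans (cong ListAction.sum (map-tabulate id f)) (tabulate-sum f)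

  dense-or-sparse : ∀ k → AvgDegAtMost G (2 * k) ⊎ (∃ λ d → k < d × ∃ (Dense d) × Orientation G everything d)
  dense-or-sparse k with peel k (order G) everything (#≤n everything)
  ... | inj₁ O = inj₁ (≤-trans (≤-reflexive degSum-≡) (≤-trans (edges₂-≤ O everything) (≤-reflexive (trans (cong (λ z → 2 * (z * k)) (#-all (order G))) (identity (order G) k)))))
    where
    identity : ∀ n k → 2 * (n * k) ≡ 2 * k * n
    identity = solve-∀
  ... | inj₂ (S , D) = inj₂ (maximal-dense (order G) k S (m≤n+m (order G) k) D)

-- Pruning to a bipartite graph of large minimum degree, and its regularity.

module Prune {n : ℕ} (E : Fin n → Fin n → Bool) (r : ℕ) where

  row : (Fin n → Bool) → Fin n → ℕ
  row R a = # (λ b → R b ∧ E a b)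

  column : (Fin n → Bool) → Fin n → ℕ
  column L b = # (λ a → L a ∧ E a b)

  between : (Fin n → Bool) → (Fin n → Bool) → ℕ
  between L R = sum (λ a → ⟦ L a ⟧ * row R a)

  between-sym : ∀ L R → between L R ≡ sum (λ b → ⟦ R b ⟧ * column L b)
  between-sym L R = trans (sum-cong-≗ (λ a → sym (sum-*ˡ ⟦ L a ⟧ (λ b → ⟦ R b ∧ E a b ⟧)))) (trans (∑-comm (λ a b → ⟦ L a ⟧ * ⟦ R b ∧ E a b ⟧))
    (sum-cong-≗ (λ b → trans (sum-cong-≗ (λ a → pointwise (L a) (R b) (E a b))) (sum-*ˡ ⟦ R b ⟧ (λ a → ⟦ L a ∧ E a b ⟧)))))
    where
    pointwise : ∀ l r e → ⟦ l ⟧ * ⟦ r ∧ e ⟧ ≡ ⟦ r ⟧ * ⟦ l ∧ e ⟧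
    pointwise true  true  e = refl
    pointwise true  false e = refl
    pointwise false true  e = refl
    pointwise false false e = refl

  weighted-─ : ∀ (S : Fin n → Bool) v (f : Fin n → ℕ) → S v ≡ true → sum (λ u → ⟦ S u ⟧ * f u) ≡ sum (λ u → ⟦ (S ─ v) u ⟧ * f u) + f v
  weighted-─ S v f Sv = trans (sum-cong-≗ (λ u → trans (cong (_* f u) (⟦⟧-─ S v Sv u)) (*-distribʳ-+ (f u) ⟦ (S ─ v) u ⟧ ⟦ v == u ⟧)))
    (trans (sum-+ (λ u → ⟦ (S ─ v) u ⟧ * f u) (λ u → ⟦ v == u ⟧ * f u)) (cong (sum (λ u → ⟦ (S ─ v) u ⟧ * f u) +_) (sum-single v f)))

  still-many : ∀ {size size′ e e′ w} → r * size < e → w < r → e ≡ e′ + w → size ≡ suc size′ → r * size′ < e′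
  still-many {size′ = size′} {e′ = e′} {w} many w<r refl refl = linear 1 (+-mono-≤ many w<r) (identity r size′ e′ w)
    where
    identity : ∀ r n b w → suc (r * n) + ((b + w) + r) + 1 ≡ b + (suc (r * suc n) + suc w)
    identity = solve-∀

  lowRow lowColumn : (Fin n → Bool) → (Fin n → Bool) → Fin n → Bool
  lowRow    L R a = L a ∧ (suc (row R a) ≤ᵇ r)
  lowColumn L R b = R b ∧ (suc (column L b) ≤ᵇ r)

  -- Deleting a vertex with fewer than `r` edges keeps the number of edges above `r` times the
  -- number of vertices. An edge therefore always remains, and `L` never becomes empty.
  prune : ∀ k L R → # L + # R ≤ k → r * (# L + # R) < between L R →
    ∃ λ L′ → ∃ λ R′ → L′ ⊆ L × R′ ⊆ R × 1 ≤ # L′ ×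
      (∀ a → L′ a ≡ true → r ≤ row R′ a) × (∀ b → R′ b ≡ true → r ≤ column L′ b)
  prune k L R size many with 1 ≤? # (lowRow L R)
  ... | yes low with #-∃ {P = lowRow L R} low
  ...   | a , p = remove k size
    where
    La : L a ≡ true
    La = ∧-elimˡ p
    many′ : r * (# (L ─ a) + # R) < between (L ─ a) R
    many′ = still-many many (≤ᵇ-elim {suc (row R a)} (∧-elimʳ {L a} p)) (weighted-─ L a (row R) La) (cong (_+ # R) (#-─ L a La))
    remove : ∀ k → # L + # R ≤ k → _
    remove zero le = ⊥-elim (<⇒≱ (∃-# {P = L} a La) (≤-trans (m≤m+n _ _) le))
    remove (suc k) le with prune k (L ─ a) R (≤-pred (≤-trans (≤-reflexive (cong (_+ # R) (sym (#-─ L a La)))) le)) many′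
    ... | L′ , R′ , L⊆ , rest = L′ , R′ , (λ x q → ─-⊆ {P = L} (L⊆ x q)) , rest
  prune k L R size many | no none with 1 ≤? # (lowColumn L R)
  ... | yes low with #-∃ {P = lowColumn L R} low
  ...   | b , p = remove k size
    where
    Rb : R b ≡ true
    Rb = ∧-elimˡ p
    many′ : r * (# L + # (R ─ b)) < between L (R ─ b)
    many′ = still-many many (≤ᵇ-elim {suc (column L b)} (∧-elimʳ {R b} p))
      (trans (between-sym L R) (trans (weighted-─ R b (column L) Rb) (cong (_+ column L b) (sym (between-sym L (R ─ b))))))
      (trans (cong (# L +_) (#-─ R b Rb)) (+-suc (# L) _))
    remove : ∀ k → # L + # R ≤ k → _
    remove zero le = ⊥-elim (<⇒≱ (∃-# {P = R} b Rb) (≤-trans (m≤n+m _ _) le))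
    remove (suc k) le with prune k L (R ─ b) (≤-pred (≤-trans (≤-reflexive (trans (sym (+-suc (# L) _)) (cong (# L +_) (sym (#-─ R b Rb))))) le)) many′
    ... | L′ , R′ , L⊆ , R⊆ , rest = L′ , R′ , L⊆ , (λ x q → ─-⊆ {P = R} (R⊆ x q)) , rest
  prune k L R size many | no none | no none′ = L , R , (λ _ q → q) , (λ _ q → q) , nonempty ,
    (λ a La → ≤-pred (≰⇒> (λ le → none (∃-# {P = lowRow L R} a (∧-intro La (≤ᵇ-intro le)))))) ,
    (λ b Rb → ≤-pred (≰⇒> (λ le → none′ (∃-# {P = lowColumn L R} b (∧-intro Rb (≤ᵇ-intro le))))))
    where
    nonempty : 1 ≤ # L
    nonempty with 1 ≤? # L
    ... | yes p = p
    ... | no ¬p = ⊥-elim (<⇒≱ many (≤-trans (sum-⟦⟧*≤ L (row R) n (λ a _ → #≤n _)) (≤-trans (≤-reflexive (cong (_* n) (≱1⇒≡0 ¬p))) z≤n)))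

-- E discards the edges a b for which a sees much of the left neighbourhood, or of the L-neighbourhood, of b.
-- Y a is a neighbourhood of a truncated to size r: L may contain vertices of unbounded degree into R.
record Regular (G : Graph) (left : Fin (order G) → Fin (order G) → Bool) (d q m₀ r : ℕ) : Set where
  field
    L R      : Fin (order G) → Bool
    E Y      : Fin (order G) → Fin (order G) → Bool
    nonempty : 1 ≤ # L
    Y-R      : ∀ {a b} → Y a b ≡ true → R b ≡ true
    Y-E      : ∀ {a b} → Y a b ≡ true → E a b ≡ true
    Y-size   : ∀ a → L a ≡ true → # (Y a) ≡ r
    E-adj    : ∀ {a b} → E a b ≡ true → adj G a b ≡ true
    E-left   : ∀ {a b} → E a b ≡ true → q * # (λ x → left x b ∧ adj G a x) ≤ d
    E-common : ∀ {a b} → E a b ≡ true → q * # (λ x → L x ∧ (adj G b x ∧ adj G a x)) ≤ d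
    R-column : ∀ b → R b ≡ true → r ≤ # (λ a → L a ∧ E a b)
    R-degree : ∀ b → R b ≡ true → # (λ x → L x ∧ adj G b x) ≤ 8 * d
    heavy    : ∀ a → L a ≡ true → # (λ a′ → r ≤ᵇ q * # (λ y → Y a y ∧ adj G a′ y)) ≤ m₀

-- At least three quarters of the `s` vertices are low, and each low vertex keeps more than
-- `2 d / 3` edges. Since `r ≤ d / 4`, the left side is at most
-- `(d / 4) (4 / 3 + 1) l = 7 d l / 12`, against more than `8 d l / 12` edges; hence the factor 12.
enough-edges : ∀ r s l h d m B → l * d ≤ B + l * (m + m) → s ≡ l + h → 4 * h ≤ s → 1 ≤ s → 6 * m < d → 4 * r ≤ d → r * (s + l) < B
enough-edges r s l h d m B edges s≡ 4h≤s 1≤s 6m<d 4r≤d = *-cancelˡ-< 12 (r * (s + l)) B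
  (linear (d * l + 3 * l) (+-mono-≤ rows (+-mono-≤ (*-monoʳ-≤ 4 columns) 1≤l)) (identity r s l d B))
  where
  most-low : 3 * s ≤ 4 * l
  most-low = linear 0 (+-mono-≤ (*-monoʳ-≤ 4 (≤-reflexive s≡)) 4h≤s) (identity₁ s l h)
    where
    identity₁ : ∀ s l h → 3 * s + (4 * (l + h) + s) + 0 ≡ 4 * l + (4 * s + 4 * h)
    identity₁ = solve-∀
  1≤l : 1 ≤ l
  1≤l with 1 ≤? l
  ... | yes p = p
  ... | no ¬p = ⊥-elim (<⇒≱ (≤-trans (*-mono-≤ {1} {3} (s≤s z≤n) 1≤s) most-low) (≤-reflexive (cong (4 *_) (≱1⇒≡0 ¬p))))
  columns : 2 * (l * d) + l ≤ 3 * B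
  columns = linear 0 (+-mono-≤ (*-monoʳ-≤ 3 edges) (*-monoʳ-≤ l 6m<d)) (identity₂ l d m B)
    where
    identity₂ : ∀ l d m b → 2 * (l * d) + l + (3 * (b + l * (m + m)) + l * d) + 0 ≡ 3 * b + (3 * (l * d) + l * suc (6 * m))
    identity₂ = solve-∀
  rows : 12 * (r * (s + l)) ≤ 7 * (d * l)
  rows = linear 0 (+-mono-≤ (*-monoʳ-≤ 3 (*-monoʳ-≤ (s + l) 4r≤d)) (*-monoʳ-≤ d most-low)) (identity₃ r s l d)
    where
    identity₃ : ∀ r s l d → 12 * (r * (s + l)) + (3 * ((s + l) * d) + d * (4 * l)) + 0 ≡ 7 * (d * l) + (3 * ((s + l) * (4 * r)) + d * (3 * s))
    identity₃ = solve-∀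
  identity : ∀ r s l d b → suc (12 * (r * (s + l))) + (7 * (d * l) + (4 * (3 * b) + l)) + (d * l + 3 * l)
    ≡ 12 * b + (12 * (r * (s + l)) + (4 * (2 * (l * d) + l) + 1))
  identity = solve-∀

module Regularise (G : Graph) {d q m₀ r : ℕ} (O : Orientation G (λ _ → true) d) (S : Fin (order G) → Bool) (D : Degeneracy.Dense G d S)
  (1≤q : 1 ≤ q) (qm₀≤d : q * m₀ ≤ d) (6m₀<d : 6 * m₀ < d) (4r≤d : 4 * r ≤ d) (m₀≤r : m₀ ≤ r)
  (sparse : ∀ (X Y : Fin (order G) → Bool) → m₀ ≤ # X → m₀ ≤ # Y → ¬ (∀ x → X x ≡ true → # Y ≤ 8 * q * # (λ y → Y y ∧ adj G x y))) where
  open Degeneracy G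
  open Orientation O

  1≤d : 1 ≤ d
  1≤d = ≤-trans (s≤s z≤n) 6m₀<d

  Low High : V → Bool
  Low  b = S b ∧ (degIn (adj G) S b ≤ᵇ 8 * d)
  High b = S b ∧ not (degIn (adj G) S b ≤ᵇ 8 * d)

  -- Markov's inequality: by the orientation the average degree inside `S` is at most `2 d`.
  few-high : 4 * # High ≤ # S
  few-high = *-cancelˡ-≤ (2 * d) ⦃ >-nonZero (*-mono-≤ {1} {2} (s≤s z≤n) 1≤d) ⦄ (begin
    2 * d * (4 * # High) ≡⟨ identity d (# High) ⟩
    # High * (8 * d) ≤⟨ sum-⟦⟧*≥ High (degIn (adj G) S) (8 * d) (λ b p → <⇒≤ (≤ᵇ-elim-not {degIn (adj G) S b} {8 * d} (∧-elimʳ {S b} p))) ⟩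
    sum (λ b → ⟦ High b ⟧ * degIn (adj G) S b) ≤⟨ sum-mono (λ b → *-monoˡ-≤ (degIn (adj G) S b) (⟦⟧-mono {High b} {S b} ∧-elimˡ)) ⟩
    edges₂ (adj G) S ≤⟨ edges₂-≤ O S ⟩
    2 * (# S * d) ≡⟨ identity′ d (# S) ⟩
    2 * d * # S ∎)
    where
    open ≤-Reasoning
    identity : ∀ d h → 2 * d * (4 * h) ≡ h * (8 * d)
    identity = solve-∀
    identity′ : ∀ d s → 2 * (s * d) ≡ 2 * d * s
    identity′ = solve-∀

  dense-left dense-common E : V → V → Bool
  dense-left   a b = d ≤ᵇ q * # (λ x → left x b ∧ adj G a x)
  dense-common a b = d ≤ᵇ q * # (λ x → S x ∧ (adj G b x ∧ adj G a x))
  E a b = adj G a b ∧ (not (dense-left a b) ∧ not (dense-common a b))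

  -- Too many such vertices would form with `P` a pair of density `1 / (8 q)`, which is where the 8
  -- in `sparse` comes from. `P` itself is large enough, since a single such vertex already sees
  -- `d / q`, hence `m₀`, of its elements.
  few-dense : ∀ (P : V → Bool) → # P ≤ 8 * d → # (λ a → d ≤ᵇ q * # (λ x → P x ∧ adj G a x)) ≤ m₀
  few-dense P P≤ with m₀ ≤? # (λ a → d ≤ᵇ q * # (λ x → P x ∧ adj G a x))
  ... | no ¬p = <⇒≤ (≰⇒> ¬p)
  ... | yes p with 1 ≤? # (λ a → d ≤ᵇ q * # (λ x → P x ∧ adj G a x))
  ...   | no ¬p′ = ≤-trans (≤-pred (≰⇒> ¬p′)) z≤n
  ...   | yes p′ with #-∃ {P = λ a → d ≤ᵇ q * # (λ x → P x ∧ adj G a x)} p′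
  ...     | a , da = ⊥-elim (sparse _ P p
              (*-cancelˡ-≤ q ⦃ >-nonZero 1≤q ⦄ (≤-trans qm₀≤d (≤-trans (≤ᵇ-elim {d} {q * # (λ x → P x ∧ adj G a x)} da) (*-monoʳ-≤ q (#-mono {P = λ x → P x ∧ adj G a x} {P} (λ x → ∧-elimˡ))))))
              (λ x dx → ≤-trans P≤ (≤-trans (*-monoʳ-≤ 8 (≤ᵇ-elim {d} {q * # (λ y → P y ∧ adj G x y)} dx)) (≤-reflexive (sym (*-assoc 8 q (# (λ y → P y ∧ adj G x y))))))))

  column-bound : ∀ b → Low b ≡ true → d ≤ # (λ a → S a ∧ E a b) + (m₀ + m₀)
  column-bound b p = begin
    d ≤⟨ proj₂ D b (∧-elimˡ p) ⟩
    # (λ a → S a ∧ adj G b a) ≤⟨ #-cover {P = λ a → S a ∧ adj G b a} {λ a → S a ∧ E a b} {λ a → dense-left a b ∨ dense-common a b} cover ⟩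
    # (λ a → S a ∧ E a b) + # (λ a → dense-left a b ∨ dense-common a b)
      ≤⟨ +-monoʳ-≤ (# (λ a → S a ∧ E a b)) (≤-trans (#-cover {P = λ a → dense-left a b ∨ dense-common a b} {λ a → dense-left a b} {λ a → dense-common a b} (λ a → ∨-elim))
           (+-mono-≤ (few-dense (λ x → left x b) (≤-trans (left-≤ b) (m≤n*m d 8)))
             (≤-trans (#-mono {P = λ a → dense-common a b} {λ a → d ≤ᵇ q * # (λ x → (S x ∧ adj G b x) ∧ adj G a x)}
               (λ a e → ≤ᵇ-intro (≤-trans (≤ᵇ-elim {d} {q * # (λ x → S x ∧ (adj G b x ∧ adj G a x))} e) (*-monoʳ-≤ q (#-mono {P = λ x → S x ∧ (adj G b x ∧ adj G a x)} {λ x → (S x ∧ adj G b x) ∧ adj G a x}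
                  (λ x e → ∧-intro (∧-intro (∧-elimˡ {S x} e) (∧-elimˡ {adj G b x} (∧-elimʳ {S x} e))) (∧-elimʳ {adj G b x} (∧-elimʳ {S x} e))))))))
               (few-dense (λ x → S x ∧ adj G b x) (≤ᵇ-elim {degIn (adj G) S b} {8 * d} (∧-elimʳ {S b} p)))))) ⟩
    # (λ a → S a ∧ E a b) + (m₀ + m₀) ∎
    where
    open ≤-Reasoning
    cover : ∀ a → S a ∧ adj G b a ≡ true → (S a ∧ E a b ≡ true) ⊎ (dense-left a b ∨ dense-common a b ≡ true)
    cover a e with ≡true⊎≡false (dense-left a b) | ≡true⊎≡false (dense-common a b)
    ... | inj₁ l | _ = inj₂ (∨-introˡ l)
    ... | inj₂ _ | inj₁ c = inj₂ (∨-introʳ {dense-left a b} c)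
    ... | inj₂ l | inj₂ c = inj₁ (∧-intro (∧-elimˡ {S a} e) (∧-intro (trans (adj-sym G a b) (∧-elimʳ {S a} e)) (∧-intro (not-intro l) (not-intro c))))

  open Prune E r

  edges : # Low * d ≤ between S Low + # Low * (m₀ + m₀)
  edges = begin
    # Low * d ≤⟨ sum-⟦⟧*≥ Low (λ b → column S b + (m₀ + m₀)) d column-bound ⟩
    sum (λ b → ⟦ Low b ⟧ * (column S b + (m₀ + m₀))) ≡⟨ sum-cong-≗ (λ b → *-distribˡ-+ ⟦ Low b ⟧ (column S b) (m₀ + m₀)) ⟩
    sum (λ b → ⟦ Low b ⟧ * column S b + ⟦ Low b ⟧ * (m₀ + m₀)) ≡⟨ sum-+ (λ b → ⟦ Low b ⟧ * column S b) (λ b → ⟦ Low b ⟧ * (m₀ + m₀)) ⟩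
    sum (λ b → ⟦ Low b ⟧ * column S b) + sum (λ b → ⟦ Low b ⟧ * (m₀ + m₀)) ≡⟨ cong₂ _+_ (sym (between-sym S Low)) (sum-*ʳ (m₀ + m₀) (λ b → ⟦ Low b ⟧)) ⟩
    between S Low + # Low * (m₀ + m₀) ∎
    where open ≤-Reasoning

  many : r * (# S + # Low) < between S Low
  many = enough-edges r (# S) (# Low) (# High) d m₀ (between S Low) edges (#-split S (λ b → degIn (adj G) S b ≤ᵇ 8 * d)) few-high (proj₁ D) 6m₀<d 4r≤d

  Pruned : (V → Bool) → (V → Bool) → Set
  Pruned L R = L ⊆ S × R ⊆ Low × 1 ≤ # L ×
    (∀ a → L a ≡ true → r ≤ row R a) × (∀ b → R b ≡ true → r ≤ column L b)

  regular-of : ∀ L R → Pruned L R → Regular G left d q m₀ r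
  regular-of L R (L⊆S , R⊆Low , nonempty , rows , columns) = record
    { L = L ; R = R ; E = E ; Y = Y ; nonempty = nonempty
    ; Y-R = λ {a} {b} y → ∧-elimˡ {R b} (proj₁ (proj₂ (truncate a)) b y)
    ; Y-E = λ {a} {b} y → ∧-elimʳ {R b} (proj₁ (proj₂ (truncate a)) b y)
    ; Y-size = Y-size
    ; E-adj = λ {a} {b} → ∧-elimˡ {adj G a b}
    ; E-left = λ {a} {b} e → <⇒≤ (≤ᵇ-elim-not {d} {q * # (λ x → left x b ∧ adj G a x)} (∧-elimˡ {not (dense-left a b)} (∧-elimʳ {adj G a b} e)))
    ; E-common = λ {a} {b} e → ≤-trans (*-monoʳ-≤ q (#-mono {P = λ x → L x ∧ (adj G b x ∧ adj G a x)} {λ x → S x ∧ (adj G b x ∧ adj G a x)}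
        (λ x p → ∧-intro (L⊆S x (∧-elimˡ {L x} p)) (∧-elimʳ {L x} p)))) (<⇒≤ (≤ᵇ-elim-not {d} {q * # (λ x → S x ∧ (adj G b x ∧ adj G a x))} (∧-elimʳ {not (dense-left a b)} (∧-elimʳ {adj G a b} e))))
    ; R-column = columns
    ; R-degree = λ b Rb → ≤-trans (#-mono {P = λ x → L x ∧ adj G b x} {λ x → S x ∧ adj G b x} (λ x p → ∧-intro (L⊆S x (∧-elimˡ {L x} p)) (∧-elimʳ {L x} p)))
        (≤ᵇ-elim {degIn (adj G) S b} {8 * d} (∧-elimʳ {S b} (R⊆Low b Rb)))
    ; heavy = heavy′
    }
    where
    truncate : ∀ a → Σ (V → Bool) λ Q → (∀ b → Q b ≡ true → R b ∧ E a b ≡ true) × (L a ≡ true → # Q ≡ r)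
    -- Outside `L` the empty set is a default value.
    truncate a with ≡true⊎≡false (L a)
    ... | inj₂ e = (λ _ → false) , (λ _ ()) , λ p → true≢false p e
    ... | inj₁ e with subset-of-size r (λ b → R b ∧ E a b) (rows a e)
    ...   | Q , Q⊆ , #Q = Q , Q⊆ , λ _ → #Q
    Y : V → V → Bool
    Y a = proj₁ (truncate a)
    Y-size : ∀ a → L a ≡ true → # (Y a) ≡ r
    Y-size a = proj₂ (proj₂ (truncate a))
    heavy′ : ∀ a → L a ≡ true → # (λ a′ → r ≤ᵇ q * # (λ y → Y a y ∧ adj G a′ y)) ≤ m₀
    heavy′ a La with m₀ ≤? # (λ a′ → r ≤ᵇ q * # (λ y → Y a y ∧ adj G a′ y))
    ... | no ¬p = <⇒≤ (≰⇒> ¬p)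
    ... | yes p = ⊥-elim (sparse _ (Y a) p (≤-trans m₀≤r (≤-reflexive (sym (Y-size a La))))
            (λ x h → ≤-trans (≤-reflexive (Y-size a La)) (≤-trans (≤ᵇ-elim {r} {q * # (λ y → Y a y ∧ adj G x y)} h) (*-monoˡ-≤ (# (λ y → Y a y ∧ adj G x y)) (m≤n*m q 8)))))

  regular : Regular G left d q m₀ r
  regular = let L , R , pruned = prune (# S + # Low) S Low ≤-refl many in regular-of L R pruned

-- Two independent random samples.

-- Independence is expressed by invariance of `f` under overwriting the entry `x`; that entry is
-- true with probability `1 / (1 + k)`.
𝔼-lookup : ∀ k {n} (x : Fin n) (f : Vec Bool n → ℕ) → (∀ α b → f (α [ x ]≔ b) ≡ f α) → suc k * 𝔼 k (λ α → ⟦ lookup α x ⟧ * f α) ≡ 𝔼 k f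
𝔼-lookup k {suc n} zero f indep = begin
  suc k * (𝔼 k (λ α → 1 * f (true ∷ α)) + k * 𝔼 k {n} (λ α → 0))
    ≡⟨ cong (suc k *_) (cong₂ (λ u v → u + k * v) (𝔼-cong k (λ α → *-identityˡ (f (true ∷ α)))) (trans (𝔼-const k n 0) (*-zeroʳ (suc k ^ n)))) ⟩
  suc k * (𝔼 k (λ α → f (true ∷ α)) + k * 0) ≡⟨ identity k (𝔼 k (λ α → f (true ∷ α))) ⟩
  𝔼 k (λ α → f (true ∷ α)) + k * 𝔼 k (λ α → f (true ∷ α)) ≡⟨ cong (λ z → 𝔼 k (λ α → f (true ∷ α)) + k * z) (𝔼-cong k (λ α → sym (indep (true ∷ α) false))) ⟩
  𝔼 k (λ α → f (true ∷ α)) + k * 𝔼 k (λ α → f (false ∷ α)) ∎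
  where
  open ≡-Reasoning
  identity : ∀ k x → suc k * (x + k * 0) ≡ x + k * x
  identity = solve-∀
𝔼-lookup k {suc n} (suc x) f indep = trans (identity k (𝔼 k (λ α → ⟦ lookup α x ⟧ * f (true ∷ α))) (𝔼 k (λ α → ⟦ lookup α x ⟧ * f (false ∷ α))))
  (cong₂ (λ u v → u + k * v) (𝔼-lookup k x (λ α → f (true ∷ α)) (λ α b → indep (true ∷ α) b)) (𝔼-lookup k x (λ α → f (false ∷ α)) (λ α b → indep (false ∷ α) b)))
  where
  identity : ∀ k a b → suc k * (a + k * b) ≡ suc k * a + k * (suc k * b)
  identity = solve-∀

ind : ∀ {n} → List (Fin n) → Vec Bool n → ℕ
ind []       α = 1
ind (x ∷ xs) α = ⟦ lookup α x ⟧ * ind xs α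

ind-update : ∀ {n} {x : Fin n} {xs} → All (x ≢_) xs → ∀ α b → ind xs (α [ x ]≔ b) ≡ ind xs α
ind-update []         α b = refl
ind-update (x≢y ∷ ps) α b = cong₂ _*_ (cong ⟦_⟧ (lookup∘update′ (λ e → x≢y (sym e)) α b)) (ind-update ps α b)

module TwoSamples (n k l : ℕ) where

  Sample : Set
  Sample = Vec Bool n

  𝔼₂ : (Sample → Sample → ℕ) → ℕ
  𝔼₂ f = 𝔼 k (λ α → 𝔼 l (f α))

  𝔼₂-mono : ∀ {f g} → (∀ α β → f α β ≤ g α β) → 𝔼₂ f ≤ 𝔼₂ g
  𝔼₂-mono p = 𝔼-mono k (λ α → 𝔼-mono l (p α))

  𝔼₂-cong : ∀ {f g} → (∀ α β → f α β ≡ g α β) → 𝔼₂ f ≡ 𝔼₂ g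
  𝔼₂-cong p = 𝔼-cong k (λ α → 𝔼-cong l (p α))

  𝔼₂-+ : ∀ f g → 𝔼₂ (λ α β → f α β + g α β) ≡ 𝔼₂ f + 𝔼₂ g
  𝔼₂-+ f g = trans (𝔼-cong k (λ α → 𝔼-+ l (f α) (g α))) (𝔼-+ k (λ α → 𝔼 l (f α)) (λ α → 𝔼 l (g α)))

  𝔼₂-* : ∀ c f → 𝔼₂ (λ α β → c * f α β) ≡ c * 𝔼₂ f
  𝔼₂-* c f = trans (𝔼-cong k (λ α → 𝔼-* l c (f α))) (𝔼-* k c (λ α → 𝔼 l (f α)))

  𝔼₂-sum : ∀ {m} (f : Fin m → Sample → Sample → ℕ) → 𝔼₂ (λ α β → sum (λ i → f i α β)) ≡ sum (λ i → 𝔼₂ (f i))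
  𝔼₂-sum f = trans (𝔼-cong k (λ α → 𝔼-sum l (λ i → f i α))) (𝔼-sum k (λ i α → 𝔼 l (f i α)))

  𝔼₂-< : ∀ {f g} → 𝔼₂ f < 𝔼₂ g → ∃ λ α → ∃ λ β → f α β < g α β
  𝔼₂-< p = let α , q = 𝔼-< k p in α , 𝔼-< l q

  𝔼₂-lookupˡ : ∀ x f → (∀ α b β → f (α [ x ]≔ b) β ≡ f α β) → suc k * 𝔼₂ (λ α β → ⟦ lookup α x ⟧ * f α β) ≡ 𝔼₂ f
  𝔼₂-lookupˡ x f indep = trans (cong (suc k *_) (𝔼-cong k (λ α → 𝔼-* l ⟦ lookup α x ⟧ (f α))))
    (𝔼-lookup k x (λ α → 𝔼 l (f α)) (λ α b → 𝔼-cong l (indep α b)))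

  𝔼₂-lookupʳ : ∀ x f → (∀ α β b → f α (β [ x ]≔ b) ≡ f α β) → suc l * 𝔼₂ (λ α β → ⟦ lookup β x ⟧ * f α β) ≡ 𝔼₂ f
  𝔼₂-lookupʳ x f indep = trans (sym (𝔼-* k (suc l) (λ α → 𝔼 l (λ β → ⟦ lookup β x ⟧ * f α β)))) (𝔼-cong k (λ α → 𝔼-lookup l x (f α) (indep α)))

  𝔼₂-sum-≤ : ∀ {m} K (f : Fin m → Sample → Sample → ℕ) (g : Fin m → ℕ) → (∀ i → K * 𝔼₂ (f i) ≤ g i) → K * 𝔼₂ (λ α β → sum (λ i → f i α β)) ≤ sum g
  𝔼₂-sum-≤ K f g p = ≤-trans (≤-reflexive (trans (cong (K *_) (𝔼₂-sum f)) (sym (sum-*ˡ K (λ i → 𝔼₂ (f i)))))) (sum-mono p)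

  𝔼₂-⟦⟧-≤ : ∀ c K f e → (c ≡ true → K * 𝔼₂ f ≤ e) → K * 𝔼₂ (λ α β → ⟦ c ⟧ * f α β) ≤ ⟦ c ⟧ * e
  𝔼₂-⟦⟧-≤ c K f e p = ≤-trans (≤-reflexive (trans (cong (K *_) (𝔼₂-* ⟦ c ⟧ f)) (*-swap K ⟦ c ⟧ (𝔼₂ f)))) (⟦⟧*-mono c p)

  𝔼₂-one : 1 ≤ 𝔼₂ (λ _ _ → 1)
  𝔼₂-one = ≤-trans (*-mono-≤ (one k) (*-mono-≤ (one l) ≤-refl)) (≤-reflexive (sym (trans constant (𝔼-const k n (suc l ^ n * 1)))))
    where
    constant : 𝔼 k {n} (λ _ → 𝔼 l {n} (λ _ → 1)) ≡ 𝔼 k {n} (λ _ → suc l ^ n * 1)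
    constant = 𝔼-cong k {n} (λ _ → 𝔼-const l n 1)
    one : ∀ k → 1 ≤ suc k ^ n
    one k = m^n>0 (suc k) n

-- Surviving triples in a random sample.

-- The sampling rates are `1 / suc k` on `L` and `1 / suc l` on `R`. `h₁`, `h₂` and `h₃` keep each
-- of the three penalties below an eighth of the expectation, `h₄` keeps half of the choices of
-- `a′`, and `h₅` makes the survivors outnumber `κ` times the sample from `L`.
module Sampling (G : Graph) {d q m₀ r : ℕ} (O : Orientation G (λ _ → true) d) (Reg : Regular G (Orientation.left O) d q m₀ r)
  (k l κ : ℕ) (1≤d : 1 ≤ d) (1≤q : 1 ≤ q)
  (h₁ : 88 * d ≤ suc k) (h₂ : 512 * (d * (d * d)) ≤ suc k * (suc k * suc l)) (h₃ : 8 * (2 * d + r) ≤ q * suc l)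
  (h₄ : 2 * (d + q * m₀) ≤ q * r) (h₅ : 4 * κ * (suc k * suc l) < r * r) where
  open Orientation O
  open Regular Reg
  open TwoSamples (order G) k l

  V : Set
  V = Fin (order G)

  heavyFor : V → V → Bool
  heavyFor a a′ = r ≤ᵇ q * # (λ y → Y a y ∧ adj G a′ y)

  -- The roles of the two ends differ. `b` is taken from the truncated neighbourhood of `a`, of
  -- which the light vertex `a′` sees at most a `1 / q` fraction, whereas `a′` ranges over the full
  -- column of `b`.
  record Triple (a b a′ : V) : Set where
    field
      La     : L a ≡ true
      La′    : L a′ ≡ true
      Yab    : Y a b ≡ true
      Ea′b   : E a′ b ≡ true
      apart  : adj G a a′ ≡ false
      light  : heavyFor a a′ ≡ false

    ab : adj G a b ≡ true
    ab = E-adj (Y-E Yab)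

    a′b : adj G a′ b ≡ true
    a′b = E-adj Ea′b

    a≢a′ : a ≢ a′
    -- `a` sees all of `Y a`, so it is heavy for itself.
    a≢a′ refl = true≢false (≤ᵇ-intro (≤-trans (≤-reflexive (sym (Y-size a La))) (≤-trans (#-mono {P = Y a} {λ y → Y a y ∧ adj G a y} (λ y p → ∧-intro p (E-adj (Y-E p))))
      (m≤n*m _ q ⦃ >-nonZero 1≤q ⦄)))) light

  triple : V → V → V → Bool
  triple a b a′ = (L a ∧ Y a b) ∧ ((L a′ ∧ E a′ b) ∧ (not (adj G a a′) ∧ not (heavyFor a a′)))

  triple-elim : ∀ {a b a′} → triple a b a′ ≡ true → Triple a b a′
  triple-elim {a} {b} {a′} p = record
    { La = ∧-elimˡ (∧-elimˡ p) ; Yab = ∧-elimʳ {L a} (∧-elimˡ p) ; La′ = ∧-elimˡ (∧-elimˡ p₂) ; Ea′b = ∧-elimʳ {L a′} (∧-elimˡ p₂)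
    ; apart = not-elim (∧-elimˡ (∧-elimʳ {L a′ ∧ E a′ b} p₂)) ; light = not-elim (∧-elimʳ {not (adj G a a′)} (∧-elimʳ {L a′ ∧ E a′ b} p₂)) }
    where
    p₂ = ∧-elimʳ {L a ∧ Y a b} p

  #triples : ℕ
  #triples = sum (λ a → sum (λ b → # (triple a b)))

  -- Each `a` has exactly `r` choices of `b`. The column of `b` has at least `r` elements, of which
  -- the neighbours of `a` and the heavy vertices take at most half by `h₄`.
  many-triples : # L * (r * r) ≤ 2 * #triples
  many-triples = begin
    # L * (r * r) ≤⟨ sum-⟦⟧*≥ L (λ a → 2 * sum (λ b → # (triple a b))) (r * r) from-a ⟩
    sum (λ a → ⟦ L a ⟧ * (2 * sum (λ b → # (triple a b)))) ≤⟨ sum-mono (λ a → ⟦⟧*≤ (L a) _) ⟩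
    sum (λ a → 2 * sum (λ b → # (triple a b))) ≡⟨ sum-*ˡ 2 (λ a → sum (λ b → # (triple a b))) ⟩
    2 * #triples ∎
    where
    open ≤-Reasoning
    from-ab : ∀ a → L a ≡ true → ∀ b → Y a b ≡ true → r ≤ 2 * # (triple a b)
    from-ab a La b Yab = *-cancelˡ-≤ q ⦃ >-nonZero 1≤q ⦄ (linear 0 (+-mono-≤ (*-monoʳ-≤ (2 * q) cover) (+-mono-≤ (*-monoʳ-≤ 2 (E-common (Y-E Yab))) (+-mono-≤ (*-monoʳ-≤ (2 * q) (heavy a La)) h₄)))
        (identity q r (# (triple a b)) common (# (heavyFor a)) d m₀))
      where
      common : ℕ
      common = # (λ x → L x ∧ (adj G b x ∧ adj G a x))
      cover : r ≤ # (triple a b) + (common + # (heavyFor a))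
      cover = ≤-trans (R-column b (Y-R Yab)) (≤-trans (#-cover {P = λ a′ → L a′ ∧ E a′ b} {triple a b} {λ x → (L x ∧ (adj G b x ∧ adj G a x)) ∨ heavyFor a x} cases)
        (+-monoʳ-≤ (# (triple a b)) (#-cover {P = λ x → (L x ∧ (adj G b x ∧ adj G a x)) ∨ heavyFor a x} {λ x → L x ∧ (adj G b x ∧ adj G a x)} {heavyFor a} (λ x → ∨-elim))))
        where
        cases : ∀ a′ → L a′ ∧ E a′ b ≡ true → (triple a b a′ ≡ true) ⊎ ((L a′ ∧ (adj G b a′ ∧ adj G a a′)) ∨ heavyFor a a′ ≡ true)
        cases a′ p with ≡true⊎≡false (adj G a a′) | ≡true⊎≡false (heavyFor a a′)
        ... | inj₁ e | _ = inj₂ (∨-introˡ (∧-intro (∧-elimˡ {L a′} p) (∧-intro (trans (adj-sym G b a′) (E-adj (∧-elimʳ {L a′} p))) e)))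
        ... | inj₂ _ | inj₁ e = inj₂ (∨-introʳ {L a′ ∧ (adj G b a′ ∧ adj G a a′)} e)
        ... | inj₂ e | inj₂ e′ = inj₁ (∧-intro (∧-intro La Yab) (∧-intro p (∧-intro (not-intro e) (not-intro e′))))
      identity : ∀ q r t c h d m → q * r + (2 * q * (t + (c + h)) + (2 * d + (2 * q * m + q * r))) + 0 ≡ q * (2 * t) + (2 * q * r + (2 * (q * c) + (2 * q * h + 2 * (d + q * m))))
      identity = solve-∀
    from-a : ∀ a → L a ≡ true → r * r ≤ 2 * sum (λ b → # (triple a b))
    from-a a La = begin
      r * r ≡⟨ cong (_* r) (Y-size a La) ⟨
      # (Y a) * r ≤⟨ sum-⟦⟧*≥ (Y a) (λ b → 2 * # (triple a b)) r (from-ab a La) ⟩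
      sum (λ b → ⟦ Y a b ⟧ * (2 * # (triple a b))) ≤⟨ sum-mono (λ b → ⟦⟧*≤ (Y a b) _) ⟩
      sum (λ b → 2 * # (triple a b)) ≡⟨ sum-*ˡ 2 (λ b → # (triple a b)) ⟩
      2 * sum (λ b → # (triple a b)) ∎

  base : V → V → V → Sample → Sample → ℕ
  base a b a′ α β = ind (a ∷ a′ ∷ []) α * ind (b ∷ []) β

  -- α samples end vertices from L and β samples subdivision vertices from R.  A sampled triple (a , b , a′) survives
  -- unless α contains a spoilt x, or β contains a rival b₁: a second common neighbour of a and a′ in Y a, or a left
  -- neighbour of b that is adjacent to a, to a′, or to two further vertices x, x′ of α.  Deleting only rivals on the left
  -- suffices for independence, and there are at most d of them although the degree of b in R is not bounded by that.
  spoilt : V → V → V → V → Bool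
  spoilt a b a′ x = L x ∧ ((b == x) ∨ ((adj G b x ∧ (not (a == x) ∧ not (a′ == x))) ∨ (left x a ∨ left x a′)))

  earlier near : V → V → Bool
  earlier b b₁ = left b₁ b ∧ R b₁
  near b₁ x = L x ∧ adj G b₁ x

  rival₃ : V → V → V → V → V → V → Bool
  rival₃ a b a′ b₁ x x′ = earlier b b₁ ∧ (near b₁ x ∧ (near b₁ x′ ∧ (not (x == x′) ∧ ((not (a == x) ∧ not (a′ == x)) ∧ (not (a == x′) ∧ not (a′ == x′))))))

  rival₁ : V → V → V → V → Bool
  rival₁ a b a′ b₁ = (left b₁ b ∧ (adj G a b₁ ∨ adj G a′ b₁)) ∨ ((Y a b₁ ∧ adj G a′ b₁) ∧ not (b == b₁))

  term₂ : V → V → V → Sample → Sample → V → V → V → ℕ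
  term₂ a b a′ α β b₁ x x′ = ⟦ rival₃ a b a′ b₁ x x′ ⟧ * (⟦ lookup β b₁ ⟧ * (⟦ lookup α x ⟧ * (⟦ lookup α x′ ⟧ * base a b a′ α β)))

  penalty₁ penalty₂ penalty₃ penalty : V → V → V → Sample → Sample → ℕ
  penalty₁ a b a′ α β = sum (λ x → ⟦ spoilt a b a′ x ⟧ * (⟦ lookup α x ⟧ * base a b a′ α β))
  penalty₂ a b a′ α β = sum (λ b₁ → sum (λ x → sum (term₂ a b a′ α β b₁ x)))
  penalty₃ a b a′ α β = sum (λ b₁ → ⟦ rival₁ a b a′ b₁ ⟧ * (⟦ lookup β b₁ ⟧ * base a b a′ α β))
  penalty  a b a′ α β = penalty₁ a b a′ α β + (penalty₂ a b a′ α β + penalty₃ a b a′ α β)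

  module _ {a b a′ : V} (τ : Triple a b a′) where
    open Triple τ

    expected : ℕ
    expected = 𝔼₂ (base a b a′)

    adj⇒≢ : ∀ {u v} → adj G u v ≡ true → u ≢ v
    adj⇒≢ {u} p refl = true≢false p (adj-irrefl G u)

    base-updateˡ : ∀ {x} → x ≢ a → x ≢ a′ → ∀ α c β → base a b a′ (α [ x ]≔ c) β ≡ base a b a′ α β
    base-updateˡ p p′ α c β = cong (_* ind (b ∷ []) β) (ind-update (p ∷ p′ ∷ []) α c)

    base-updateʳ : ∀ {x} → x ≢ b → ∀ α β c → base a b a′ α (β [ x ]≔ c) ≡ base a b a′ α β
    base-updateʳ p α β c = cong (ind (a ∷ a′ ∷ []) α *_) (ind-update (p ∷ []) β c)

    -- Sampling `x` is independent of sampling the triple only if `x` is neither end. That one end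
    -- is not a left neighbour of the other is where their nonadjacency is used.
    spoilt-≢ : ∀ x → spoilt a b a′ x ≡ true → x ≢ a × x ≢ a′
    spoilt-≢ x p with ∨-elim {b == x} (∧-elimʳ {L x} p)
    ... | inj₁ e with ==⇒≡ {i = b} e
    ...   | refl = (λ { refl → adj⇒≢ ab refl }) , λ { refl → adj⇒≢ a′b refl }
    spoilt-≢ x p | inj₂ p′ with ∨-elim {adj G b x ∧ (not (a == x) ∧ not (a′ == x))} p′
    ... | inj₁ e = (λ e′ → ==-not⇒≢ (∧-elimˡ (∧-elimʳ {adj G b x} e)) (sym e′)) , λ e′ → ==-not⇒≢ (∧-elimʳ {not (a == x)} (∧-elimʳ {adj G b x} e)) (sym e′)
    ... | inj₂ e with ∨-elim {left x a} e
    ...   | inj₁ l′ = (λ e′ → adj⇒≢ (left-adj l′) e′) , λ { refl → true≢false (left-adj l′) (trans (adj-sym G a′ a) apart) }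
    ...   | inj₂ l′ = (λ { refl → true≢false (left-adj l′) apart }) , λ e′ → adj⇒≢ (left-adj l′) e′

    #spoilt : # (spoilt a b a′) ≤ 1 + (8 * d + (d + d))
    #spoilt = ≤-trans (#-cover {P = spoilt a b a′} {b ==_} {λ x → (L x ∧ adj G b x) ∨ (left x a ∨ left x a′)} cover)
      (+-mono-≤ (≤-reflexive (#-single b)) (≤-trans (#-cover {P = λ x → (L x ∧ adj G b x) ∨ (left x a ∨ left x a′)} {λ x → L x ∧ adj G b x} {λ x → left x a ∨ left x a′} (λ x → ∨-elim))
        (+-mono-≤ (R-degree b (Y-R Yab)) (≤-trans (#-cover {P = λ x → left x a ∨ left x a′} {λ x → left x a} {λ x → left x a′} (λ x → ∨-elim)) (+-mono-≤ (left-≤ a) (left-≤ a′))))))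
      where
      cover : ∀ x → spoilt a b a′ x ≡ true → ((b == x) ≡ true) ⊎ ((L x ∧ adj G b x) ∨ (left x a ∨ left x a′) ≡ true)
      cover x p with ∨-elim {b == x} (∧-elimʳ {L x} p)
      ... | inj₁ e = inj₁ e
      ... | inj₂ p′ with ∨-elim {adj G b x ∧ (not (a == x) ∧ not (a′ == x))} p′
      ...   | inj₁ e = inj₂ (∨-introˡ (∧-intro (∧-elimˡ {L x} p) (∧-elimˡ {adj G b x} e)))
      ...   | inj₂ e = inj₂ (∨-introʳ {L x ∧ adj G b x} e)

    -- There are at most `10 d + 1`, hence `11 d`, spoiling vertices, and 88 is 8 times 11.
    penalty₁-≤ : 8 * 𝔼₂ (penalty₁ a b a′) ≤ expected
    penalty₁-≤ = *-cancelˡ-≤ (suc k) (begin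
      suc k * (8 * 𝔼₂ (penalty₁ a b a′)) ≡⟨ *-swap (suc k) 8 (𝔼₂ (penalty₁ a b a′)) ⟩
      8 * (suc k * 𝔼₂ (penalty₁ a b a′)) ≤⟨ *-monoʳ-≤ 8 (𝔼₂-sum-≤ (suc k) _ (λ x → ⟦ spoilt a b a′ x ⟧ * expected)
        (λ x → 𝔼₂-⟦⟧-≤ (spoilt a b a′ x) (suc k) _ expected (λ p → ≤-reflexive (𝔼₂-lookupˡ x (base a b a′) (base-updateˡ (proj₁ (spoilt-≢ x p)) (proj₂ (spoilt-≢ x p))))))) ⟩
      8 * sum (λ x → ⟦ spoilt a b a′ x ⟧ * expected) ≡⟨ cong (8 *_) (sum-*ʳ expected (λ x → ⟦ spoilt a b a′ x ⟧)) ⟩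
      8 * (# (spoilt a b a′) * expected) ≡⟨ *-assoc 8 (# (spoilt a b a′)) expected ⟨
      8 * # (spoilt a b a′) * expected ≤⟨ *-monoˡ-≤ expected (≤-trans (*-monoʳ-≤ 8 #spoilt) (≤-trans (linear 0 (*-monoʳ-≤ 8 1≤d) (identity d)) h₁)) ⟩
      suc k * expected ∎)
      where
      open ≤-Reasoning
      identity : ∀ d → 8 * (1 + (8 * d + (d + d))) + 8 * d + 0 ≡ 88 * d + 8 * 1
      identity = solve-∀

    rival₁-≢ : ∀ b₁ → rival₁ a b a′ b₁ ≡ true → b₁ ≢ b
    rival₁-≢ b₁ p with ∨-elim {left b₁ b ∧ (adj G a b₁ ∨ adj G a′ b₁)} p
    ... | inj₁ e = adj⇒≢ (left-adj (∧-elimˡ e))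
    ... | inj₂ e = λ e′ → ==-not⇒≢ (∧-elimʳ {Y a b₁ ∧ adj G a′ b₁} e) (sym e′)

    #rival₁ : q * # (rival₁ a b a′) ≤ 2 * d + r
    #rival₁ = begin
      q * # (rival₁ a b a′) ≤⟨ *-monoʳ-≤ q (≤-trans (#-cover {P = rival₁ a b a′} {λ x → left x b ∧ adj G a x} {λ x → (left x b ∧ adj G a′ x) ∨ (Y a x ∧ adj G a′ x)} cover)
        (+-monoʳ-≤ _ (#-cover {P = λ x → (left x b ∧ adj G a′ x) ∨ (Y a x ∧ adj G a′ x)} {λ x → left x b ∧ adj G a′ x} {λ x → Y a x ∧ adj G a′ x} (λ x → ∨-elim)))) ⟩
      q * (u + (v + w)) ≡⟨ identity q u v w ⟩
      q * u + q * v + q * w ≤⟨ +-mono-≤ (+-mono-≤ (E-left (Y-E Yab)) (E-left Ea′b)) (<⇒≤ (≤ᵇ-false light)) ⟩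
      d + d + r ≡⟨ cong (λ z → d + z + r) (sym (+-identityʳ d)) ⟩
      2 * d + r ∎
      where
      open ≤-Reasoning
      u v w : ℕ
      u = # (λ x → left x b ∧ adj G a x)
      v = # (λ x → left x b ∧ adj G a′ x)
      w = # (λ x → Y a x ∧ adj G a′ x)
      identity : ∀ q u v w → q * (u + (v + w)) ≡ q * u + q * v + q * w
      identity = solve-∀
      cover : ∀ x → rival₁ a b a′ x ≡ true → (left x b ∧ adj G a x ≡ true) ⊎ ((left x b ∧ adj G a′ x) ∨ (Y a x ∧ adj G a′ x) ≡ true)
      cover x p with ∨-elim {left x b ∧ (adj G a x ∨ adj G a′ x)} p
      ... | inj₂ e = inj₂ (∨-introʳ {left x b ∧ adj G a′ x} (∧-elimˡ e))
      ... | inj₁ e with ∨-elim {adj G a x} (∧-elimʳ {left x b} e)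
      ...   | inj₁ e′ = inj₁ (∧-intro (∧-elimˡ {left x b} e) e′)
      ...   | inj₂ e′ = inj₂ (∨-introˡ (∧-intro (∧-elimˡ {left x b} e) e′))

    penalty₃-≤ : 8 * 𝔼₂ (penalty₃ a b a′) ≤ expected
    penalty₃-≤ = *-cancelˡ-≤ (q * suc l) ⦃ >-nonZero (*-mono-≤ {1} {q} 1≤q (s≤s z≤n)) ⦄ (begin
      q * suc l * (8 * 𝔼₂ (penalty₃ a b a′)) ≡⟨ swap q (suc l) (𝔼₂ (penalty₃ a b a′)) ⟩
      8 * q * (suc l * 𝔼₂ (penalty₃ a b a′)) ≤⟨ *-monoʳ-≤ (8 * q) (𝔼₂-sum-≤ (suc l) _ (λ x → ⟦ rival₁ a b a′ x ⟧ * expected)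
        (λ x → 𝔼₂-⟦⟧-≤ (rival₁ a b a′ x) (suc l) _ expected (λ p → ≤-reflexive (𝔼₂-lookupʳ x (base a b a′) (base-updateʳ (rival₁-≢ x p)))))) ⟩
      8 * q * sum (λ x → ⟦ rival₁ a b a′ x ⟧ * expected) ≡⟨ cong (8 * q *_) (sum-*ʳ expected (λ x → ⟦ rival₁ a b a′ x ⟧)) ⟩
      8 * q * (# (rival₁ a b a′) * expected) ≡⟨ regroup q (# (rival₁ a b a′)) expected ⟩
      8 * (q * # (rival₁ a b a′)) * expected ≤⟨ *-monoˡ-≤ expected (≤-trans (*-monoʳ-≤ 8 #rival₁) h₃) ⟩
      q * suc l * expected ∎)
      where
      open ≤-Reasoning
      swap : ∀ q l x → q * l * (8 * x) ≡ 8 * q * (l * x)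
      swap = solve-∀
      regroup : ∀ q x e → 8 * q * (x * e) ≡ 8 * (q * x) * e
      regroup = solve-∀

    -- There are at most `d` left neighbours `b₁` of `b`, each with at most `8 d` choices for `x`
    -- and for `x′`; with the leading 8 this is `512 d³`. The inequalities built into `rival₃` make
    -- the three samplings independent of one another and of `base`.
    penalty₂-≤ : 8 * 𝔼₂ (penalty₂ a b a′) ≤ expected
    penalty₂-≤ = *-cancelˡ-≤ K ⦃ >-nonZero (*-mono-≤ {1} {suc k} (s≤s z≤n) (*-mono-≤ {1} {suc k} (s≤s z≤n) (s≤s z≤n))) ⦄ (begin
      K * (8 * 𝔼₂ (penalty₂ a b a′)) ≡⟨ *-swap K 8 (𝔼₂ (penalty₂ a b a′)) ⟩
      8 * (K * 𝔼₂ (penalty₂ a b a′)) ≤⟨ *-monoʳ-≤ 8 (𝔼₂-sum-≤ K _ _ (λ b₁ → 𝔼₂-sum-≤ K _ _ (λ x → 𝔼₂-sum-≤ K _ _ (λ x′ → 𝔼₂-⟦⟧-≤ (rival₃ a b a′ b₁ x x′) K _ expected (term b₁ x x′))))) ⟩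
      8 * sum (λ b₁ → sum (λ x → sum (λ x′ → ⟦ rival₃ a b a′ b₁ x x′ ⟧ * expected))) ≤⟨ *-monoʳ-≤ 8 count ⟩
      8 * (d * (8 * d * (8 * d * expected))) ≡⟨ identity d expected ⟩
      512 * (d * (d * d)) * expected ≤⟨ *-monoˡ-≤ expected h₂ ⟩
      K * expected ∎)
      where
      open ≤-Reasoning
      K : ℕ
      K = suc k * (suc k * suc l)
      identity : ∀ d e → 8 * (d * (8 * d * (8 * d * e))) ≡ 512 * (d * (d * d)) * e
      identity = solve-∀
      term : ∀ b₁ x x′ → rival₃ a b a′ b₁ x x′ ≡ true → K * 𝔼₂ (λ α β → ⟦ lookup β b₁ ⟧ * (⟦ lookup α x ⟧ * (⟦ lookup α x′ ⟧ * base a b a′ α β))) ≤ expected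
      term b₁ x x′ p = ≤-reflexive (begin-equality
        K * 𝔼₂ (λ α β → ⟦ lookup β b₁ ⟧ * f₂ α β) ≡⟨ reorder (suc k) (suc l) (𝔼₂ (λ α β → ⟦ lookup β b₁ ⟧ * f₂ α β)) ⟩
        suc k * (suc k * (suc l * 𝔼₂ (λ α β → ⟦ lookup β b₁ ⟧ * f₂ α β))) ≡⟨ cong (λ z → suc k * (suc k * z)) (𝔼₂-lookupʳ b₁ f₂ (λ α β c → cong (⟦ lookup α x ⟧ *_) (cong (⟦ lookup α x′ ⟧ *_) (base-updateʳ b₁≢b α β c)))) ⟩
        suc k * (suc k * 𝔼₂ f₂) ≡⟨ cong (suc k *_) (𝔼₂-lookupˡ x f₁ (λ α c β → cong₂ _*_ (cong ⟦_⟧ (lookup∘update′ (λ e → ==-not⇒≢ (∧-elimˡ distinct) (sym e)) α c)) (base-updateˡ (new x (∧-elimˡ fresh)) (new′ x (∧-elimˡ fresh)) α c β))) ⟩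
        suc k * 𝔼₂ f₁ ≡⟨ 𝔼₂-lookupˡ x′ (base a b a′) (base-updateˡ (new x′ (∧-elimʳ {not (a == x) ∧ not (a′ == x)} fresh)) (new′ x′ (∧-elimʳ {not (a == x) ∧ not (a′ == x)} fresh))) ⟩
        expected ∎)
        where
        f₁ f₂ : Sample → Sample → ℕ
        f₁ α β = ⟦ lookup α x′ ⟧ * base a b a′ α β
        f₂ α β = ⟦ lookup α x ⟧ * f₁ α β
        reorder : ∀ k l e → k * (k * l) * e ≡ k * (k * (l * e))
        reorder = solve-∀
        b₁≢b : b₁ ≢ b
        b₁≢b = adj⇒≢ (left-adj (∧-elimˡ (∧-elimˡ p)))
        distinct : not (x == x′) ∧ ((not (a == x) ∧ not (a′ == x)) ∧ (not (a == x′) ∧ not (a′ == x′))) ≡ true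
        distinct = ∧-elimʳ {near b₁ x′} (∧-elimʳ {near b₁ x} (∧-elimʳ {earlier b b₁} p))
        fresh : (not (a == x) ∧ not (a′ == x)) ∧ (not (a == x′) ∧ not (a′ == x′)) ≡ true
        fresh = ∧-elimʳ {not (x == x′)} distinct
        new : ∀ x → not (a == x) ∧ not (a′ == x) ≡ true → x ≢ a
        new x p e = ==-not⇒≢ (∧-elimˡ p) (sym e)
        new′ : ∀ x → not (a == x) ∧ not (a′ == x) ≡ true → x ≢ a′
        new′ x p e = ==-not⇒≢ (∧-elimʳ {not (a == x)} p) (sym e)
      weights : ∀ b₁ x x′ → ⟦ rival₃ a b a′ b₁ x x′ ⟧ ≤ ⟦ earlier b b₁ ⟧ * (⟦ near b₁ x ⟧ * ⟦ near b₁ x′ ⟧)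
      weights b₁ x x′ = ≤-trans (⟦⟧-mono {rival₃ a b a′ b₁ x x′} {earlier b b₁ ∧ (near b₁ x ∧ (near b₁ x′))}
          (λ p → ∧-intro (∧-elimˡ {earlier b b₁} p) (∧-intro (∧-elimˡ {near b₁ x} (∧-elimʳ {earlier b b₁} p)) (∧-elimˡ {near b₁ x′} (∧-elimʳ {near b₁ x} (∧-elimʳ {earlier b b₁} p))))))
        (≤-reflexive (trans (⟦∧⟧ (earlier b b₁) _) (cong (⟦ earlier b b₁ ⟧ *_) (⟦∧⟧ (near b₁ x) (near b₁ x′)))))
      count : sum (λ b₁ → sum (λ x → sum (λ x′ → ⟦ rival₃ a b a′ b₁ x x′ ⟧ * expected))) ≤ d * (8 * d * (8 * d * expected))
      count = begin
        sum (λ b₁ → sum (λ x → sum (λ x′ → ⟦ rival₃ a b a′ b₁ x x′ ⟧ * expected))) ≤⟨ sum-mono (λ b₁ → sum-mono (λ x → inner b₁ x)) ⟩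
        sum (λ b₁ → sum (λ x → ⟦ earlier b b₁ ⟧ * (⟦ near b₁ x ⟧ * (# (near b₁) * expected)))) ≡⟨ sum-cong-≗ (λ b₁ → trans (sum-*ˡ ⟦ earlier b b₁ ⟧ (λ x → ⟦ near b₁ x ⟧ * (# (near b₁) * expected))) (cong (⟦ earlier b b₁ ⟧ *_) (sum-*ʳ (# (near b₁) * expected) (λ x → ⟦ near b₁ x ⟧)))) ⟩
        sum (λ b₁ → ⟦ earlier b b₁ ⟧ * (# (near b₁) * (# (near b₁) * expected)))
          ≤⟨ sum-⟦⟧*≤ (earlier b) _ (8 * d * (8 * d * expected)) (λ b₁ p → *-mono-≤ (R-degree b₁ (∧-elimʳ {left b₁ b} p)) (*-monoˡ-≤ expected (R-degree b₁ (∧-elimʳ {left b₁ b} p)))) ⟩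
        # (earlier b) * (8 * d * (8 * d * expected)) ≤⟨ *-monoˡ-≤ (8 * d * (8 * d * expected)) (≤-trans (#-mono {P = earlier b} {λ b₁ → left b₁ b} (λ b₁ → ∧-elimˡ)) (left-≤ b)) ⟩
        d * (8 * d * (8 * d * expected)) ∎
        where
        inner : ∀ b₁ x → sum (λ x′ → ⟦ rival₃ a b a′ b₁ x x′ ⟧ * expected) ≤ ⟦ earlier b b₁ ⟧ * (⟦ near b₁ x ⟧ * (# (near b₁) * expected))
        inner b₁ x = begin
          sum (λ x′ → ⟦ rival₃ a b a′ b₁ x x′ ⟧ * expected) ≡⟨ sum-*ʳ expected (λ x′ → ⟦ rival₃ a b a′ b₁ x x′ ⟧) ⟩
          sum (λ x′ → ⟦ rival₃ a b a′ b₁ x x′ ⟧) * expected ≤⟨ *-monoˡ-≤ expected (sum-mono (weights b₁ x)) ⟩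
          sum (λ x′ → ⟦ earlier b b₁ ⟧ * (⟦ near b₁ x ⟧ * ⟦ near b₁ x′ ⟧)) * expected
            ≡⟨ cong (_* expected) (trans (sum-*ˡ ⟦ earlier b b₁ ⟧ (λ x′ → ⟦ near b₁ x ⟧ * ⟦ near b₁ x′ ⟧)) (cong (⟦ earlier b b₁ ⟧ *_) (sum-*ˡ ⟦ near b₁ x ⟧ (λ x′ → ⟦ near b₁ x′ ⟧)))) ⟩
          ⟦ earlier b b₁ ⟧ * (⟦ near b₁ x ⟧ * # (near b₁)) * expected ≡⟨ assoc ⟦ earlier b b₁ ⟧ ⟦ near b₁ x ⟧ (# (near b₁)) expected ⟩
          ⟦ earlier b b₁ ⟧ * (⟦ near b₁ x ⟧ * (# (near b₁) * expected)) ∎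
          where
          assoc : ∀ a b c e → a * (b * c) * e ≡ a * (b * (c * e))
          assoc = solve-∀

    penalty-≤ : 2 * 𝔼₂ (penalty a b a′) ≤ expected
    penalty-≤ = *-cancelˡ-≤ 4 (begin
      4 * (2 * 𝔼₂ (penalty a b a′)) ≡⟨ cong (λ z → 4 * (2 * z)) (trans (𝔼₂-+ (penalty₁ a b a′) (λ α β → penalty₂ a b a′ α β + penalty₃ a b a′ α β)) (cong (𝔼₂ (penalty₁ a b a′) +_) (𝔼₂-+ (penalty₂ a b a′) (penalty₃ a b a′)))) ⟩
      4 * (2 * (p₁ + (p₂ + p₃))) ≤⟨ linear expected (+-mono-≤ penalty₁-≤ (+-mono-≤ penalty₂-≤ penalty₃-≤)) (identity p₁ p₂ p₃ expected) ⟩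
      4 * expected ∎)
      where
      open ≤-Reasoning
      p₁ p₂ p₃ : ℕ
      p₁ = 𝔼₂ (penalty₁ a b a′)
      p₂ = 𝔼₂ (penalty₂ a b a′)
      p₃ = 𝔼₂ (penalty₃ a b a′)
      identity : ∀ p₁ p₂ p₃ e → 4 * (2 * (p₁ + (p₂ + p₃))) + (e + (e + e)) + e ≡ 4 * e + (8 * p₁ + (8 * p₂ + 8 * p₃))
      identity = solve-∀

    expected-≡ : suc k * (suc k * (suc l * expected)) ≡ 𝔼₂ (λ _ _ → 1)
    expected-≡ = begin
      suc k * (suc k * (suc l * expected)) ≡⟨ reorder (suc k) (suc l) expected ⟩
      suc l * (suc k * (suc k * expected)) ≡⟨ cong (λ z → suc l * (suc k * (suc k * z))) (𝔼₂-cong (λ α β → *-assoc ⟦ lookup α a ⟧ (ind (a′ ∷ []) α) (ind (b ∷ []) β))) ⟩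
      suc l * (suc k * (suc k * 𝔼₂ (λ α β → ⟦ lookup α a ⟧ * g₂ α β))) ≡⟨ cong (λ z → suc l * (suc k * z)) (𝔼₂-lookupˡ a g₂ (λ α c β → cong (_* ind (b ∷ []) β) (ind-update (a≢a′ ∷ []) α c))) ⟩
      suc l * (suc k * 𝔼₂ g₂) ≡⟨ cong (λ z → suc l * (suc k * z)) (𝔼₂-cong (λ α β → cong (_* ind (b ∷ []) β) (*-identityʳ ⟦ lookup α a′ ⟧))) ⟩
      suc l * (suc k * 𝔼₂ (λ α β → ⟦ lookup α a′ ⟧ * g₁ α β)) ≡⟨ cong (suc l *_) (𝔼₂-lookupˡ a′ g₁ (λ _ _ _ → refl)) ⟩
      suc l * 𝔼₂ g₁ ≡⟨ 𝔼₂-lookupʳ b (λ _ _ → 1) (λ _ _ _ → refl) ⟩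
      𝔼₂ (λ _ _ → 1) ∎
      where
      open ≡-Reasoning
      g₁ g₂ : Sample → Sample → ℕ
      g₁ α β = ind (b ∷ []) β
      g₂ α β = ind (a′ ∷ []) α * ind (b ∷ []) β
      reorder : ∀ k l e → k * (k * (l * e)) ≡ l * (k * (k * e))
      reorder = solve-∀

  good : V → V → V → Sample → Sample → Bool
  good a b a′ α β = triple a b a′ ∧ ((1 ≤ᵇ base a b a′ α β) ∧ (penalty a b a′ α β ≤ᵇ 0))

  #good : Sample → Sample → ℕ
  #good α β = sum (λ a → sum (λ b → # (λ a′ → good a b a′ α β)))

  sampleSize : Sample → Sample → ℕ
  sampleSize α β = sum (λ x → ⟦ L x ⟧ * (⟦ lookup α x ⟧ * 1))

  base≤1 : ∀ a b a′ α β → base a b a′ α β ≤ 1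
  base≤1 a b a′ α β = *-mono-≤ {_} {1} {_} {1} (*-mono-≤ {_} {1} {_} {1} (⟦⟧≤1 (lookup α a)) (*-mono-≤ {_} {1} {_} {1} (⟦⟧≤1 (lookup α a′)) ≤-refl)) (*-mono-≤ {_} {1} {_} {1} (⟦⟧≤1 (lookup β b)) ≤-refl)

  -- `base` is at most 1 and `penalty` is a natural number: a sampled triple is good or has penalty
  -- at least 1.
  base-good : ∀ {a b a′} → triple a b a′ ≡ true → ∀ α β → base a b a′ α β ≤ ⟦ good a b a′ α β ⟧ + penalty a b a′ α β
  base-good {a} {b} {a′} τ α β rewrite τ = cases (base a b a′ α β) (penalty a b a′ α β) (base≤1 a b a′ α β)
    where
    cases : ∀ x p → x ≤ 1 → x ≤ ⟦ (1 ≤ᵇ x) ∧ (p ≤ᵇ 0) ⟧ + p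
    cases zero p _ = z≤n
    cases (suc zero) zero _ = ≤-refl
    cases (suc zero) (suc p) _ = s≤s z≤n
    cases (suc (suc x)) p (s≤s ())

  K Z : ℕ
  K = suc k * (suc k * suc l)
  Z = 𝔼₂ (λ _ _ → 1)

  triple-survives : ∀ a b a′ → ⟦ triple a b a′ ⟧ * Z ≤ 2 * K * 𝔼₂ (λ α β → ⟦ good a b a′ α β ⟧)
  triple-survives a b a′ with ≡true⊎≡false (triple a b a′)
  ... | inj₂ e = ≤-trans (≤-reflexive (cong (λ z → ⟦ z ⟧ * Z) e)) z≤n
  ... | inj₁ e = ≤-trans (⟦⟧*≤ (triple a b a′) Z) (≤-trans (≤-reflexive (sym (expected-≡ τ))) (linear 0 (*-monoʳ-≤ K (+-mono-≤ (*-monoʳ-≤ 2 half) (penalty-≤ τ)))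
        (identity (suc k) (suc l) (expected τ) (𝔼₂ (λ α β → ⟦ good a b a′ α β ⟧)) (𝔼₂ (penalty a b a′)))))
    where
    τ : Triple a b a′
    τ = triple-elim e
    half : expected τ ≤ 𝔼₂ (λ α β → ⟦ good a b a′ α β ⟧) + 𝔼₂ (penalty a b a′)
    half = ≤-trans (𝔼₂-mono (base-good e)) (≤-reflexive (𝔼₂-+ (λ α β → ⟦ good a b a′ α β ⟧) (penalty a b a′)))
    identity : ∀ k l e g p → k * (k * (l * e)) + (k * (k * l)) * (2 * (g + p) + e) + 0 ≡ 2 * (k * (k * l)) * g + (k * (k * l)) * (2 * e + 2 * p)
    identity = solve-∀

  survivors : #triples * Z ≤ 2 * K * 𝔼₂ #good
  survivors = begin
    #triples * Z ≡⟨ sum-*ʳ Z (λ a → sum (λ b → # (triple a b))) ⟨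
    sum (λ a → sum (λ b → # (triple a b)) * Z) ≡⟨ sum-cong-≗ (λ a → trans (sym (sum-*ʳ Z (λ b → # (triple a b)))) (sum-cong-≗ (λ b → sym (sum-*ʳ Z (λ a′ → ⟦ triple a b a′ ⟧))))) ⟩
    sum (λ a → sum (λ b → sum (λ a′ → ⟦ triple a b a′ ⟧ * Z))) ≤⟨ sum-mono (λ a → sum-mono (λ b → sum-mono (λ a′ → triple-survives a b a′))) ⟩
    sum (λ a → sum (λ b → sum (λ a′ → 2 * K * 𝔼₂ (λ α β → ⟦ good a b a′ α β ⟧))))
      ≡⟨ sum-cong-≗ (λ a → trans (sum-cong-≗ (λ b → trans (sum-*ˡ (2 * K) (λ a′ → 𝔼₂ (λ α β → ⟦ good a b a′ α β ⟧))) (cong (2 * K *_) (sym (𝔼₂-sum (λ a′ α β → ⟦ good a b a′ α β ⟧))))))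
           (trans (sum-*ˡ (2 * K) (λ b → 𝔼₂ (λ α β → # (λ a′ → good a b a′ α β)))) (cong (2 * K *_) (sym (𝔼₂-sum (λ b α β → # (λ a′ → good a b a′ α β))))))) ⟩
    sum (λ a → 2 * K * 𝔼₂ (λ α β → sum (λ b → # (λ a′ → good a b a′ α β)))) ≡⟨ trans (sum-*ˡ (2 * K) (λ a → 𝔼₂ (λ α β → sum (λ b → # (λ a′ → good a b a′ α β))))) (cong (2 * K *_) (sym (𝔼₂-sum (λ a α β → sum (λ b → # (λ a′ → good a b a′ α β)))))) ⟩
    2 * K * 𝔼₂ #good ∎
    where open ≤-Reasoning

  expected-size : suc k * 𝔼₂ sampleSize ≤ # L * Z
  expected-size = ≤-trans (𝔼₂-sum-≤ (suc k) (λ x α β → ⟦ L x ⟧ * (⟦ lookup α x ⟧ * 1)) (λ x → ⟦ L x ⟧ * Z)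
    (λ x → 𝔼₂-⟦⟧-≤ (L x) (suc k) (λ α β → ⟦ lookup α x ⟧ * 1) Z (λ _ → ≤-reflexive (𝔼₂-lookupˡ x (λ _ _ → 1) (λ _ _ _ → refl)))))
    (≤-reflexive (sum-*ʳ Z (λ x → ⟦ L x ⟧)))

  -- The expected number of good triples is at least `# L * r²` divided by `4 K`, and the expected
  -- sample from `L` has size `# L` divided by `suc k`; `h₅` compares the two after multiplication
  -- by `κ`.
  good-sample : ∃ λ α → ∃ λ β → κ * sampleSize α β < #good α β
  good-sample = 𝔼₂-< (subst (_< 𝔼₂ #good) (sym (𝔼₂-* κ sampleSize)) (*-cancelˡ-< (4 * K) _ _ (begin-strict
    4 * K * (κ * 𝔼₂ sampleSize) ≡⟨ regroup (suc k) (suc l) κ (𝔼₂ sampleSize) ⟩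
    4 * κ * (suc k * suc l) * (suc k * 𝔼₂ sampleSize) ≤⟨ *-monoʳ-≤ (4 * κ * (suc k * suc l)) expected-size ⟩
    4 * κ * (suc k * suc l) * (# L * Z) <⟨ *-monoˡ-< (# L * Z) ⦃ >-nonZero (*-mono-≤ nonempty 𝔼₂-one) ⦄ h₅ ⟩
    r * r * (# L * Z) ≡⟨ regroup′ (r * r) (# L) Z ⟩
    # L * (r * r) * Z ≤⟨ *-monoˡ-≤ Z many-triples ⟩
    2 * #triples * Z ≡⟨ *-assoc 2 #triples Z ⟩
    2 * (#triples * Z) ≤⟨ *-monoʳ-≤ 2 survivors ⟩
    2 * (2 * K * 𝔼₂ #good) ≡⟨ regroup″ K (𝔼₂ #good) ⟩
    4 * K * 𝔼₂ #good ∎)))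
    where
    open ≤-Reasoning
    regroup : ∀ k l c s → 4 * (k * (k * l)) * (c * s) ≡ 4 * c * (k * l) * (k * s)
    regroup = solve-∀
    regroup′ : ∀ r l z → r * (l * z) ≡ l * r * z
    regroup′ = solve-∀
    regroup″ : ∀ k g → 2 * (2 * k * g) ≡ 4 * k * g
    regroup″ = solve-∀

  -- The incidence graph carried by a good sample.

  module Extract (α β : Sample) (many : κ * sampleSize α β < #good α β) where

    Good : V → V → V → Bool
    Good a b a′ = good a b a′ α β

    record Surviving (a b a′ : V) : Set where
      field
        τ        : Triple a b a′
        αa       : lookup α a ≡ true
        αa′      : lookup α a′ ≡ true
        βb       : lookup β b ≡ true
        unspoilt : ∀ x → spoilt a b a′ x ≡ true → ¬ (lookup α x ≡ true)
        unrival₃ : ∀ b₁ x x′ → rival₃ a b a′ b₁ x x′ ≡ true → lookup β b₁ ≡ true → lookup α x ≡ true → ¬ (lookup α x′ ≡ true)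
        unrival₁ : ∀ b₁ → rival₁ a b a′ b₁ ≡ true → ¬ (lookup β b₁ ≡ true)
      open Triple τ public

    factorˡ : ∀ x y → 1 ≤ x * y → 1 ≤ x
    factorˡ (suc x) y _ = s≤s z≤n

    factorʳ : ∀ x y → 1 ≤ x * y → 1 ≤ y
    factorʳ x y p = factorˡ y x (≤-trans p (≤-reflexive (*-comm x y)))

    surviving : ∀ {a b a′} → Good a b a′ ≡ true → Surviving a b a′
    surviving {a} {b} {a′} p = record
      { τ = triple-elim (∧-elimˡ p)
      ; αa = ⟦⟧-elim (factorˡ _ _ (factorˡ _ (ind (b ∷ []) β) 1≤base))
      ; αa′ = ⟦⟧-elim (factorˡ _ 1 (factorʳ ⟦ lookup α a ⟧ _ (factorˡ _ (ind (b ∷ []) β) 1≤base)))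
      ; βb = ⟦⟧-elim (factorˡ _ 1 (factorʳ (ind (a ∷ a′ ∷ []) α) _ 1≤base))
      ; unspoilt = λ x s αx → <⇒≱ (≤-trans (≤-trans (unit s (unit αx 1≤base)) (term≤sum (λ x → ⟦ spoilt a b a′ x ⟧ * (⟦ lookup α x ⟧ * base a b a′ α β)) x)) (m≤m+n (penalty₁ a b a′ α β) _)) none
      ; unrival₃ = λ b₁ x x′ s βb₁ αx αx′ → <⇒≱ (≤-trans (≤-trans (unit s (unit βb₁ (unit αx (unit αx′ 1≤base))))
          (≤-trans (term≤sum (term₂ a b a′ α β b₁ x) x′)
          (≤-trans (term≤sum (λ x → sum (term₂ a b a′ α β b₁ x)) x)
          (term≤sum (λ b₁ → sum (λ x → sum (term₂ a b a′ α β b₁ x))) b₁))))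
          (≤-trans (m≤m+n (penalty₂ a b a′ α β) _) (m≤n+m _ (penalty₁ a b a′ α β)))) none
      ; unrival₁ = λ b₁ s βb₁ → <⇒≱ (≤-trans (≤-trans (unit s (unit βb₁ 1≤base)) (term≤sum (λ b₁ → ⟦ rival₁ a b a′ b₁ ⟧ * (⟦ lookup β b₁ ⟧ * base a b a′ α β)) b₁))
          (≤-trans (m≤n+m (penalty₃ a b a′ α β) (penalty₂ a b a′ α β)) (m≤n+m _ (penalty₁ a b a′ α β)))) none
      }
      where
      1≤base : 1 ≤ base a b a′ α β
      1≤base = ≤ᵇ-elim (∧-elimˡ (∧-elimʳ {triple a b a′} p))
      none : penalty a b a′ α β ≤ 0
      none = ≤ᵇ-elim (∧-elimʳ {1 ≤ᵇ base a b a′ α β} (∧-elimʳ {triple a b a′} p))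
      unit : ∀ {c x} → c ≡ true → 1 ≤ x → 1 ≤ ⟦ c ⟧ * x
      unit {x = x} refl p = ≤-trans p (≤-reflexive (sym (*-identityˡ x)))

    only-ends : ∀ {a b a′ x} → Surviving a b a′ → L x ≡ true → lookup α x ≡ true → adj G x b ≡ true → (x ≡ a) ⊎ (x ≡ a′)
    only-ends {a} {b} {a′} {x} g Lx αx xb with x ≟ a | x ≟ a′
    ... | yes e | _     = inj₁ e
    ... | no _  | yes e = inj₂ e
    ... | no ne | no ne′ = ⊥-elim (Surviving.unspoilt g x (∧-intro Lx (∨-introʳ {b == x} (∨-introˡ (∧-intro (trans (adj-sym G b x) xb)
            (∧-intro (not-intro (≢⇒== (λ e → ne (sym e)))) (not-intro (≢⇒== (λ e → ne′ (sym e))))))))) αx)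

    one-between : ∀ {a b b₁ a′} → Surviving a b a′ → Surviving a b₁ a′ → b ≡ b₁
    one-between {a} {b} {b₁} {a′} g g₁ with b ≟ b₁
    ... | yes e = e
    ... | no ne = ⊥-elim (Surviving.unrival₁ g b₁ (∨-introʳ {left b₁ b ∧ (adj G a b₁ ∨ adj G a′ b₁)}
            (∧-intro (∧-intro (Surviving.Yab g₁) (Surviving.a′b g₁)) (not-intro (≢⇒== ne)))) (Surviving.βb g₁))

    -- A sampled left neighbour `b₁` that subdivides another edge would be a rival: through its
    -- adjacency to `a` or `a′`, or else because its own ends `c` and `c′` are two further vertices
    -- of the sample.
    not-left : ∀ {a b a′ c b₁ c′} → Surviving a b a′ → Surviving c b₁ c′ → ¬ (left b₁ b ≡ true)
    not-left {a} {b} {a′} {c} {b₁} {c′} g g₁ b₁<b with ≡true⊎≡false (adj G a b₁) | ≡true⊎≡false (adj G a′ b₁)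
    ... | inj₁ e | _ = Surviving.unrival₁ g b₁ (∨-introˡ (∧-intro b₁<b (∨-introˡ e))) (Surviving.βb g₁)
    ... | inj₂ _ | inj₁ e = Surviving.unrival₁ g b₁ (∨-introˡ (∧-intro b₁<b (∨-introʳ {adj G a b₁} e))) (Surviving.βb g₁)
    ... | inj₂ e | inj₂ e′ = Surviving.unrival₃ g b₁ c c′ (∧-intro (∧-intro b₁<b (Y-R S.Yab)) (∧-intro (∧-intro S.La (trans (adj-sym G b₁ c) S.ab))
            (∧-intro (∧-intro S.La′ (trans (adj-sym G b₁ c′) S.a′b)) (∧-intro (not-intro (≢⇒== S.a≢a′)) (∧-intro (away S.ab) (away S.a′b)))))) S.βb S.αa S.αa′
      where
      module S = Surviving g₁
      away : ∀ {x} → adj G x b₁ ≡ true → not (a == x) ∧ not (a′ == x) ≡ true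
      away {x} xb₁ = ∧-intro (not-intro (≢⇒== {i = a} {x} λ { refl → true≢false xb₁ e })) (not-intro (≢⇒== {i = a′} {x} λ { refl → true≢false xb₁ e′ }))

    linked : V → V → Bool
    linked u v = some (λ b → Good u b v)

    F : V → V → Bool
    F u v = linked u v ∨ linked v u

    F-sym : ∀ {u v} → F u v ≡ true → F v u ≡ true
    F-sym {u} {v} p with ∨-elim {linked u v} p
    ... | inj₁ e = ∨-introʳ {linked v u} e
    ... | inj₂ e = ∨-introˡ e

    -- A pair may be linked in both directions by different vertices; the direction from `u` to `v`
    -- takes precedence. For unlinked pairs `u` is a default value.
    midpoint : ∀ u v → Σ V λ b → F u v ≡ true → Surviving u b v ⊎ Surviving v b u
    midpoint u v with ≡true⊎≡false (linked u v)
    ... | inj₁ e = proj₁ (some-elim {P = λ b → Good u b v} e) , λ _ → inj₁ (surviving (proj₂ (some-elim {P = λ b → Good u b v} e)))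
    ... | inj₂ e with ≡true⊎≡false (linked v u)
    ...   | inj₁ e′ = proj₁ (some-elim {P = λ b → Good v b u} e′) , λ _ → inj₂ (surviving (proj₂ (some-elim {P = λ b → Good v b u} e′)))
    ...   | inj₂ e′ = u , λ p → case ∨-elim {linked u v} p of λ { (inj₁ q) → true≢false q e ; (inj₂ q) → true≢false q e′ }

    F-irrefl : ∀ {u v} → F u v ≡ true → u ≢ v
    F-irrefl {u} {v} p with proj₂ (midpoint u v) p
    ... | inj₁ g = Surviving.a≢a′ g
    ... | inj₂ g = λ e → Surviving.a≢a′ g (sym e)

    -- Only sampled vertices that are ends of a surviving triple are kept: for these, `unspoilt`
    -- excludes left neighbours in the sample from `L`, which makes `W` independent.
    W : V → Bool
    W u = some (λ v → F u v)

    F-end : ∀ {u v} → F u v ≡ true → W u ≡ true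
    F-end {u} {v} p = some-intro {P = λ v → F u v} v p

    W-elim : ∀ {u} → W u ≡ true → L u ≡ true × lookup α u ≡ true × (∀ x → L x ≡ true → lookup α x ≡ true → ¬ (left x u ≡ true))
    W-elim {u} p with some-elim {P = λ v → F u v} p
    ... | v , q with proj₂ (midpoint u v) q
    ...   | inj₁ g = Surviving.La g , Surviving.αa g , λ x Lx αx x<u → Surviving.unspoilt g x
              (∧-intro Lx (∨-introʳ {proj₁ (midpoint u v) == x} (∨-introʳ {adj G (proj₁ (midpoint u v)) x ∧ (not (u == x) ∧ not (v == x))} (∨-introˡ x<u)))) αx
    ...   | inj₂ g = Surviving.La′ g , Surviving.αa′ g , λ x Lx αx x<u → Surviving.unspoilt g x
              (∧-intro Lx (∨-introʳ {proj₁ (midpoint u v) == x} (∨-introʳ {adj G (proj₁ (midpoint u v)) x ∧ (not (v == x) ∧ not (u == x))} (∨-introʳ {left x v} x<u)))) αx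

    W-indep : ∀ {u v} → W u ≡ true → W v ≡ true → adj G u v ≡ false
    W-indep {u} {v} Wu Wv = ≢true⇒≡false λ e → case total refl refl e of
      λ { (inj₁ u<v) → proj₂ (proj₂ (W-elim Wv)) u (proj₁ (W-elim Wu)) (proj₁ (proj₂ (W-elim Wu))) u<v
        ; (inj₂ v<u) → proj₂ (proj₂ (W-elim Wu)) v (proj₁ (W-elim Wv)) (proj₁ (proj₂ (W-elim Wv))) v<u }

    oriented : ∀ u v → F u v ≡ true → ∃ λ a → ∃ λ a′ → Surviving a (proj₁ (midpoint u v)) a′
    oriented u v p with proj₂ (midpoint u v) p
    ... | inj₁ g = u , v , g
    ... | inj₂ g = v , u , g

    incidence : InducedIncidence G F W
    incidence = record
      { ι = id
      ; mid = λ u v → proj₁ (midpoint u v)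
      ; ι-inj = λ _ _ e → e
      ; ι-indep = W-indep
      ; mid-adjˡ = λ {u} {v} p → case proj₂ (midpoint u v) p of λ { (inj₁ g) → Surviving.ab g ; (inj₂ g) → Surviving.a′b g }
      ; mid-adjʳ = λ {u} {v} p → case proj₂ (midpoint u v) p of λ { (inj₁ g) → Surviving.a′b g ; (inj₂ g) → Surviving.ab g }
      ; mid-only = λ {u} {v} {x} p Wx e → let Lx , αx , _ = W-elim Wx in case proj₂ (midpoint u v) p of
          λ { (inj₁ g) → only-ends g Lx αx e ; (inj₂ g) → case only-ends g Lx αx e of λ { (inj₁ q) → inj₂ q ; (inj₂ q) → inj₁ q } }
      ; mid-indep = λ {u} {v} {u′} {v′} p p′ → let _ , _ , g = oriented u v p ; _ , _ , g′ = oriented u′ v′ p′ in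
          ≢true⇒≡false λ e → case total refl refl e of λ { (inj₁ q) → not-left g′ g q ; (inj₂ q) → not-left g g′ q }
      }

    -- By `one-between` an ordered pair of ends has at most one good `b`, and `edges₂` counts
    -- ordered pairs as well.
    #good≤edges : #good α β ≤ edges₂ F W
    #good≤edges = sum-mono (λ a → begin
      sum (λ b → # (λ a′ → Good a b a′)) ≡⟨ ∑-comm (λ b a′ → ⟦ Good a b a′ ⟧) ⟩
      sum (λ a′ → # (λ b → Good a b a′)) ≤⟨ sum-mono (λ a′ → link a a′) ⟩
      sum (λ a′ → ⟦ W a ⟧ * ⟦ W a′ ∧ F a a′ ⟧) ≡⟨ sum-*ˡ ⟦ W a ⟧ (λ a′ → ⟦ W a′ ∧ F a a′ ⟧) ⟩
      ⟦ W a ⟧ * degIn F W a ∎)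
      where
      open ≤-Reasoning
      link : ∀ a a′ → # (λ b → Good a b a′) ≤ ⟦ W a ⟧ * ⟦ W a′ ∧ F a a′ ⟧
      link a a′ with ≡true⊎≡false (linked a a′)
      ... | inj₂ e = ≤-trans (≤-pred (≤ᵇ-false e)) z≤n
      ... | inj₁ e = ≤-trans (#-unique (λ b → Good a b a′) (λ b b₁ p p₁ → one-between (surviving p) (surviving p₁)))
              (≤-reflexive (sym (cong₂ _*_ (⟦⟧-true (F-end aa′)) (⟦⟧-true (∧-intro (F-end (F-sym {a} {a′} aa′)) aa′)))))
        where
        aa′ : F a a′ ≡ true
        aa′ = ∨-introˡ e

    #W≤ : # W ≤ sampleSize α β
    #W≤ = sum-mono (λ x → ≤-trans (⟦⟧-mono {W x} {L x ∧ lookup α x} (λ p → ∧-intro (proj₁ (W-elim p)) (proj₁ (proj₂ (W-elim p)))))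
      (≤-reflexive (trans (⟦∧⟧ (L x) (lookup α x)) (cong (⟦ L x ⟧ *_) (sym (*-identityʳ _))))))

    dense-F : κ * # W < edges₂ F W
    dense-F = ≤-<-trans (*-monoʳ-≤ κ #W≤) (≤-trans many #good≤edges)

    W-nonempty : 1 ≤ # W
    W-nonempty with 1 ≤? # W
    ... | yes p = p
    ... | no ¬p = ⊥-elim (<⇒≱ dense-F (≤-trans (sum-⟦⟧*≤ W (degIn F W) (order G) (λ u _ → #≤n _)) (≤-trans (≤-reflexive (cong (_* order G) (≱1⇒≡0 ¬p))) z≤n)))

-- The edges of H and their routes in a complete graph.

forwardEdges : (H : Graph) → List (Fin (order H) × Fin (order H))
forwardEdges H = filter (λ e → T? (FwdEdge H (proj₁ e) (proj₂ e))) (cartesianProduct (allFin (order H)) (allFin (order H)))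

forwardEdges-complete : ∀ H i j → T (FwdEdge H i j) → (i , j) ∈ forwardEdges H
forwardEdges-complete H i j p = ∈-filter⁺ (λ e → T? (FwdEdge H (proj₁ e) (proj₂ e))) (∈-cartesianProduct⁺ (∈-allFin i) (∈-allFin j)) p

forwardEdges-distinct : ∀ H {i j} → (i , j) ∈ forwardEdges H → i ≢ j
forwardEdges-distinct H {i} {j} m i≡j = <-irrefl (cong toℕ i≡j) (forward-ordered H (proj₂ (∈-filter⁻ (λ e → T? (FwdEdge H (proj₁ e) (proj₂ e)))
  {xs = cartesianProduct (allFin (order H)) (allFin (order H))} m)))

topMinor-complete : ∀ {h} (es : List (Fin h × Fin h)) → (∀ {i j} → (i , j) ∈ es → i ≢ j) → TopMinor (λ i j → not (i == j)) (λ _ → true) es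
topMinor-complete {h} es distinct = record
  { φ = id ; φ-inj = id ; φ-within = λ _ → refl ; len = λ _ _ → 0 ; at = at ; disjoint = λ _ _ _ _ _ ()
  ; route = λ m → record { start = refl ; end = refl ; step = λ { zero _ → not-intro (≢⇒== (distinct m)) } ; within = λ _ _ → refl ; inj = at-inj (distinct m) ; avoid = λ _ () } }
  where
  at : Fin h → Fin h → ℕ → Fin h
  at i j zero    = i
  at i j (suc _) = j
  at-inj : ∀ {i j} → i ≢ j → ∀ t u → t ≤ 1 → u ≤ 1 → at i j t ≡ at i j u → t ≡ u
  at-inj ne zero zero _ _ _ = refl
  at-inj ne zero (suc u) _ _ e = ⊥-elim (ne e)
  at-inj ne (suc t) zero _ _ e = ⊥-elim (ne (sym e))
  at-inj ne (suc zero) (suc zero) _ _ _ = refl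
  at-inj ne (suc (suc t)) _ (s≤s ()) _ _
  at-inj ne (suc zero) (suc (suc u)) _ (s≤s ()) _

-- Polynomial bounds in s.

-- For positive `s` powers increase with the exponent, so bounds by a single monomial are closed
-- under sums as well as products. The recursive sizes stay polynomial because their depth depends
-- on H only.
record Monomial (f : ℕ → ℕ) : Set where
  field
    coefficient exponent : ℕ
    bounds : ∀ s → 1 ≤ s → f s ≤ coefficient * s ^ exponent

power-mono : ∀ {s} → 1 ≤ s → ∀ {m n} → m ≤ n → s ^ m ≤ s ^ n
power-mono {suc s} _ = ^-monoʳ-≤ (suc s)

monomial-const : ∀ c → Monomial (λ _ → c)
monomial-const c = record { coefficient = c ; exponent = 0 ; bounds = λ _ _ → ≤-reflexive (sym (*-identityʳ c)) }

monomial-id : Monomial id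
monomial-id = record { coefficient = 1 ; exponent = 1 ; bounds = λ s _ → ≤-reflexive (identity s) }
  where
  identity : ∀ s → s ≡ 1 * (s * 1)
  identity = solve-∀

monomial-+ : ∀ {f g} → Monomial f → Monomial g → Monomial (λ s → f s + g s)
monomial-+ F G = record { coefficient = F.coefficient + G.coefficient ; exponent = F.exponent + G.exponent
  ; bounds = λ s 1≤s → ≤-trans (+-mono-≤ (≤-trans (F.bounds s 1≤s) (*-monoʳ-≤ F.coefficient (power-mono 1≤s (m≤m+n F.exponent G.exponent))))
                                       (≤-trans (G.bounds s 1≤s) (*-monoʳ-≤ G.coefficient (power-mono 1≤s (m≤n+m G.exponent F.exponent)))))
                             (≤-reflexive (sym (*-distribʳ-+ (s ^ (F.exponent + G.exponent)) F.coefficient G.coefficient))) }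
  where
  module F = Monomial F
  module G = Monomial G

monomial-* : ∀ {f g} → Monomial f → Monomial g → Monomial (λ s → f s * g s)
monomial-* F G = record { coefficient = F.coefficient * G.coefficient ; exponent = F.exponent + G.exponent
  ; bounds = λ s 1≤s → ≤-trans (*-mono-≤ (F.bounds s 1≤s) (G.bounds s 1≤s))
      (≤-reflexive (trans (identity F.coefficient (s ^ F.exponent) G.coefficient (s ^ G.exponent)) (cong (F.coefficient * G.coefficient *_) (sym (^-distribˡ-+-* s F.exponent G.exponent))))) }
  where
  module F = Monomial F
  module G = Monomial G
  identity : ∀ a x b y → a * x * (b * y) ≡ a * b * (x * y)
  identity = solve-∀

monomial-next : ∀ {q} → Monomial q → Monomial (λ s → next s (q s))
monomial-next Q = monomial-* (monomial-* (monomial-const 32) monomial-id) (monomial-* Q Q)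

monomial-typeSize : ∀ {base q} → Monomial base → ∀ k → Monomial q → Monomial (λ s → typeSize s (base s) k (q s))
monomial-typeSize B zero    Q = B
monomial-typeSize B (suc k) Q = monomial-* (monomial-* (monomial-* (monomial-const 2) monomial-id) Q) (monomial-typeSize B k (monomial-next Q))

monomial-candidateSize : ∀ {q} h k → Monomial q → Monomial (λ s → candidateSize s h k (q s))
monomial-candidateSize h zero    Q = monomial-const 0
monomial-candidateSize h (suc k) Q = monomial-+ (monomial-* (monomial-next Q) (monomial-candidateSize h k (monomial-next Q)))
  (monomial-+ (monomial-+ (monomial-* (monomial-* (monomial-const 4) monomial-id) Q)
    (monomial-* (monomial-* (monomial-const 2) (monomial-next Q)) (monomial-* (monomial-const (2 ^ h)) monomial-id))) (monomial-const 1))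

monomial-threshold : ∀ m → Monomial (λ s → threshold s m)
monomial-threshold zero    = monomial-const 1
monomial-threshold (suc m) = monomial-+ (monomial-* (monomial-* (monomial-const 2) monomial-id) (monomial-threshold m)) (monomial-* (monomial-const (suc m)) monomial-id)

monomial-poly : ∀ c e → Σ Poly λ p → ∀ s → eval p s ≡ c * s ^ e
monomial-poly c zero    = (c ∷ []) , λ s → trans (cong (c +_) (*-zeroʳ s)) (trans (+-identityʳ c) (sym (*-identityʳ c)))
monomial-poly c (suc e) = let p , eq = monomial-poly c e in (0 ∷ p) , λ s → trans (cong (s *_) (eq s)) (identity s c (s ^ e))
  where
  identity : ∀ s c x → s * (c * x) ≡ c * (s * x)
  identity = solve-∀

-- Choice of the constants and conclusion.

-- The scale is `t`: the pruned degree is `J * t` and the inverse sampling rates are `J′ * t` and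
-- `t`. Each inequality is homogeneous in these quantities, so after inserting `d ≤ 8 J t` the
-- powers of `t` cancel and a condition on the constants is left; thus 704 is 88 times 8, and the
-- inner 512 is the cube of 8.
module Parameters (J J′ q t d m₀ κ : ℕ) (1≤J : 1 ≤ J) (1≤t : 1 ≤ t) (q≡ : q ≡ 256 * J) (d≤ : d ≤ 8 * (J * t)) (4m₀≤t : 4 * m₀ ≤ t) where

  sampling-rate₁ : 704 * J ≤ J′ → 88 * d ≤ J′ * t
  sampling-rate₁ h = begin
    88 * d ≤⟨ *-monoʳ-≤ 88 d≤ ⟩
    88 * (8 * (J * t)) ≡⟨ *-assoc 88 8 (J * t) ⟨
    704 * (J * t) ≡⟨ *-assoc 704 J t ⟨
    704 * J * t ≤⟨ *-monoˡ-≤ t h ⟩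
    J′ * t ∎
    where open ≤-Reasoning

  sampling-rate₂ : 512 * (512 * (J * (J * J))) ≤ J′ * J′ → 512 * (d * (d * d)) ≤ J′ * t * (J′ * t * t)
  sampling-rate₂ h = begin
    512 * (d * (d * d)) ≤⟨ *-monoʳ-≤ 512 (*-mono-≤ d≤ (*-mono-≤ d≤ d≤)) ⟩
    512 * (8 * (J * t) * (8 * (J * t) * (8 * (J * t)))) ≡⟨ identity 512 8 J t ⟩
    512 * (512 * (J * (J * J))) * (t * (t * t)) ≤⟨ *-monoˡ-≤ (t * (t * t)) h ⟩
    J′ * J′ * (t * (t * t)) ≡⟨ identity′ J′ t ⟩
    J′ * t * (J′ * t * t) ∎
    where
    open ≤-Reasoning
    identity : ∀ c e J t → c * (e * (J * t) * (e * (J * t) * (e * (J * t)))) ≡ c * (e * (e * e) * (J * (J * J))) * (t * (t * t))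
    identity = solve-∀
    identity′ : ∀ K t → K * K * (t * (t * t)) ≡ K * t * (K * t * t)
    identity′ = solve-∀

  rivals : 8 * (2 * d + J * t) ≤ q * t
  rivals = begin
    8 * (2 * d + J * t) ≤⟨ *-monoʳ-≤ 8 (+-monoˡ-≤ (J * t) (*-monoʳ-≤ 2 d≤)) ⟩
    8 * (2 * (8 * (J * t)) + J * t) ≡⟨ identity (J * t) ⟩
    136 * (J * t) ≤⟨ *-monoˡ-≤ (J * t) (m≤m+n 136 120) ⟩
    256 * (J * t) ≡⟨ *-assoc 256 J t ⟨
    256 * J * t ≡⟨ cong (_* t) q≡ ⟨
    q * t ∎
    where
    open ≤-Reasoning
    identity : ∀ u → 8 * (2 * (8 * u) + u) ≡ 136 * u
    identity = solve-∀

  triples : 2 * (d + q * m₀) ≤ q * (J * t)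
  triples = *-cancelˡ-≤ 2 (linear 0 (+-mono-≤ (*-monoʳ-≤ 4 d≤) (+-mono-≤ (*-monoʳ-≤ q (≤-trans 4m₀≤t (m≤n*m t J ⦃ >-nonZero 1≤J ⦄))) (*-monoʳ-≤ (J * t) 32≤q)))
      (identity q (J * t) d m₀))
    where
    32≤q : 32 ≤ q
    32≤q = ≤-trans (≤-trans (m≤m+n 32 224) (*-monoʳ-≤ 256 1≤J)) (≤-reflexive (sym q≡))
    identity : ∀ q u d m → 2 * (2 * (d + q * m)) + (4 * (8 * u) + (q * u + u * q)) + 0 ≡ 2 * (q * u) + (4 * d + (q * (4 * m) + u * 32))
    identity = solve-∀

  ratio : 4 * κ * J′ < J * J → 4 * κ * (J′ * t * t) < J * t * (J * t)
  ratio h = begin-strict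
    4 * κ * (J′ * t * t) ≡⟨ identity (4 * κ) J′ t ⟩
    4 * κ * J′ * (t * t) <⟨ *-monoˡ-< (t * t) ⦃ >-nonZero (*-mono-≤ 1≤t 1≤t) ⦄ h ⟩
    J * J * (t * t) ≡⟨ identity′ J t ⟩
    J * t * (J * t) ∎
    where
    open ≤-Reasoning
    identity : ∀ c K t → c * (K * t * t) ≡ c * K * (t * t)
    identity = solve-∀
    identity′ : ∀ J t → J * J * (t * t) ≡ J * t * (J * t)
    identity′ = solve-∀

sampled-subdivision : ∀ H G {d q m₀ r} (O : Orientation G (λ _ → true) d) → Regular G (Orientation.left O) d q m₀ r → ∀ M T → 1 ≤ d → 1 ≤ q → 1 ≤ M → 1 ≤ T →
  88 * d ≤ M → 512 * (d * (d * d)) ≤ M * (M * T) → 8 * (2 * d + r) ≤ q * T → 2 * (d + q * m₀) ≤ q * r →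
  4 * (2 * maderBound (order H) (forwardEdges H)) * (M * T) < r * r → ContainsInducedSubdivision H G
sampled-subdivision H G O Reg (suc k) (suc l) 1≤d 1≤q _ _ h₁ h₂ h₃ h₄ h₅ =
  let α , β , many = Sampling.good-sample G O Reg k l κ 1≤d 1≤q h₁ h₂ h₃ h₄ h₅ in embed α β many
  where
  es = forwardEdges H
  κ : ℕ
  κ = 2 * maderBound (order H) es
  open Sampling G O Reg k l κ 1≤d 1≤q h₁ h₂ h₃ h₄ h₅
  embed : ∀ α β → κ * sampleSize α β < #good α β → ContainsInducedSubdivision H G
  embed α β many = Assemble.subdivision H G incidence (Mader.mader F (λ {u} {v} → F-sym {u} {v}) F-irrefl es (forwardEdges-distinct H) W W-nonempty (<⇒≤ dense-F)) (forwardEdges-complete H)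
    where open Extract α β many

dense-pair-subdivision : ∀ H G s (1≤s : 1 ≤ s) → ¬ ContainsKss s G → ∀ q → 1 ≤ q → ∀ (X Y : Fin (order G) → Bool) →
  candidateSize s (order H) (order H) q ≤ # X → typeSize s (threshold s (order H * order H)) (order H) q ≤ # Y →
  (∀ x → X x ≡ true → # Y ≤ q * # (λ y → Y y ∧ adj G x y)) → ContainsInducedSubdivision H G
dense-pair-subdivision H G s 1≤s noKss q 1≤q X Y bigX bigY dense = Assemble.subdivision H G
  (DensePair.dense-pair G s 1≤s noKss (order H) q X Y 1≤q bigX bigY dense) (topMinor-complete (forwardEdges H) (forwardEdges-distinct H)) (forwardEdges-complete H)

module DegreeBound (H : Graph) where

  κ : ℕ
  κ = 2 * maderBound (order H) (forwardEdges H)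

  abstract
    j J J′ q : ℕ
    -- With `x = suc j`, the summand `4 κ` gives `4 κ x ^ 7 < x ^ 8`, which is `ratio-J`. The
    -- summand 512 gives `704 ≤ x ^ 3`, and `512 * 512 ≤ x ^ 2`, the factor by which `J′ * J′`
    -- exceeds the cube of `J`.
    j  = 512 + 4 * κ
    J  = suc j ^ 4
    J′ = suc j ^ 7
    q  = 256 * J

    q≡256J : q ≡ 256 * J
    q≡256J = refl

    1≤J : 1 ≤ J
    1≤J = m^n>0 (suc j) 4

    1≤J′ : 1 ≤ J′
    1≤J′ = m^n>0 (suc j) 7

    512≤j : 512 ≤ suc j
    512≤j = ≤-trans (m≤m+n 512 (4 * κ)) (n≤1+n j)

    704J≤J′ : 704 * J ≤ J′
    704J≤J′ = bound (suc j) 512≤j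
      where
      bound : ∀ x → 512 ≤ x → 704 * x ^ 4 ≤ x ^ 7
      bound x p = begin
        704 * x ^ 4 ≤⟨ *-monoˡ-≤ (x ^ 4) (≤-trans (m≤m+n 704 (512 * 512 ∸ 704)) (*-mono-≤ p p)) ⟩
        x * x * x ^ 4 ≤⟨ m≤n*m (x * x * x ^ 4) x ⦃ >-nonZero (≤-trans (s≤s z≤n) p) ⦄ ⟩
        x * (x * x * x ^ 4) ≡⟨ cong (x *_) (*-assoc x x (x ^ 4)) ⟩
        x ^ 7 ∎
        where open ≤-Reasoning

    J³≤J′² : 512 * (512 * (J * (J * J))) ≤ J′ * J′
    J³≤J′² = bound (suc j) 512≤j
      where
      identity : ∀ x y → x * (x * (y * (y * y))) ≡ x * x * (y * y * y)
      identity = solve-∀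
      powers : ∀ x → x * (x * (x ^ 4 * (x ^ 4 * x ^ 4))) ≡ x ^ 7 * x ^ 7
      powers x = trans (cong (λ z → x * (x * z)) (trans (cong (x ^ 4 *_) (sym (^-distribˡ-+-* x 4 4))) (sym (^-distribˡ-+-* x 4 8)))) (^-distribˡ-+-* x 7 7)
      bound : ∀ x → 512 ≤ x → 512 * (512 * (x ^ 4 * (x ^ 4 * x ^ 4))) ≤ x ^ 7 * x ^ 7
      bound x p = ≤-trans (*-mono-≤ p (*-monoˡ-≤ (x ^ 4 * (x ^ 4 * x ^ 4)) p)) (≤-reflexive (powers x))

    ratio-J : 4 * κ * J′ < J * J
    ratio-J = ≤-trans (*-monoˡ-< J′ ⦃ >-nonZero 1≤J′ ⦄ (s≤s (m≤n+m (4 * κ) 512))) (≤-reflexive (sym (trans (sym (^-distribˡ-+-* (suc j) 4 4)) refl)))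

  -- The sizes at which a pair of density `1 / (8 q)` yields the subdivision; `q` does not depend on
  -- `s`.
  m₀ : ℕ → ℕ
  m₀ s = candidateSize s (order H) (order H) (8 * q) + typeSize s (threshold s (order H * order H)) (order H) (8 * q)

  -- The three summands secure in turn `4 m₀ < t`, `q m₀ ≤ d` and `6 m₀ < d`.
  degree : ℕ → ℕ
  degree s = 4 * J * suc (4 * m₀ s) + q * m₀ s + 6 * m₀ s

  monomial-degree : Monomial degree
  monomial-degree = monomial-+ (monomial-+ (monomial-* (monomial-const (4 * J)) (monomial-+ (monomial-const 1) (monomial-* (monomial-const 4) monomial-m₀))) (monomial-* (monomial-const q) monomial-m₀)) (monomial-* (monomial-const 6) monomial-m₀)
    where
    monomial-m₀ : Monomial m₀
    monomial-m₀ = monomial-+ (monomial-candidateSize (order H) (order H) (monomial-const (8 * q))) (monomial-typeSize (monomial-threshold (order H * order H)) (order H) (monomial-const (8 * q)))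

  dense-subdivision : ∀ s → 1 ≤ s → ∀ G → ¬ ContainsKss s G → ¬ ContainsInducedSubdivision H G → ∀ d → degree s < d → ∃ (Degeneracy.Dense G d) → ¬ Orientation G (λ _ → true) d
  dense-subdivision s 1≤s G noKss none d degree<d (S , D) O = none (sampled-subdivision H G O
      (Regularise.regular G O S D 1≤q qm₀≤d 6m₀<d 4r≤d m₀≤r sparse) (J′ * t) t (≤-trans (s≤s z≤n) degree<d) 1≤q (*-mono-≤ 1≤J′ 1≤t) 1≤t
      (P.sampling-rate₁ 704J≤J′) (P.sampling-rate₂ J³≤J′²) P.rivals P.triples (P.ratio ratio-J))
    where
    m t : ℕ
    m = m₀ s
    instance
      4J≢0 = >-nonZero (*-mono-≤ {1} {4} (s≤s z≤n) 1≤J)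
    -- Since `t` is positive, rounding down costs at most a factor 2: `d` lies between `4 J t` and
    -- `8 J t`.
    t = d / (4 * J)
    1≤q : 1 ≤ q
    1≤q = ≤-trans (≤-trans 1≤J (m≤n*m J 256)) (≤-reflexive (sym q≡256J))
    4m<t : suc (4 * m) ≤ t
    4m<t = ≤-trans (≤-reflexive (sym (m*n/m≡n′))) (/-monoˡ-≤ (4 * J) (≤-trans (≤-trans (m≤m+n (4 * J * suc (4 * m)) (q * m)) (m≤m+n _ (6 * m))) (<⇒≤ degree<d)))
      where
      m*n/m≡n′ : (4 * J * suc (4 * m)) / (4 * J) ≡ suc (4 * m)
      m*n/m≡n′ = trans (cong (_/ (4 * J)) (*-comm (4 * J) (suc (4 * m)))) (m*n/n≡m (suc (4 * m)) (4 * J))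
    1≤t : 1 ≤ t
    1≤t = ≤-trans (s≤s z≤n) 4m<t
    4r≤d : 4 * (J * t) ≤ d
    4r≤d = ≤-trans (≤-reflexive (identity J t)) (m/n*n≤m d (4 * J))
      where
      identity : ∀ J t → 4 * (J * t) ≡ t * (4 * J)
      identity = solve-∀
    d≤8r : d ≤ 8 * (J * t)
    d≤8r = begin
      d ≡⟨ m≡m%n+[m/n]*n d (4 * J) ⟩
      d % (4 * J) + t * (4 * J) ≤⟨ +-monoˡ-≤ (t * (4 * J)) (<⇒≤ (m%n<n d (4 * J))) ⟩
      4 * J + t * (4 * J) ≤⟨ linear 0 (*-monoʳ-≤ (4 * J) 1≤t) (identity J t) ⟩
      8 * (J * t) ∎
      where
      open ≤-Reasoning
      identity : ∀ J t → 4 * J + t * (4 * J) + 4 * J * t + 0 ≡ 8 * (J * t) + 4 * J * 1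
      identity = solve-∀
    qm₀≤d : q * m ≤ d
    qm₀≤d = ≤-trans (≤-trans (m≤n+m (q * m) (4 * J * suc (4 * m))) (m≤m+n _ (6 * m))) (<⇒≤ degree<d)
    6m₀<d : 6 * m < d
    6m₀<d = ≤-<-trans (m≤n+m (6 * m) (4 * J * suc (4 * m) + q * m)) degree<d
    m₀≤r : m ≤ J * t
    m₀≤r = ≤-trans (≤-trans (m≤n*m m 4) (<⇒≤ 4m<t)) (m≤n*m t J ⦃ >-nonZero 1≤J ⦄)
    module P = Parameters J J′ q t d m κ 1≤J 1≤t q≡256J d≤8r (<⇒≤ 4m<t)
    sparse : ∀ (X Y : Fin (order G) → Bool) → m ≤ # X → m ≤ # Y → ¬ (∀ x → X x ≡ true → # Y ≤ 8 * q * # (λ y → Y y ∧ adj G x y))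
    sparse X Y m≤X m≤Y dense = none (dense-pair-subdivision H G s 1≤s noKss (8 * q) (*-mono-≤ {1} {8} (s≤s z≤n) 1≤q) X Y
      (≤-trans (m≤m+n _ _) m≤X) (≤-trans (m≤n+m _ (candidateSize s (order H) (order H) (8 * q))) m≤Y) dense)

  polynomial : Poly
  polynomial = proj₁ (monomial-poly (2 * Monomial.coefficient monomial-degree) (Monomial.exponent monomial-degree))

  2*degree≤polynomial : ∀ s → 1 ≤ s → 2 * degree s ≤ eval polynomial s
  2*degree≤polynomial s 1≤s = ≤-trans (*-monoʳ-≤ 2 (Monomial.bounds monomial-degree s 1≤s))
    (≤-reflexive (trans (sym (*-assoc 2 (Monomial.coefficient monomial-degree) _)) (sym (proj₂ (monomial-poly (2 * Monomial.coefficient monomial-degree) (Monomial.exponent monomial-degree)) s))))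

theorem1p1 : (H : Graph) → Σ Poly λ p →
    (s : ℕ) → 1 ≤ s → (G : Graph) →
    ¬ ContainsKss s G → ¬ ContainsInducedSubdivision H G →
    AvgDegAtMost G (eval p s)
theorem1p1 H = polynomial , λ s 1≤s G noKss none → case Degeneracy.dense-or-sparse G (degree s) of λ
  { (inj₁ sparse) → ≤-trans sparse (*-monoˡ-≤ (order G) (2*degree≤polynomial s 1≤s))
  ; (inj₂ (d , degree<d , D , O)) → ⊥-elim (dense-subdivision s 1≤s G noKss none d degree<d D O) }
  where open DegreeBound H
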